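{- For every finite multiset $S$ of integers and every $d\ge 0$, \[ \mathsf{DS}(S,d;\mathbf{x})=\sum_P s_{\lambda(P)'}(\mathbf{x}), \] where $P$ ranges over all Dyck tableaux with entries the multiset $S$ and $\mathrm{di}(\mathrm{RR}(P))=d$, and $\lambda(P)'$ denotes the conjugate partition of the shape $\lambda(P)$.
   Context: Sequences are finite integer sequences indexed from $0$, possibly empty; $|F|$ is the length of $F$. For $x=(x_0,\ldots,x_{m-1})$, $\mathrm{di}(x)=\#\{(i,j):0\le i<j<m,\ x_i=x_j+1\}$. A sequence $x$ is affine Dyck if $x_{i+1}\le x_i+1$ for all $0\le i<m-1$, and dual Dyck if $x_{i+1}\ge x_i+2$ for all $0\le i<m-1$. A factorization of $S$ is an ordered sequence $\mathcal F=(F_0,F_1,F_2,\ldots)$ of finite sequences, all but finitely many empty, such that the concatenation $F_0F_1F_2\cdots$ is a permutation (rearrangement) of the multiset $S$; it is an affine Dyck factorization if each $F_i$ is an affine Dyck sequence, and $\mathrm{di}(\mathcal F)=\mathrm{di}(F_0F_1F_2\cdots)$. Variables are $\mathbf{x}=(x_0,x_1,x_2,\ldots)$. The (affine) Dyck symmetric function is \[ \mathsf{DS}(S,d;\mathbf{x})=\sum_{\mathcal F}\ \prod_{r\ge0}x_r^{|F_r|}, \] the sum over affine Dyck factorizations $\mathcal F$ of $S$ with $\mathrm{di}(\mathcal F)=d$. A Dyck tableau is a left-aligned tableau with rows $T_0,T_1,\ldots,T_{\ell-1}$ from top to bottom (nonempty rows; the tableau with no rows is allowed), with $|T_0|\ge|T_1|\ge\cdots\ge|T_{\ell-1}|$,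 such that each row read left to right is a dual Dyck sequence, and whenever adjacent rows $T_j$ and $T_{j+1}$ both have an entry in column $p$, $T_j[p]\le T_{j+1}[p]+1$. Its row-reading word is $\mathrm{RR}(P)=T_{\ell-1}T_{\ell-2}\cdots T_0$ (rows read left to right, bottom row first). Its shape $\lambda(P)$ is the partition of row lengths. $s_\lambda(\mathbf x)$ is the Schur function in the variables $x_0,x_1,x_2,\ldots$. -}

module Defs where

open import Data.Integer using (ℤ; 1ℤ; +_)
import Data.Integer as ℤ
open import Data.List
  using (List; []; _∷_; _++_; map; concat; filter; length; reverse; upTo; zip;
         foldr; deduplicate; cartesianProductWith)
open import Data.List.Properties using (≡-dec; ∷-injective; filter-none; length-++)
open import Data.List.Membership.Propositional using (_∈_)
open import Data.List.Membership.Propositional.Properties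
  using (∈-filter⁺; ∈-filter⁻; ∈-cartesianProductWith⁺; ∈-cartesianProductWith⁻;
         ∈-deduplicate⁺; ∈-∃++; ∈-upTo⁺)
import Data.List.Membership.DecPropositional as DecMembership
open import Data.List.Relation.Binary.Permutation.Propositional
  using (_↭_; ↭-refl; ↭-sym; ↭-trans; prep)
open import Data.List.Relation.Binary.Permutation.Propositional.Properties
  using (shift; drop-∷; ∈-resp-↭; ↭-length)
open import Data.List.Relation.Unary.All as All using (All; []; _∷_)
open import Data.List.Relation.Unary.All.Properties using (concat⁻)
open import Data.List.Relation.Unary.AllPairs using ([]; _∷_)
open import Data.List.Relation.Unary.Any using (here; there)
open import Data.List.Relation.Unary.Linked using (Linked; linked?)
open import Data.List.Relation.Unary.Unique.Propositional using (Unique)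
import Data.List.Relation.Unary.Unique.Propositional.Properties as Unique
import Data.List.Relation.Unary.Unique.DecPropositional.Properties as DecUnique
open import Data.Nat using (ℕ; zero; suc; _+_; _≤_; _<_; _≥_; _⊔_; z≤n; s≤s; _≟_; _≤?_; _<?_)
open import Data.Nat.ListAction using (sum)
open import Data.Nat.Properties
  using (≤-trans; ≤-reflexive; m≤m+n; m≤n+m; +-mono-≤; ≮⇒≥; allUpTo?)
open import Data.Product using (_×_; _,_; proj₁; proj₂; uncurry)
open import Function using (flip)
open import Relation.Binary.Definitions using (DecidableEquality)
open import Relation.Binary.PropositionalEquality
  using (_≡_; refl; sym; trans; cong; subst)
open import Relation.Nullary using (Dec; yes; no; ¬_; contradiction; map′; _×-dec_)
open import Relation.Unary using (Decidable)

------------------------------------------------------------------------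
-- Sequences.  A finite multiset is a list up to the permutation relation _↭_.

Sequence : Set
Sequence = List ℤ

di : Sequence → ℕ
di []       = 0
di (x ∷ xs) = length (filter (λ y → x ℤ.≟ y ℤ.+ 1ℤ) xs) + di xs

AffineDyck : Sequence → Set
AffineDyck = Linked (λ x y → y ℤ.≤ x ℤ.+ 1ℤ)

DualDyck : Sequence → Set
DualDyck = Linked (λ x y → y ℤ.≥ x ℤ.+ + 2)

------------------------------------------------------------------------
-- Affine Dyck factorizations, Dyck tableaux, semistandard tableaux

-- The list F₀ ∷ … ∷ Fₙ₋₁ ∷ [] stands for the infinite sequence in which every
-- later factor is empty.  It is not a unique representation, but it becomes one
-- once the number of listed factors is fixed, as it is in DS below.
record IsAffineDyckFactorization (S : Sequence) (F : List Sequence) : Set where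
  field
    rearranges : concat F ↭ S
    affineDyck : All AffineDyck F

-- R is a row placed directly above the row R′; zip pairs off the entries of the
-- columns that occur in both.
Columns : {A : Set} → (A → A → Set) → List (List A) → Set
Columns _~_ = Linked (λ R R′ → All (uncurry _~_) (zip R R′))

shape : {A : Set} → List (List A) → List ℕ
shape = map length

record IsDyckTableau (T : List Sequence) : Set where
  field
    nonempty   : All (λ R → 0 < length R) T
    decreasing : Linked _≥_ (shape T)
    rows       : All DualDyck T
    columns    : Columns (λ x y → x ℤ.≤ y ℤ.+ 1ℤ) T

RR : List Sequence → Sequence
RR T = concat (reverse T)

record IsSSYT (μ : List ℕ) (T : List (List ℕ)) : Set where
  field
    hasShape : shape T ≡ μ
    rows     : All (Linked _≤_) T
    columns  : Columns _<_ T

-- Column j has one cell for each part exceeding j.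
conjugate : List ℕ → List ℕ
conjugate μ = map (λ j → length (filter (j <?_) μ)) (upTo (foldr _⊔_ 0 μ))

------------------------------------------------------------------------
-- Finite sets, given by a repetition-free list of exactly their elements.  By
-- these fields, sizes and sums over them do not depend on the list chosen.

record Enumeration {A : Set} (P : A → Set) : Set where
  field
    list     : List A
    unique   : Unique list
    sound    : ∀ {x} → x ∈ list → P x
    complete : ∀ {x} → P x → x ∈ list

open Enumeration public

#_ : {A : Set} {P : A → Set} → Enumeration P → ℕ
# E = length (list E)

private
  variable
    A : Set
    P Q : A → Set

  restrict : Decidable Q → (∀ {x} → Q x → P x) → Enumeration P → Enumeration Q
  restrict Q? Q⇒P E = record
    { list     = filter Q? (list E)
    ; unique   = Unique.filter⁺ Q? (unique E)
    ; sound    = λ x∈ → proj₂ (∈-filter⁻ Q? {xs = list E} x∈)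
    ; complete = λ q → ∈-filter⁺ Q? (complete E (Q⇒P q)) q
    }

  Bounded : ℕ → (A → Set) → List A → Set
  Bounded n P xs = length xs ≤ n × All P xs

  lists≤ : ∀ n → Enumeration P → Enumeration (Bounded n P)
  lists≤ zero E = record
    { list     = [] ∷ []
    ; unique   = [] ∷ []
    ; sound    = λ { (here refl) → z≤n , [] }
    ; complete = λ { {[]} _ → here refl ; {_ ∷ _} (() , _) }
    }
  lists≤ {P = P} (suc n) E = record
    { list     = [] ∷ conses
    ; unique   = All.tabulate []∉ ∷
                 Unique.cartesianProductWith⁺ _∷_ ∷-injective (unique E) (unique E′)
    ; sound    = snd
    ; complete = cmp
    }
    where
    E′ = lists≤ n E
    conses = cartesianProductWith _∷_ (list E) (list E′)
    []∉ : ∀ {xs} → xs ∈ conses → ¬ [] ≡ xs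
    []∉ xs∈ eq with ∈-cartesianProductWith⁻ _∷_ (list E) (list E′) xs∈
    ... | _ , _ , _ , _ , refl with () ← eq
    snd : ∀ {xs} → xs ∈ [] ∷ conses → Bounded (suc n) P xs
    snd (here refl) = z≤n , []
    snd (there xs∈) with ∈-cartesianProductWith⁻ _∷_ (list E) (list E′) xs∈
    ... | _ , _ , y∈ , ys∈ , refl with l , ps ← sound E′ ys∈ = s≤s l , sound E y∈ ∷ ps
    cmp : ∀ {xs} → Bounded (suc n) P xs → xs ∈ [] ∷ conses
    cmp {[]}     _               = here refl
    cmp {x ∷ xs} (s≤s l , p ∷ ps) =
      there (∈-cartesianProductWith⁺ _∷_ (complete E p) (complete E′ (l , ps)))

  module _ (_≟A_ : DecidableEquality A) where

    open DecMembership _≟A_ using (_∈?_)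

    support : (xs : List A) → Enumeration (_∈ xs)
    support xs = restrict (_∈? xs) (∈-deduplicate⁺ _≟A_) record
      { list     = deduplicate _≟A_ xs
      ; unique   = DecUnique.deduplicate-! _≟A_ xs
      ; sound    = λ x∈ → x∈
      ; complete = λ x∈ → x∈
      }

    ↭-dec : (xs ys : List A) → Dec (xs ↭ ys)
    ↭-dec []       []      = yes ↭-refl
    ↭-dec []       (_ ∷ _) = no λ p → contradiction (↭-length p) λ ()
    ↭-dec (x ∷ xs) ys with x ∈? ys
    ... | no x∉ = no λ p → x∉ (∈-resp-↭ p (here refl))
    ... | yes x∈ with us , vs , refl ← ∈-∃++ x∈ =
      map′ (λ p → ↭-trans (prep x p) (↭-sym (shift x us vs)))
           (λ p → drop-∷ (↭-trans p (shift x us vs)))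
           (↭-dec xs (us ++ vs))

    -- All tableaux with at most m rows, all of length at most n, with entries in xs.
    grids : ∀ m n (xs : List A) → Enumeration (Bounded m (Bounded n (_∈ xs)))
    grids m n xs = lists≤ m (lists≤ n (support xs))

  row-length≤ : (F : List (List A)) → All (λ R → length R ≤ length (concat F)) F
  row-length≤ []      = []
  row-length≤ (R ∷ F) rewrite length-++ R {concat F} =
    m≤m+n _ _ ∷ All.map (λ l → ≤-trans l (m≤n+m _ (length R))) (row-length≤ F)

  rows≤ : (F : List (List A)) → All (λ R → 0 < length R) F → length F ≤ length (concat F)
  rows≤ []      []       = z≤n
  rows≤ (R ∷ F) (p ∷ ps) rewrite length-++ R {concat F} = +-mono-≤ p (rows≤ F ps)

  bounded : ∀ {m n} {F : List (List A)} → length F ≤ m → length (concat F) ≤ n →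
            All P (concat F) → Bounded m (Bounded n P) F
  bounded {F = F} r c ps =
    r , All.zipWith (λ (l , qs) → ≤-trans l c , qs) (row-length≤ F , concat⁻ ps)

  ↭-bounded : ∀ {m} {F : List (List A)} {xs} → length F ≤ m → concat F ↭ xs →
              Bounded m (Bounded (length xs) (_∈ xs)) F
  ↭-bounded r p = bounded r (≤-reflexive (↭-length p)) (All.tabulate (∈-resp-↭ p))

  length-shape : (F : List (List A)) → length (shape F) ≡ length F
  length-shape []      = refl
  length-shape (_ ∷ F) = cong suc (length-shape F)

  sum-shape : (F : List (List A)) → length (concat F) ≡ sum (shape F)
  sum-shape []      = refl
  sum-shape (R ∷ F) = trans (length-++ R) (cong (λ k → length R + k) (sum-shape F))

  columns? : {_~_ : A → A → Set} → (∀ x y → Dec (x ~ y)) → Decidable (Columns _~_)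
  columns? _~?_ = linked? (λ R R′ → All.all? (λ (x , y) → x ~? y) (zip R R′))

------------------------------------------------------------------------
-- Formal power series in x₀, x₁, x₂, …

-- A series is given by its coefficients.  The list α₀ ∷ … ∷ αₙ₋₁ ∷ [] denotes the
-- monomial x₀^α₀ ⋯ xₙ₋₁^αₙ₋₁, all later variables having exponent 0, so every
-- monomial is denoted by some list (by several, differing in trailing zeros).
Monomial : Set
Monomial = List ℕ

exponent : Monomial → ℕ → ℕ
exponent []      _       = 0
exponent (a ∷ α) zero    = a
exponent (a ∷ α) (suc i) = exponent α i

Series : Set
Series = Monomial → ℕ

infix 4 _≈_
_≈_ : Series → Series → Set
f ≈ g = ∀ α → f α ≡ g α

∑ : {A : Set} {P : A → Set} → Enumeration P → (A → Series) → Series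
∑ E f α = sum (map (λ x → f x α) (list E))

------------------------------------------------------------------------
-- Dyck symmetric functions

-- The factorizations F with di F = d and monomial ∏ᵣ xᵣ^|Fᵣ| equal to α.  The
-- factors beyond the length of α are forced to be empty and are not listed.
factorizations : (S : Sequence) (d : ℕ) (α : Monomial) →
  Enumeration (λ F → IsAffineDyckFactorization S F × di (concat F) ≡ d × map length F ≡ α)
factorizations S d α =
  restrict
    (λ F → map′ (λ (p , a) → record { rearranges = p ; affineDyck = a })
                (λ p → let open IsAffineDyckFactorization p in rearranges , affineDyck)
                (↭-dec ℤ._≟_ (concat F) S ×-dec
                 All.all? (linked? (λ x y → y ℤ.≤? x ℤ.+ 1ℤ)) F)
           ×-dec di (concat F) ≟ d
           ×-dec ≡-dec _≟_ (map length F) α)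
    (λ { {F} (p , _ , refl) →
         ↭-bounded (≤-reflexive (sym (length-shape F)))
                   (IsAffineDyckFactorization.rearranges p) })
    (grids ℤ._≟_ (length α) (length S) S)

DS : Sequence → ℕ → Series
DS S d α = # factorizations S d α

------------------------------------------------------------------------
-- Schur functions

multiplicity : ℕ → List ℕ → ℕ
multiplicity i xs = length (filter (i ≟_) xs)

-- The monomial of T, the product of x_i over its entries i, is α.
HasContent : Monomial → List (List ℕ) → Set
HasContent α T = ∀ i → multiplicity i (concat T) ≡ exponent α i

private
  exponent≥ : ∀ α {i} → length α ≤ i → exponent α i ≡ 0
  exponent≥ []      _       = refl
  exponent≥ (_ ∷ α) (s≤s l) = exponent≥ α l

  multiplicity-∈ : ∀ {i xs} → i ∈ xs → ¬ multiplicity i xs ≡ 0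
  multiplicity-∈ {i} {xs} i∈ eq
    with filter (i ≟_) xs | ∈-filter⁺ (i ≟_) i∈ refl
  multiplicity-∈ i∈ () | _ ∷ _ | _

  entries< : ∀ {α T} → HasContent α T → All (_< length α) (concat T)
  entries< {α} {T} h = All.tabulate lt
    where
    lt : ∀ {i} → i ∈ concat T → i < length α
    lt {i} i∈ with i <? length α
    ... | yes l = l
    ... | no ≮  =
      contradiction (trans (h i) (exponent≥ α (≮⇒≥ ≮))) (multiplicity-∈ i∈)

  hasContent? : ∀ α → Decidable (HasContent α)
  hasContent? α T =
    map′ to (λ h → entries< {α} {T} h , λ {i} _ → h i)
      (All.all? (_<? length α) (concat T) ×-dec
       allUpTo? (λ i → multiplicity i (concat T) ≟ exponent α i) (length α))
    where
    to : All (_< length α) (concat T) ×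
         (∀ {i} → i < length α → multiplicity i (concat T) ≡ exponent α i) →
         HasContent α T
    to (lt , h) i with i <? length α
    ... | yes l = h l
    ... | no ≮  = trans
      (cong length (filter-none (i ≟_) (All.map (λ { l refl → ≮ l }) lt)))
      (sym (exponent≥ α (≮⇒≥ ≮)))

semistandard : (μ : List ℕ) (α : Monomial) →
  Enumeration (λ T → IsSSYT μ T × HasContent α T)
semistandard μ α =
  restrict
    (λ T → map′ (λ (h , r , c) → record { hasShape = h ; rows = r ; columns = c })
                (λ t → let open IsSSYT t in hasShape , rows , columns)
                (≡-dec _≟_ (shape T) μ ×-dec
                 All.all? (linked? _≤?_) T ×-dec
                 columns? _<?_ T)
           ×-dec hasContent? α T)
    (λ { {T} (record { hasShape = refl } , h) →
         bounded (≤-reflexive (sym (length-shape T))) (≤-reflexive (sum-shape T))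
                 (All.map ∈-upTo⁺ (entries< {α} {T} h)) })
    (grids _≟_ (length μ) (sum μ) (upTo (length α)))

-- The Schur function s_μ of a partition μ, listed as its decreasing positive parts.
schur : List ℕ → Series
schur μ α = # semistandard μ α

------------------------------------------------------------------------
-- Dyck tableaux with given entries and di of the reading word

dyckTableaux : (S : Sequence) (d : ℕ) →
  Enumeration (λ T → IsDyckTableau T × concat T ↭ S × di (RR T) ≡ d)
dyckTableaux S d =
  restrict
    (λ T → map′ (λ (n , e , r , c) → record
                   { nonempty = n ; decreasing = e ; rows = r ; columns = c })
                (λ t → let open IsDyckTableau t in nonempty , decreasing , rows , columns)
                (All.all? (λ R → 0 <? length R) T ×-dec
                 linked? (flip _≤?_) (shape T) ×-dec
                 All.all? (linked? (λ x y → x ℤ.+ + 2 ℤ.≤? y)) T ×-dec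
                 columns? (λ x y → x ℤ.≤? y ℤ.+ 1ℤ) T)
           ×-dec ↭-dec ℤ._≟_ (concat T) S
           ×-dec di (RR T) ≟ d)
    (λ {T} (t , p , _) →
       ↭-bounded (subst (length T ≤_) (↭-length p) (rows≤ T (IsDyckTableau.nonempty t))) p)
    (grids ℤ._≟_ (length S) (length S) S)

{-# OPTIONS --safe #-}
module Submission where

open import Defs
import Algebra.Solver.CommutativeMonoid as CMSolver
open import Data.Bool using (Bool; true; false; not)
open import Data.Bool.Properties using (not-involutive)
open import Data.Empty using (⊥; ⊥-elim)
open import Data.Integer using (ℤ; 1ℤ; -[1+_]) renaming (+_ to pos)
import Data.Integer as ℤ
import Data.Integer.Properties as ℤ
open import Algebra.Properties.AbelianGroup ℤ.+-0-abelianGroup using (∙-cancelˡ)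
open import Data.List
  using (List; []; _∷_; _∷ʳ_; _++_; length; map; filter; concat; reverse; replicate; upTo;
         applyUpTo; zip; zipWith; take; drop; foldr; cartesianProductWith)
open import Data.List.Properties
  using (++-assoc; ++-identityʳ; concat-++; filter-++; filter-accept; filter-all; filter-none;
         filter-reject; length-++; length-applyUpTo; length-drop; length-filter; length-map;
         length-replicate; length-take; length-zipWith; map-++; map-cong-local; map-upTo; map-∘;
         reverse-++; reverse-involutive; take++drop≡id; unfold-reverse; ∷-injective; ∷ʳ-++; ≡-dec)
open import Data.List.Membership.DecPropositional ℤ._≟_ using (_∈?_)
open import Data.List.Membership.Propositional using (_∈_)
open import Data.List.Membership.Propositional.Properties
  using (∈-++⁺ˡ; ∈-++⁺ʳ; ∈-++⁻; ∈-cartesianProductWith⁺; ∈-cartesianProductWith⁻; ∈-filter⁺;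
         ∈-filter⁻; ∈-map⁺; ∈-map⁻; ∈-upTo⁺; ∈-upTo⁻; ∈-∃++)
open import Data.List.Relation.Binary.Permutation.Propositional
  using (_↭_; prep; ↭-refl; ↭-reflexive; ↭-sym; ↭-trans; ↭⇒↭ₛ)
open import Data.List.Relation.Binary.Permutation.Propositional.Properties as ↭
  using (shift; ∈-resp-↭)
import Data.List.Relation.Binary.Permutation.Setoid.Properties as ↭ₛ
open import Data.List.Relation.Unary.All as All using (All; []; _∷_)
import Data.List.Relation.Unary.All.Properties as All
open import Data.List.Relation.Unary.AllPairs using ([]; _∷_)
open import Data.List.Relation.Unary.Any using (here; there)
open import Data.List.Relation.Unary.Linked as Linked using (Linked; []; [-]; _∷_; linked?)
import Data.List.Relation.Unary.Linked.Properties as Linked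
open import Data.List.Relation.Unary.Unique.Propositional using (Unique)
import Data.List.Relation.Unary.Unique.Propositional.Properties as Unique
open import Data.Nat
open import Data.Nat.ListAction using (sum)
open import Data.Nat.ListAction.Properties using (sum-++; sum-↭)
open import Data.Nat.Properties
open import Algebra.Properties.CommutativeSemigroup +-commutativeSemigroup
  using (interchange; x∙yz≈y∙xz)
open import Data.Product using (∃; _×_; _,_; proj₁; proj₂; swap; uncurry)
open import Data.Sum using (_⊎_; inj₁; inj₂; [_,_]′)
open import Data.Unit using (⊤; tt)
open import Function using (_∘_; id)
open import Relation.Binary.Definitions using (tri<; tri≈; tri>)
open import Relation.Binary.PropositionalEquality
open import Relation.Nullary using (¬_; Dec; yes; no; contradiction; map′; ¬?; _×-dec_)
open import Relation.Unary using (Decidable)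

-- Write a row with gaps at least 2 as the bit string of its entries.  The words e(k) := the sum
-- of all dual Dyck words of length k, h(k) := the sum of all affine Dyck words of length k and
-- N(λ) := the sum of RR(P) over the Dyck tableaux P of shape λ are compared modulo the congruence
-- on words "same content and same di".
--
-- (1) N(λ) e(k) = Σ N(μ) over the horizontal strips μ/λ of size k.  Two rows L, R decompose into
-- runs of consecutive integers that alternate between L and R.  The runs of odd length behave as
-- a queue: one that starts in R is an arrival, one that starts in L serves a waiting arrival, or
-- is moved to the other row if nobody waits.  This turns L R into a congruent word A B.  A chain
-- is inserted into a tableau by passing it through the rows from top to bottom.  That this
-- respects the column condition follows from one inequality on two consecutive queues: the number
-- of moved runs up to any given integer is at least as large in the upper one.  Reading backwards
-- and exchanging the two rows turns each queue into a queue, which gives the inverse.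
--
-- (2) N(λ) h(k) = Σ N(ν) over the vertical strips ν/λ of size k.  In words, e(n) h(k) splits into
-- two hooks according to the step between the factors, one of which also occurs in
-- e(n+1) h(k-1); strips split in the same way according to the last cell of the first row that
-- grows.  So (2) follows from (1) by induction on k.
--
-- (3) Iterating (2) writes DS as a sum of N(ν) over chains of vertical strips; conjugating these
-- shapes gives the chains of horizontal strips that make up the semistandard tableaux.

-- Two rows as a queue

-- A maximal alternating run of 2n+1 integers contributes n to `di` of the two rows whichever row it
-- starts in, while a run of 2n+2 integers contributes n or n+1. Hence only runs of odd length may
-- change rows. All tableaux have a fixed number of rows, each a bit string of a fixed length, with
-- empty rows at the bottom; shapes are padded with zeros accordingly. Starting a new row is then no
-- separate case of the insertion. Instead, the bound `sum lam + k ≤ length lam` provides enough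
-- empty rows for the inserted chain to be used up. The obstacle for the inverse is that a queue can
-- be run backwards only if the number waiting at its right end is known. In a horizontal strip
-- these numbers are the growths of the rows, so the strip itself supplies them; what remains to be
-- proved is that the backward run then reaches every left end with nobody waiting.

pattern O = false
pattern I = true

data Block : Set where
  gap pair : Block
  odd even : Bool → ℕ → Block

data State : Set where
  idle paired left right : ℕ → State
  fleft fright           : State

Row : Set
Row = List Bool

private variable
  X Y : Set
  d d₁ d₂ e e₁ e₂ a k n x : ℕ
  ds es lam κ ν : List ℕ
  s : Bool
  L R A B C C₁ C₂ T₀ T₁ T₀′ T₁′ out : Row
  P P′ Ts Ts′ : List Row
  b c b₁ b₂ c₁ c₂ : List Block
  q₁ q₂ : State

-- Tab x A B e: reading from the left, x + (number of entries of B) − (number of entries of A)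
-- stays positive except that it may vanish just before an entry of B, and it ends at e.  For
-- x = 1 and e > 0 this is the column condition for the row A below the row B.
data Tab : ℕ → List Bool → List Bool → ℕ → Set where
  done    : Tab e [] [] e
  neither : Tab (suc x) A B e → Tab (suc x) (O ∷ A) (O ∷ B) e
  upper   : Tab (suc x) A B e → Tab x (O ∷ A) (I ∷ B) e
  lower   : Tab x A B e → Tab (suc x) (I ∷ A) (O ∷ B) e
  both    : Tab (suc x) A B e → Tab (suc x) (I ∷ A) (I ∷ B) e

-- Path q L R A B e: starting from the state q, the two rows L and R are transformed into A and
-- B, with e arrivals waiting at the end.  The numbers in the states count the waiting arrivals,
-- except that left d stands for d − 1 (which is −1 if the current run has to end in R).
-- The states fleft and fright are those inside a run that is being moved.
data Path : State → (L R A B : List Bool) → ℕ → Set where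
  done    : Path (idle d) [] [] [] [] d
  gap     : Path (idle d) L R A B e → Path (idle d) (O ∷ L) (O ∷ R) (O ∷ A) (O ∷ B) e
  pair    : Path (paired d) L R A B e → Path (idle d) (I ∷ L) (I ∷ R) (I ∷ A) (I ∷ B) e
  pairEnd : Path (idle d) L R A B e → Path (paired d) (O ∷ L) (O ∷ R) (O ∷ A) (O ∷ B) e
  rstart  : Path (right (suc d)) L R A B e → Path (idle d) (O ∷ L) (I ∷ R) (O ∷ A) (I ∷ B) e
  lstart  : Path (left d) L R A B e → Path (idle d) (I ∷ L) (O ∷ R) (I ∷ A) (O ∷ B) e
  flip    : Path fleft L R A B e → Path (idle 0) (I ∷ L) (O ∷ R) (O ∷ A) (I ∷ B) e
  lend    : Path (idle d) L R A B e → Path (left (suc d)) (O ∷ L) (O ∷ R) (O ∷ A) (O ∷ B) e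
  lr      : Path (right d) L R A B e → Path (left d) (O ∷ L) (I ∷ R) (O ∷ A) (I ∷ B) e
  rend    : Path (idle d) L R A B e → Path (right d) (O ∷ L) (O ∷ R) (O ∷ A) (O ∷ B) e
  rl      : Path (left d) L R A B e → Path (right d) (I ∷ L) (O ∷ R) (I ∷ A) (O ∷ B) e
  fend    : Path (idle 0) L R A B e → Path fleft (O ∷ L) (O ∷ R) (O ∷ A) (O ∷ B) e
  flr     : Path fright L R A B e → Path fleft (O ∷ L) (I ∷ R) (I ∷ A) (O ∷ B) e
  frl     : Path fleft L R A B e → Path fright (I ∷ L) (O ∷ R) (O ∷ A) (I ∷ B) e

-- off q k is 1 + k + (number of waiting arrivals in q).
off : State → ℕ → ℕ
off (idle d)   k = suc (d + k)
off (paired d) k = suc (d + k)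
off (left e)   k = e + k
off (right d)  k = suc (d + k)
off fleft      k = suc k
off fright     k = suc k

-- The pairs of states of two consecutive queues in which the last bit of the row C₁ that leaves
-- the first and enters the second agrees.
data Match : State → State → Set where
  ii : Match (idle d) (idle e)
  il : Match (idle d) (left e)
  if : Match (idle d) fleft
  ri : Match (right d) (idle e)
  rl : Match (right d) (left e)
  rf : Match (right d) fleft
  fi : Match fleft (idle e)
  fl : Match fleft (left e)
  ff : Match fleft fleft
  pp : Match (paired d) (paired e)
  pr : Match (paired d) (right e)
  pf : Match (paired d) fright
  lp : Match (left d) (paired e)
  lr : Match (left d) (right e)
  lf : Match (left d) fright
  fp : Match fright (paired e)
  fr : Match fright (right e)
  gg : Match fright fright

-- Counting entries shows why one number `k` serves the old and the new rows. A new row exceeds the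
-- old one by the number waiting; the chain leaving the upper queue is the upper row minus one entry
-- per moved run; the chain entering the lower queue has the length of the lower row, plus those
-- waiting, minus the moved runs. Between blocks the counter is therefore `1 + d₂ + k` for the old
-- rows and `1 + d₁ + k` for the new ones, where `d₁` and `d₂` wait in the upper and lower queue.
-- What has to be controlled is the sign of `k`.
Out : ℕ → List Bool → List Bool → ℕ → ℕ → ℕ → Set
Out x T₁′ T₀′ d₁ d₂ e = ∃ λ k → e ≡ suc (d₂ + k) × Tab x T₁′ T₀′ (suc (d₁ + k))

outN : Out (suc x) T₁′ T₀′ d₁ d₂ e → Out (suc x) (O ∷ T₁′) (O ∷ T₀′) d₁ d₂ e
outN (k , p , t) = k , p , neither t
outU : Out (suc x) T₁′ T₀′ d₁ d₂ e → Out x (O ∷ T₁′) (I ∷ T₀′) d₁ d₂ e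
outU (k , p , t) = k , p , upper t
outL : Out x T₁′ T₀′ d₁ d₂ e → Out (suc x) (I ∷ T₁′) (O ∷ T₀′) d₁ d₂ e
outL (k , p , t) = k , p , lower t
outB : Out (suc x) T₁′ T₀′ d₁ d₂ e → Out (suc x) (I ∷ T₁′) (I ∷ T₀′) d₁ d₂ e
outB (k , p , t) = k , p , both t

-- The run that is being moved in the second queue could never end.
stuck : Path (left 0) T₀ C C₁ T₀′ d₁ → Path fright T₁ C₁ C₂ T₁′ d₂ → Tab 1 T₁ T₀ e → ⊥
stuck (lr (rl p)) (frl (flr q)) (lower (upper t)) = stuck p q t

-- The counter 0 demands an entry of `T₀`, which rules out `rend`, and the state `left 0` rules out
-- `lend`. So neither of the two runs can end before the lists do.
stuck′ : Path (right 0) T₀ C C₁ T₀′ d₁ → Path fleft T₁ C₁ C₂ T₁′ d₂ → Tab 0 T₁ T₀ e → ⊥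
stuck′ (rl p) (flr q) (upper t) = stuck p q t

off-suc : ∀ q k → off q (suc k) ≡ suc (off q k)
off-suc (idle d)   k = cong suc (+-suc d k)
off-suc (paired d) k = cong suc (+-suc d k)
off-suc (left e)   k = +-suc e k
off-suc (right d)  k = cong suc (+-suc d k)
off-suc fleft      k = refl
off-suc fright     k = refl

t⁺ : ∀ q → Tab (suc (off q k)) T₁ T₀ e → Tab (off q (suc k)) T₁ T₀ e
t⁺ q = subst (λ x → Tab x _ _ _) (sym (off-suc q _))
t⁻ : ∀ q → Tab (off q (suc k)) T₁ T₀ e → Tab (suc (off q k)) T₁ T₀ e
t⁻ q = subst (λ x → Tab x _ _ _) (off-suc q _)
o⁻ : ∀ q → Out (off q (suc k)) T₁′ T₀′ d₁ d₂ e → Out (suc (off q k)) T₁′ T₀′ d₁ d₂ e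
o⁻ q = subst (λ x → Out x _ _ _ _ _) (off-suc q _)
o⁺ : ∀ q → Out (suc (off q k)) T₁′ T₀′ d₁ d₂ e → Out (off q (suc k)) T₁′ T₀′ d₁ d₂ e
o⁺ q = subst (λ x → Out x _ _ _ _ _) (sym (off-suc q _))

-- k counts the runs moved by the first queue minus those moved by the second.  The functions
-- excess treat the states in which this difference is temporarily −1, in the middle of a run.
mutual
  tab-path : Match q₁ q₂ → ∀ k → Path q₁ T₀ C C₁ T₀′ d₁ → Path q₂ T₁ C₁ C₂ T₁′ d₂ →
    Tab (off q₂ k) T₁ T₀ e → Out (off q₁ k) T₁′ T₀′ d₁ d₂ e
  tab-path ii k done done done = k , refl , done
  tab-path ii k (gap p) (gap q) (neither t) = outN (tab-path ii k p q t)
  tab-path ii k (gap p) (lstart q) (lower t) = outN (tab-path il k p q t)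
  tab-path (ii {d = d}) (suc k) (gap p) (flip q) (lower t) =
    o⁺ (idle d) (outL (tab-path if k p q t))
  tab-path ii zero (gap p) (flip q) (lower t) = outL (excess₁ p q t)
  tab-path ii k (pair p) (pair q) (both t) = outB (tab-path pp k p q t)
  tab-path ii k (pair p) (rstart q) (upper t) = outB (tab-path pr k p q t)
  tab-path ii k (rstart p) (gap q) (neither t) = outU (tab-path ri k p q t)
  tab-path ii k (rstart p) (lstart q) (lower t) = outU (tab-path rl k p q t)
  tab-path (ii {d = d}) (suc k) (rstart p) (flip q) (lower t) =
    o⁺ (idle d) (outB (tab-path rf k p q t))
  tab-path ii zero (rstart p) (flip q) (lower t) = outB (excess₂ p q t)
  tab-path ii k (lstart p) (pair q) (both t) = outL (tab-path lp k p q t)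
  tab-path ii k (lstart p) (rstart q) (upper t) = outL (tab-path lr k p q t)
  tab-path (ii {e = e}) k (flip p) (gap q) (upper t) =
    outU (tab-path fi (suc k) p q (t⁺ (idle e) t))
  tab-path (ii {e = e}) k (flip p) (lstart q) (both t) =
    outU (tab-path fl (suc k) p q (t⁺ (left e) t))
  tab-path ii k (flip p) (flip q) (both t) = outB (tab-path ff k p q t)
  tab-path il k (gap p) (lend q) (neither t) = outN (tab-path ii k p q t)
  tab-path il k (pair p) (lr q) (upper t) = outB (tab-path pr k p q t)
  tab-path il k (rstart p) (lend q) (neither t) = outU (tab-path ri k p q t)
  tab-path il k (lstart p) (lr q) (upper t) = outL (tab-path lr k p q t)
  tab-path (il {e = suc e}) k (flip p) (lend q) (upper t) =
    outU (tab-path fi (suc k) p q (t⁺ (idle e) t))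
  tab-path if k (gap p) (fend q) (neither t) = outN (tab-path ii k p q t)
  tab-path (if {d = d}) k (pair p) (flr q) (upper t) =
    outU (o⁻ (paired d) (tab-path pf (suc k) p q t))
  tab-path if k (rstart p) (fend q) (neither t) = outU (tab-path ri k p q t)
  tab-path (if {d = d}) k (lstart p) (flr q) (upper t) =
    outN (o⁻ (left d) (tab-path lf (suc k) p q t))
  tab-path if k (flip p) (fend q) (upper t) = outU (tab-path fi (suc k) p q t)
  tab-path ri k (rend p) (gap q) (neither t) = outN (tab-path ii k p q t)
  tab-path ri k (rend p) (lstart q) (lower t) = outN (tab-path il k p q t)
  tab-path (ri {d = d}) (suc k) (rend p) (flip q) (lower t) =
    o⁺ (right d) (outL (tab-path if k p q t))
  tab-path ri zero (rend p) (flip q) (lower t) = outL (excess₁ p q t)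
  tab-path ri k (rl p) (pair q) (both t) = outL (tab-path lp k p q t)
  tab-path ri k (rl p) (rstart q) (upper t) = outL (tab-path lr k p q t)
  tab-path rl k (rend p) (lend q) (neither t) = outN (tab-path ii k p q t)
  tab-path rl k (rl p) (lr q) (upper t) = outL (tab-path lr k p q t)
  tab-path rf k (rend p) (fend q) (neither t) = outN (tab-path ii k p q t)
  tab-path (rf {d = d}) k (rl p) (flr q) (upper t) =
    outN (o⁻ (left d) (tab-path lf (suc k) p q t))
  tab-path fi k (fend p) (gap q) (neither t) = outN (tab-path ii k p q t)
  tab-path fi k (fend p) (lstart q) (lower t) = outN (tab-path il k p q t)
  tab-path fi (suc k) (fend p) (flip q) (lower t) = outL (tab-path if k p q t)
  tab-path fi zero (fend p) (flip q) (lower t) = outL (excess₁ p q t)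
  tab-path (fi {e = e}) (suc k) (flr p) (pair q) (lower t) =
    outL (tab-path fp k p q (t⁻ (left e) t))
  tab-path fi zero (flr p) (pair q) (lower t) = outL (excess₃ p q t)
  tab-path (fi {e = e}) (suc k) (flr p) (rstart q) (neither t) =
    outL (tab-path fr k p q (t⁻ (idle e) t))
  tab-path fi zero (flr p) (rstart q) (neither t) = outL (excess₄ p q t)
  tab-path fl k (fend p) (lend q) (neither t) = outN (tab-path ii k p q t)
  tab-path (fl {e}) (suc k) (flr p) (lr q) t with t⁻ (left e) t
  ... | neither t = outL (tab-path fr k p q t)
  tab-path (fl {zero}) zero (flr p) (lr q) ()
  tab-path (fl {suc e}) zero (flr p) (lr q) (neither t) = outL (excess₄ p q t)
  tab-path ff k (fend p) (fend q) (neither t) = outN (tab-path ii k p q t)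
  tab-path ff k (flr p) (flr q) (neither t) = outN (tab-path gg k p q t)
  tab-path pp k (pairEnd p) (pairEnd q) (neither t) = outN (tab-path ii k p q t)
  tab-path pr k (pairEnd p) (rend q) (neither t) = outN (tab-path ii k p q t)
  tab-path pr k (pairEnd p) (rl q) (lower t) = outN (tab-path il k p q t)
  tab-path (pf {d = d}) (suc k) (pairEnd p) (frl q) (lower t) =
    o⁺ (paired d) (outL (tab-path if k p q t))
  tab-path pf zero (pairEnd p) (frl q) (lower t) = outL (excess₁ p q t)
  tab-path lp k (lend p) (pairEnd q) (neither t) = outN (tab-path ii k p q t)
  tab-path lp k (lr p) (pairEnd q) (neither t) = outU (tab-path ri k p q t)
  tab-path lr k (lend p) (rend q) (neither t) = outN (tab-path ii k p q t)
  tab-path lr k (lend p) (rl q) (lower t) = outN (tab-path il k p q t)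
  tab-path lr k (lr p) (rend q) (neither t) = outU (tab-path ri k p q t)
  tab-path lr k (lr p) (rl q) (lower t) = outU (tab-path rl k p q t)
  tab-path (lf {d = suc d}) (suc k) (lend p) (frl q) (lower t) =
    o⁺ (left (suc d)) (outL (tab-path if k p q t))
  tab-path lf zero (lend p) (frl q) (lower t) = outL (excess₁ p q t)
  tab-path (lf {d = d}) (suc k) (lr p) (frl q) (lower t) =
    o⁺ (left d) (outB (tab-path rf k p q t))
  tab-path (lf {zero}) zero (lr p) (frl q) (lower t) = ⊥-elim (stuck′ p q t)
  tab-path (lf {suc d}) zero (lr p) (frl q) (lower t) = outB (excess₂ p q t)
  tab-path (fp {e = e}) k (frl p) (pairEnd q) (upper t) =
    outU (tab-path fi (suc k) p q (t⁺ (idle e) t))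
  tab-path (fr {e = e}) k (frl p) (rend q) (upper t) =
    outU (tab-path fi (suc k) p q (t⁺ (idle e) t))
  tab-path (fr {e = e}) k (frl p) (rl q) (both t) = outU (tab-path fl (suc k) p q (t⁺ (left e) t))
  tab-path gg k (frl p) (frl q) (both t) = outB (tab-path ff k p q t)

  excess₁ : Path (idle d) T₀ C C₁ T₀′ d₁ → Path fleft T₁ C₁ C₂ T₁′ d₂ → Tab 0 T₁ T₀ e →
    Out (d + 0) T₁′ T₀′ d₁ d₂ e
  -- At counter 0 only `upper` is possible: the upper row has an entry at the very next integer.
  -- Either the upper queue starts to move a run there, or this entry is passed on and extends the
  -- run being moved below to even length, which cancels the contribution of that run to `k` for the
  -- time being.
  excess₁ (flip p) (fend q) (upper t) = outU (tab-path fi 0 p q t)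
  excess₁ (pair p) (flr q) (upper t) = outU (tab-path pf 0 p q t)
  excess₁ {d = zero} (lstart p) (flr q) (upper t) = ⊥-elim (stuck p q t)
  excess₁ {d = suc d} (lstart p) (flr q) (upper t) = outN (tab-path lf 0 p q t)
  excess₂ : Path (right d) T₀ C C₁ T₀′ d₁ → Path fleft T₁ C₁ C₂ T₁′ d₂ → Tab 0 T₁ T₀ e →
    Out (d + 0) T₁′ T₀′ d₁ d₂ e
  excess₂ {d = zero} (rl p) (flr q) (upper t) = ⊥-elim (stuck p q t)
  excess₂ {d = suc d} (rl p) (flr q) (upper t) = outN (tab-path lf 0 p q t)

  excess₃ : Path fright T₀ C C₁ T₀′ d₁ → Path (paired d) T₁ C₁ C₂ T₁′ d₂ → Tab (d + 0) T₁ T₀ e →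
    Out 0 T₁′ T₀′ d₁ d₂ e
  excess₃ (frl p) (pairEnd q) (upper t) = outU (tab-path fi 0 p q t)

  excess₄ : Path fright T₀ C C₁ T₀′ d₁ → Path (right d) T₁ C₁ C₂ T₁′ d₂ → Tab (d + 0) T₁ T₀ e →
    Out 0 T₁′ T₀′ d₁ d₂ e
  excess₄ (frl p) (rend q) (upper t) = outU (tab-path fi 0 p q t)
  excess₄ {d = suc d} (frl p) (rl q) (both t) = outU (tab-path fl 0 p q t)

-- The blocks are an empty position; an integer in both rows; and a maximal run of 2n+1 or 2n+2
-- consecutive integers alternating between the rows, starting in the left row iff the Boolean is
-- true.  Every nonempty block includes the empty position that follows it.
oddBits : Bool → ℕ → List Bool → List Bool
oddBits s zero    K = s ∷ O ∷ K
oddBits s (suc n) K = s ∷ not s ∷ oddBits s n K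

evenBits : Bool → ℕ → List Bool → List Bool
evenBits s n K = s ∷ oddBits (not s) n K

lefts rights : List Block → List Bool
lefts []              = []
lefts (gap ∷ b)       = O ∷ lefts b
lefts (pair ∷ b)      = I ∷ O ∷ lefts b
lefts (odd s n ∷ b)   = oddBits s n (lefts b)
lefts (even s n ∷ b)  = evenBits s n (lefts b)
rights []             = []
rights (gap ∷ b)      = O ∷ rights b
rights (pair ∷ b)     = I ∷ O ∷ rights b
rights (odd s n ∷ b)  = oddBits (not s) n (rights b)
rights (even s n ∷ b) = evenBits (not s) n (rights b)

-- Columns are added from the largest integer down. A `gap` that is consumed is the empty position
-- after the new run, which the new block includes. The last clause is a default for combinations
-- that two rows without adjacent entries cannot produce; `bits-push` excludes them by means of
-- `Chain`.
push : Bool → Bool → List Block → List Block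
push O O b                = gap ∷ b
push I I (gap ∷ b)        = pair ∷ b
push O I (gap ∷ b)        = odd O 0 ∷ b
push I O (gap ∷ b)        = odd I 0 ∷ b
push I O (odd O n ∷ b)    = even I n ∷ b
push O I (odd I n ∷ b)    = even O n ∷ b
push I O (even O n ∷ b)   = odd I (suc n) ∷ b
push O I (even I n ∷ b)   = odd O (suc n) ∷ b
push _ _ b                = b

parse : List Bool → List Bool → List Block
parse (l ∷ L) (r ∷ R) = push l r (parse L R)
parse _       _       = []

parse-odd : ∀ s n L R b → parse L R ≡ b →
  parse (oddBits s n L) (oddBits (not s) n R) ≡ odd s n ∷ b
parse-odd O zero    L R b refl = refl
parse-odd I zero    L R b refl = refl
parse-odd O (suc n) L R b eq rewrite parse-odd O n L R b eq = refl
parse-odd I (suc n) L R b eq rewrite parse-odd I n L R b eq = refl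

parse-bits : ∀ b → parse (lefts b) (rights b) ≡ b
parse-bits []             = refl
parse-bits (gap ∷ b)      = cong (gap ∷_) (parse-bits b)
parse-bits (pair ∷ b)     rewrite parse-bits b = refl
parse-bits (odd s n ∷ b)  = parse-odd s n _ _ b (parse-bits b)
parse-bits (even O n ∷ b) = cong (push O I) (parse-odd I n _ _ b (parse-bits b))
parse-bits (even I n ∷ b) = cong (push I O) (parse-odd O n _ _ b (parse-bits b))

-- In particular the last bit is O.
data Chain : List Bool → Set where
  []  : Chain []
  O∷_ : ∀ {L} → Chain L → Chain (O ∷ L)
  I∷_ : ∀ {L} → Chain L → Chain (I ∷ O ∷ L)

tail-chain : ∀ {s L} → Chain (s ∷ L) → Chain L
tail-chain (O∷ c) = c
tail-chain (I∷ c) = O∷ c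

bits-push : ∀ s t {L R} b → Chain (s ∷ L) → Chain (t ∷ R) → lefts b ≡ L → rights b ≡ R →
            lefts (push s t b) ≡ s ∷ L × rights (push s t b) ≡ t ∷ R
bits-push O O b              _      _      refl refl = refl , refl
bits-push I I (gap ∷ b)      _      _      refl refl = refl , refl
bits-push O I (gap ∷ b)      _      _      refl refl = refl , refl
bits-push I O (gap ∷ b)      _      _      refl refl = refl , refl
bits-push I O (odd O n ∷ b)  _      _      refl refl = refl , refl
bits-push O I (odd I n ∷ b)  _      _      refl refl = refl , refl
bits-push I O (even O n ∷ b) _      _      refl refl = refl , refl
bits-push O I (even I n ∷ b) _      _      refl refl = refl , refl
bits-push I I (pair ∷ b) () _ refl refl
bits-push I O (pair ∷ b) () _ refl refl
bits-push O I (pair ∷ b) _ () refl refl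
bits-push I I [] () _ refl refl
bits-push I O [] () _ refl refl
bits-push O I [] _ () refl refl
bits-push I O (odd I zero ∷ b) () _ refl refl
bits-push I O (odd I (suc n) ∷ b) () _ refl refl
bits-push O I (odd O zero ∷ b) _ () refl refl
bits-push O I (odd O (suc n) ∷ b) _ () refl refl
bits-push I I (odd I zero ∷ b) () _ refl refl
bits-push I I (odd I (suc n) ∷ b) () _ refl refl
bits-push I I (odd O zero ∷ b) _ () refl refl
bits-push I I (odd O (suc n) ∷ b) _ () refl refl
bits-push I O (even I n ∷ b) () _ refl refl
bits-push O I (even O n ∷ b) _ () refl refl
bits-push I I (even I n ∷ b) () _ refl refl
bits-push I I (even O n ∷ b) _ () refl refl

bits-parse : ∀ {L R} → Chain L → Chain R → length L ≡ length R →
             lefts (parse L R) ≡ L × rights (parse L R) ≡ R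
bits-parse {[]} {[]} _ _ _ = refl , refl
bits-parse {s ∷ L} {t ∷ R} c c′ eq =
  let l , r = bits-parse (tail-chain c) (tail-chain c′) (suc-injective eq)
  in bits-push s t _ c c′ l r

chain-I∷odd : ∀ n {K} → Chain K → Chain (I ∷ oddBits O n K)
chain-I∷odd zero    c = I∷ (O∷ c)
chain-I∷odd (suc n) c = I∷ (chain-I∷odd n c)

chain-odd : ∀ s n {K} → Chain K → Chain (oddBits s n K)
chain-odd O zero    c = O∷ (O∷ c)
chain-odd O (suc n) c = O∷ (chain-I∷odd n c)
chain-odd I zero    c = I∷ c
chain-odd I (suc n) c = I∷ (chain-odd I n c)

chain-even : ∀ s n {K} → Chain K → Chain (evenBits s n K)
chain-even O n c = O∷ (chain-odd I n c)
chain-even I n c = chain-I∷odd n c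

chain-lefts : ∀ b → Chain (lefts b)
chain-lefts []             = []
chain-lefts (gap ∷ b)      = O∷ chain-lefts b
chain-lefts (pair ∷ b)     = I∷ chain-lefts b
chain-lefts (odd s n ∷ b)  = chain-odd s n (chain-lefts b)
chain-lefts (even s n ∷ b) = chain-even s n (chain-lefts b)

chain-rights : ∀ b → Chain (rights b)
chain-rights []             = []
chain-rights (gap ∷ b)      = O∷ chain-rights b
chain-rights (pair ∷ b)     = I∷ chain-rights b
chain-rights (odd s n ∷ b)  = chain-odd (not s) n (chain-rights b)
chain-rights (even s n ∷ b) = chain-even (not s) n (chain-rights b)

-- The queue acting on blocks, forwards and backwards

data Queue : ℕ → List Block → List Block → ℕ → Set where
  []     : ∀ {d} → Queue d [] [] d
  gap    : ∀ {d e b c} → Queue d b c e → Queue d (gap ∷ b) (gap ∷ c) e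
  pair   : ∀ {d e b c} → Queue d b c e → Queue d (pair ∷ b) (pair ∷ c) e
  even   : ∀ {s n d e b c} → Queue d b c e → Queue d (even s n ∷ b) (even s n ∷ c) e
  arrive : ∀ {n d e b c} → Queue (suc d) b c e → Queue d (odd O n ∷ b) (odd O n ∷ c) e
  serve  : ∀ {n d e b c} → Queue d b c e → Queue (suc d) (odd I n ∷ b) (odd I n ∷ c) e
  flip   : ∀ {n e b c} → Queue 0 b c e → Queue 0 (odd I n ∷ b) (odd O n ∷ c) e

forward : ℕ → List Block → List Block × ℕ
forward d []                   = [] , d
forward d (odd O n ∷ b)        = let c , e = forward (suc d) b in odd O n ∷ c , e
forward zero (odd I n ∷ b)     = let c , e = forward zero b in odd O n ∷ c , e
forward (suc d) (odd I n ∷ b)  = let c , e = forward d b in odd I n ∷ c , e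
forward d (x ∷ b)              = let c , e = forward d b in x ∷ c , e

forward-queue : ∀ d b → Queue d b (proj₁ (forward d b)) (proj₂ (forward d b))
forward-queue d []                  = []
forward-queue d (gap ∷ b)           = gap (forward-queue d b)
forward-queue d (pair ∷ b)          = pair (forward-queue d b)
forward-queue d (even s n ∷ b)      = even (forward-queue d b)
forward-queue d (odd O n ∷ b)       = arrive (forward-queue (suc d) b)
forward-queue zero (odd I n ∷ b)    = flip (forward-queue 0 b)
forward-queue (suc d) (odd I n ∷ b) = serve (forward-queue d b)

queue-forward : ∀ {d b c e} → Queue d b c e → proj₁ (forward d b) ≡ c
queue-forward []                  = refl
queue-forward (gap q)             = cong (gap ∷_) (queue-forward q)
queue-forward (pair q)            = cong (pair ∷_) (queue-forward q)
queue-forward (even {s} {n} q)    = cong (even s n ∷_) (queue-forward q)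
queue-forward (arrive {n} q)      = cong (odd O n ∷_) (queue-forward q)
queue-forward (serve {n} q)       = cong (odd I n ∷_) (queue-forward q)
queue-forward (flip {n} q)        = cong (odd O n ∷_) (queue-forward q)

-- Seen from the right, a run of the output that starts in the right row is ambiguous: it may have
-- arrived or been moved. An arrival leaves at least one waiting behind it and a moved run leaves
-- none, so the number waiting decides.
back : Block → ℕ × List Block → ℕ × List Block
back (odd O n) (zero  , b) = zero , odd I n ∷ b
back (odd O n) (suc d , b) = d , odd O n ∷ b
back (odd I n) (d , b)     = suc d , odd I n ∷ b
back x         (d , b)     = d , x ∷ b

backward : ℕ → List Block → ℕ × List Block
backward e []      = e , []
backward e (x ∷ c) = back x (backward e c)

backward-queue : ∀ e c → Queue (proj₁ (backward e c)) (proj₂ (backward e c)) c e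
backward-queue e [] = []
backward-queue e (gap ∷ c) = gap (backward-queue e c)
backward-queue e (pair ∷ c) = pair (backward-queue e c)
backward-queue e (even s n ∷ c) = even (backward-queue e c)
backward-queue e (odd I n ∷ c) = serve (backward-queue e c)
backward-queue e (odd O n ∷ c) with backward e c | backward-queue e c
... | zero  , _ | q = flip q
... | suc d , _ | q = arrive q

queue-backward : ∀ {d b c e} → Queue d b c e → backward e c ≡ (d , b)
queue-backward []           = refl
queue-backward (gap q)      = cong (back gap) (queue-backward q)
queue-backward (pair q)     = cong (back pair) (queue-backward q)
queue-backward (even q)     = cong (back (even _ _)) (queue-backward q)
queue-backward (arrive q)   = cong (back (odd O _)) (queue-backward q)
queue-backward (serve q)    = cong (back (odd I _)) (queue-backward q)
queue-backward (flip q)     = cong (back (odd O _)) (queue-backward q)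

path-I∷ : ∀ n → Path (idle d) L R A B e →
  Path (right (suc d)) (oddBits I n L) (oddBits O n R) (oddBits I n A) (oddBits O n B) e
path-I∷ zero    p = rl (lend p)
path-I∷ (suc n) p = rl (lr (path-I∷ n p))

path-O∷ : ∀ n → Path (idle d) L R A B e →
  Path (left d) (oddBits O n L) (oddBits I n R) (oddBits O n A) (oddBits I n B) e
path-O∷ zero    p = lr (rend p)
path-O∷ (suc n) p = lr (rl (path-O∷ n p))

path-flip : ∀ n → Path (idle 0) L R A B e →
  Path fright (oddBits I n L) (oddBits O n R) (oddBits O n A) (oddBits I n B) e
path-flip zero    p = frl (fend p)
path-flip (suc n) p = frl (flr (path-flip n p))

-- Two consecutive queues have different block decompositions. In bitwise form they can be compared
-- position by position.
queue-path : Queue d b c e → Path (idle d) (lefts b) (rights b) (lefts c) (rights c) e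
queue-path []                   = done
queue-path (gap q)              = gap (queue-path q)
queue-path (pair q)             = pair (pairEnd (queue-path q))
queue-path (even {O} {n} q)     = rstart (path-I∷ n (queue-path q))
queue-path (even {I} {n} q)     = lstart (path-O∷ n (queue-path q))
queue-path (arrive {zero} q)    = rstart (rend (queue-path q))
queue-path (arrive {suc n} q)   = rstart (rl (path-O∷ n (queue-path q)))
queue-path (serve {zero} q)     = lstart (lend (queue-path q))
queue-path (serve {suc n} q)    = lstart (lr (path-I∷ n (queue-path q)))
queue-path (flip {zero} q)      = flip (fend (queue-path q))
queue-path (flip {suc n} q)     = flip (flr (path-flip n (queue-path q)))

queue-++ : ∀ {b′ c′ e′} → Queue d b c e → Queue e b′ c′ e′ → Queue d (b ++ b′) (c ++ c′) e′
queue-++ []         r = r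
queue-++ (gap q)    r = gap (queue-++ q r)
queue-++ (pair q)   r = pair (queue-++ q r)
queue-++ (even q)   r = even (queue-++ q r)
queue-++ (arrive q) r = arrive (queue-++ q r)
queue-++ (serve q)  r = serve (queue-++ q r)
queue-++ (flip q)   r = flip (queue-++ q r)

-- The reflection of the integers, combined with the exchange of the two rows.
mir : Block → Block
mir (odd s n) = odd (not s) n
mir x         = x

mirror : List Block → List Block
mirror []      = []
mirror (x ∷ b) = mirror b ∷ʳ mir x

-- Read backwards with the rows exchanged, an arrival becomes a service and a service an arrival. A
-- moved run is moved back, because in the mirrored input it starts in the left row at a moment when
-- nobody waits.
mirror-queue : Queue d b c e → Queue e (mirror c) (mirror b) d
mirror-queue []         = []
mirror-queue (gap q)    = queue-++ (mirror-queue q) (gap [])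
mirror-queue (pair q)   = queue-++ (mirror-queue q) (pair [])
mirror-queue (even q)   = queue-++ (mirror-queue q) (even [])
mirror-queue (arrive q) = queue-++ (mirror-queue q) (serve [])
mirror-queue (serve q)  = queue-++ (mirror-queue q) (arrive [])
mirror-queue (flip q)   = queue-++ (mirror-queue q) (flip [])

-- Reflection of bit strings and of the column condition

alternate : Bool → ℕ → List Bool
alternate s zero    = s ∷ []
alternate s (suc n) = s ∷ not s ∷ alternate s n

oddBits-alternate : ∀ s n K → oddBits s n K ≡ alternate s n ++ O ∷ K
oddBits-alternate s zero    K = refl
oddBits-alternate s (suc n) K = cong (λ X → s ∷ not s ∷ X) (oddBits-alternate s n K)

alternate-∷ʳ : ∀ s n → alternate s n ∷ʳ not s ≡ s ∷ alternate (not s) n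
alternate-∷ʳ s zero = refl
alternate-∷ʳ s (suc n) rewrite not-involutive s =
  cong (λ X → s ∷ not s ∷ X) (alternate-∷ʳ s n)

reverse-alternate : ∀ s n → reverse (alternate s n) ≡ alternate s n
reverse-alternate s zero    = refl
reverse-alternate s (suc n) = begin
  reverse (s ∷ not s ∷ alternate s n)              ≡⟨ unfold-reverse s (not s ∷ alternate s n) ⟩
  reverse (not s ∷ alternate s n) ∷ʳ s             ≡⟨ cong (_∷ʳ s)
      (unfold-reverse (not s) (alternate s n)) ⟩
  (reverse (alternate s n) ∷ʳ not s) ∷ʳ s          ≡⟨ cong (λ X → (X ∷ʳ not s) ∷ʳ s)
      (reverse-alternate s n) ⟩
  (alternate s n ∷ʳ not s) ∷ʳ s                    ≡⟨ cong (_∷ʳ s) (alternate-∷ʳ s n) ⟩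
  s ∷ (alternate (not s) n ∷ʳ s)                   ≡⟨ cong (λ t → s ∷ (alternate (not s) n ∷ʳ t))
      (not-involutive s) ⟨
  s ∷ (alternate (not s) n ∷ʳ not (not s))         ≡⟨ cong (s ∷_) (alternate-∷ʳ (not s) n) ⟩
  s ∷ not s ∷ alternate (not (not s)) n            ≡⟨ cong (λ t → s ∷ not s ∷ alternate t n)
      (not-involutive s) ⟩
  s ∷ not s ∷ alternate s n                        ∎
  where open ≡-Reasoning

coreˡ coreʳ : Block → List Bool
coreˡ gap        = []
coreˡ pair       = I ∷ []
coreˡ (odd s n)  = alternate s n
coreˡ (even s n) = s ∷ alternate (not s) n
coreʳ gap        = []
coreʳ pair       = I ∷ []
coreʳ (odd s n)  = alternate (not s) n
coreʳ (even s n) = not s ∷ alternate s n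

lefts-core : ∀ x b → lefts (x ∷ b) ≡ coreˡ x ++ O ∷ lefts b
lefts-core gap        b = refl
lefts-core pair       b = refl
lefts-core (odd s n)  b = oddBits-alternate s n _
lefts-core (even s n) b = cong (s ∷_) (oddBits-alternate (not s) n _)

rights-core : ∀ x b → rights (x ∷ b) ≡ coreʳ x ++ O ∷ rights b
rights-core gap        b = refl
rights-core pair       b = refl
rights-core (odd s n)  b = oddBits-alternate (not s) n _
rights-core (even s n) b =
  cong (not s ∷_) (trans (oddBits-alternate (not (not s)) n _)
                         (cong (λ t → alternate t n ++ O ∷ rights b) (not-involutive s)))

coreˡ-mir : ∀ x → coreˡ (mir x) ≡ reverse (coreʳ x)
coreˡ-mir gap        = refl
coreˡ-mir pair       = refl
coreˡ-mir (odd s n)  = sym (reverse-alternate (not s) n)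
coreˡ-mir (even s n) = sym (begin
  reverse (not s ∷ alternate s n)    ≡⟨ unfold-reverse (not s) (alternate s n) ⟩
  reverse (alternate s n) ∷ʳ not s   ≡⟨ cong (_∷ʳ not s) (reverse-alternate s n) ⟩
  alternate s n ∷ʳ not s             ≡⟨ alternate-∷ʳ s n ⟩
  s ∷ alternate (not s) n            ∎)
  where open ≡-Reasoning

mir-involutive : ∀ x → mir (mir x) ≡ x
mir-involutive gap        = refl
mir-involutive pair       = refl
mir-involutive (odd s n)  = cong (λ t → odd t n) (not-involutive s)
mir-involutive (even s n) = refl

coreʳ-mir : ∀ x → coreʳ (mir x) ≡ reverse (coreˡ x)
coreʳ-mir x = begin
  coreʳ (mir x)                     ≡⟨ reverse-involutive (coreʳ (mir x)) ⟨
  reverse (reverse (coreʳ (mir x))) ≡⟨ cong reverse (coreˡ-mir (mir x)) ⟨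
  reverse (coreˡ (mir (mir x)))     ≡⟨ cong (λ y → reverse (coreˡ y)) (mir-involutive x) ⟩
  reverse (coreˡ x)                 ∎
  where open ≡-Reasoning

module _ (bits : List Block → List Bool) (core : Block → List Bool) (bits-[] : bits [] ≡ [])
         (bits-core : ∀ x b → bits (x ∷ b) ≡ core x ++ O ∷ bits b) where

  bits-∷ʳ : ∀ b x → O ∷ bits (b ∷ʳ x) ≡ (O ∷ bits b) ++ core x ∷ʳ O
  bits-∷ʳ [] x rewrite bits-core x [] | bits-[] = refl
  bits-∷ʳ (y ∷ b) x rewrite bits-core y (b ∷ʳ x) | bits-core y b | bits-∷ʳ b x =
    cong (O ∷_) (sym (++-assoc (core y) (O ∷ bits b) (core x ∷ʳ O)))

  bits-mirror : (bits′ : List Block → List Bool) (core′ : Block → List Bool) → bits′ [] ≡ [] →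
                (∀ x b → bits′ (x ∷ b) ≡ core′ x ++ O ∷ bits′ b) →
                (∀ x → core (mir x) ≡ reverse (core′ x)) →
                ∀ b → O ∷ bits (mirror b) ≡ reverse (O ∷ bits′ b)
  bits-mirror bits′ core′ bits′-[] bits′-core core-mir [] rewrite bits-[] | bits′-[] = refl
  bits-mirror bits′ core′ bits′-[] bits′-core core-mir (x ∷ b) = begin
    O ∷ bits (mirror b ∷ʳ mir x)                        ≡⟨ bits-∷ʳ (mirror b) (mir x) ⟩
    (O ∷ bits (mirror b)) ++ core (mir x) ∷ʳ O
      ≡⟨ cong₂ (λ u v → u ++ v ∷ʳ O) (bits-mirror bits′ core′ bits′-[] bits′-core core-mir b)
          (core-mir x) ⟩
    reverse (O ∷ bits′ b) ++ reverse (core′ x) ∷ʳ O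
      ≡⟨ cong (reverse (O ∷ bits′ b) ++_) (unfold-reverse O (core′ x)) ⟨
    reverse (O ∷ bits′ b) ++ reverse (O ∷ core′ x)       ≡⟨ reverse-++ (O ∷ core′ x) (O ∷ bits′ b) ⟨
    reverse (O ∷ core′ x ++ O ∷ bits′ b)                 ≡⟨ cong (λ u → reverse (O ∷ u))
        (bits′-core x b) ⟨
    reverse (O ∷ bits′ (x ∷ b))                          ∎
    where open ≡-Reasoning

-- A row ends with the empty position of its last block; the O in front replaces it after
-- the reflection.
lefts-mirror : ∀ b → O ∷ lefts (mirror b) ≡ reverse (O ∷ rights b)
lefts-mirror = bits-mirror lefts coreˡ refl lefts-core rights coreʳ refl rights-core coreˡ-mir

rights-mirror : ∀ b → O ∷ rights (mirror b) ≡ reverse (O ∷ lefts b)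
rights-mirror = bits-mirror rights coreʳ refl rights-core lefts coreˡ refl lefts-core coreʳ-mir

tab-++ : Tab x A B d → Tab d L R e → Tab x (A ++ L) (B ++ R) e
tab-++ done        u = u
tab-++ (neither t) u = neither (tab-++ t u)
tab-++ (upper t)   u = upper (tab-++ t u)
tab-++ (lower t)   u = lower (tab-++ t u)
tab-++ (both t)    u = both (tab-++ t u)

-- The value 0 is entered only through `lower` and left only through `upper`. Reversal with exchange
-- of the rows swaps these two constructors, so the condition on the counter is symmetric.
tab-reverse : Tab x A B e → Tab e (reverse B) (reverse A) x
tab-reverse done = done
tab-reverse {A = a ∷ A} {b ∷ B} t rewrite unfold-reverse a A | unfold-reverse b B = last t
  where
  last : ∀ {x a b A B e} → Tab x (a ∷ A) (b ∷ B) e → Tab e (reverse B ∷ʳ b) (reverse A ∷ʳ a) x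
  last (neither t) = tab-++ (tab-reverse t) (neither done)
  last (upper t)   = tab-++ (tab-reverse t) (lower done)
  last (lower t)   = tab-++ (tab-reverse t) (upper done)
  last (both t)    = tab-++ (tab-reverse t) (both done)

tab-tail : Tab (suc x) (O ∷ A) (O ∷ B) e → Tab (suc x) A B e
tab-tail (neither t) = t

tab-mirror : Tab (suc x) A B (suc e) → O ∷ C ≡ reverse (O ∷ A) → O ∷ C₁ ≡ reverse (O ∷ B) →
  Tab (suc e) C₁ C (suc x)
tab-mirror t p q =
  tab-tail (subst₂ (λ u v → Tab _ u v _) (sym q) (sym p) (tab-reverse (neither t)))

tab-queue : Queue d₁ b₁ c₁ e₁ → Queue d₂ b₂ c₂ e₂ → lefts c₁ ≡ rights b₂ → ∀ k →
            Tab (suc (d₂ + k)) (lefts b₂) (lefts b₁) e →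
            Out (suc (d₁ + k)) (rights c₂) (rights c₁) e₁ e₂ e
tab-queue q₁ q₂ eq k t =
  tab-path ii k (queue-path q₁)
    (subst (λ R → Path _ _ R _ _ _) (sym eq) (queue-path q₂)) t

reverse-O∷ : ∀ {U V U′ V′ : List Bool} → O ∷ U′ ≡ reverse (O ∷ U) → O ∷ V′ ≡ reverse (O ∷ V) →
  U ≡ V → U′ ≡ V′
reverse-O∷ p q refl = proj₂ (∷-injective (trans p (sym q)))

-- After reflection the chain between the rows travels upwards, so the lower queue comes first and
-- outputs become inputs. The converse is thus `tab-queue` for the mirrored pair, without a second
-- case analysis; `j` plays the role of `k` at the left end.
tab-queue⁻ : Queue d₁ b₁ c₁ e₁ → Queue d₂ b₂ c₂ e₂ → lefts c₁ ≡ rights b₂ → ∀ k →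
             Tab (suc x) (rights c₂) (rights c₁) (suc (e₁ + k)) →
             ∃ λ j → suc x ≡ suc (d₁ + j) × Tab (suc (d₂ + j)) (lefts b₂) (lefts b₁) (suc (e₂ + k))
tab-queue⁻ {b₁ = b₁} {c₁} {b₂ = b₂} {c₂} q₁ q₂ eq k t =
  let j , p , u = tab-queue (mirror-queue q₂) (mirror-queue q₁)
                    (reverse-O∷ (lefts-mirror b₂) (rights-mirror c₁) (sym eq)) k
                    (tab-mirror t (lefts-mirror c₂) (lefts-mirror c₁))
  in j , p , tab-mirror u (mirrored (rights-mirror b₁)) (mirrored (rights-mirror b₂))
  where
  mirrored : ∀ {U V : List Bool} → O ∷ U ≡ reverse (O ∷ V) → O ∷ V ≡ reverse (O ∷ U)
  mirrored p = trans (sym (reverse-involutive _)) (cong reverse (sym p))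

-- Words up to content and di

Word : Set
Word = List ℤ

hits : ℤ → Word → ℕ
hits x ys = length (filter (λ y → x ℤ.≟ y ℤ.+ 1ℤ) ys)

cross : Word → Word → ℕ
cross u v = sum (map (λ x → hits x v) u)

hits-++ : ∀ x u v → hits x (u ++ v) ≡ hits x u + hits x v
hits-++ x u v =
  trans (cong length (filter-++ (λ y → x ℤ.≟ y ℤ.+ 1ℤ) u v)) (length-++ (filter _ u))

hits-↭ : ∀ x {u v} → u ↭ v → hits x u ≡ hits x v
hits-↭ x p = ↭.↭-length (↭.filter-↭ (λ y → x ℤ.≟ y ℤ.+ 1ℤ) p)

hits-none : ∀ {x v} → All (λ y → ¬ x ≡ y ℤ.+ 1ℤ) v → hits x v ≡ 0
hits-none a = cong length (filter-none _ a)

cross-↭ˡ : ∀ {u u′} v → u ↭ u′ → cross u v ≡ cross u′ v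
cross-↭ˡ v p = sum-↭ (↭.map⁺ (λ x → hits x v) p)

cross-↭ʳ : ∀ u {v v′} → v ↭ v′ → cross u v ≡ cross u v′
cross-↭ʳ []      p = refl
cross-↭ʳ (x ∷ u) p = cong₂ _+_ (hits-↭ x p) (cross-↭ʳ u p)

di-++ : ∀ u v → di (u ++ v) ≡ di u + (cross u v + di v)
di-++ []      v = refl
di-++ (x ∷ u) v rewrite hits-++ x u v | di-++ u v =
  solve 5 (λ a b c d e → (a ⊕ b) ⊕ (c ⊕ (d ⊕ e)) ⊜ (a ⊕ c) ⊕ ((b ⊕ d) ⊕ e)) refl
    (hits x u) (hits x v) (di u) (cross u v) (di v)
  where open CMSolver +-0-commutativeMonoid

infix 4 _~_
_~_ : Word → Word → Set
u ~ v = u ↭ v × di u ≡ di v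

~-refl : ∀ {u} → u ~ u
~-refl = ↭-refl , refl

~-trans : ∀ {u v w} → u ~ v → v ~ w → u ~ w
~-trans (p , q) (p′ , q′) = ↭-trans p p′ , trans q q′

~-reflexive : ∀ {u v} → u ≡ v → u ~ v
~-reflexive refl = ~-refl

-- Between the two factors only the cross term arises, and it depends only on their contents.
~-++ : ∀ {u u′ v v′} → u ~ u′ → v ~ v′ → u ++ v ~ u′ ++ v′
~-++ {u} {u′} {v} {v′} (p , q) (p′ , q′) = ↭.++⁺ p p′ , (begin
  di (u ++ v)                    ≡⟨ di-++ u v ⟩
  di u + (cross u v + di v)      ≡⟨ cong₂ _+_ q
      (cong₂ _+_ (trans (cross-↭ˡ v p) (cross-↭ʳ u′ p′)) q′) ⟩
  di u′ + (cross u′ v′ + di v′)  ≡⟨ di-++ u′ v′ ⟨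
  di (u′ ++ v′)                  ∎)
  where open ≡-Reasoning

opt : Bool → ℤ → Word
opt O z = []
opt I z = z ∷ []

letters : ℤ → List Bool → Word
letters z []      = []
letters z (l ∷ L) = opt l z ++ letters (z ℤ.+ 1ℤ) L

i<i+1 : ∀ i → i ℤ.< i ℤ.+ 1ℤ
i<i+1 i = subst (ℤ._< i ℤ.+ 1ℤ) (ℤ.+-identityʳ i) (ℤ.+-monoʳ-< i (ℤ.+<+ (s≤s z≤n)))

letters≥ : ∀ z L → All (z ℤ.≤_) (letters z L)
letters≥ z []      = []
letters≥ z (O ∷ L) = All.map (ℤ.≤-trans (ℤ.<⇒≤ (i<i+1 z))) (letters≥ (z ℤ.+ 1ℤ) L)
letters≥ z (I ∷ L) = ℤ.≤-refl ∷ All.map (ℤ.≤-trans (ℤ.<⇒≤ (i<i+1 z))) (letters≥ (z ℤ.+ 1ℤ) L)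

hits-letters : ∀ {x z} L → x ℤ.≤ z → hits x (letters z L) ≡ 0
hits-letters {x} {z} L x≤z =
  hits-none (All.map (λ {y} z≤y x≡y+1 → ℤ.<-irrefl x≡y+1
      (ℤ.≤-<-trans (ℤ.≤-trans x≤z z≤y) (i<i+1 y))) (letters≥ z L))

di-letters : ∀ z L → di (letters z L) ≡ 0
di-letters z []      = refl
di-letters z (O ∷ L) = di-letters _ L
di-letters z (I ∷ L) rewrite hits-letters L (ℤ.<⇒≤ (i<i+1 z)) = di-letters _ L

weight : Bool → ℕ
weight O = 0
weight I = 1

-- The number of entries z of L with z − 1 in R; the Boolean says whether R has an entry just
-- before the current position.
adj : Bool → List Bool → List Bool → ℕ
adj I (I ∷ L) (r ∷ R) = suc (adj r L R)
adj _ (_ ∷ L) (r ∷ R) = adj r L R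
adj _ _ _ = 0

cross-drop : ∀ {y u} v → All (ℤ._> y ℤ.+ 1ℤ) u → cross u (y ∷ v) ≡ cross u v
cross-drop v [] = refl
cross-drop {y} {x ∷ u} v (x>y+1 ∷ a) with x ℤ.≟ y ℤ.+ 1ℤ
... | yes x≡y+1 with () ← ℤ.<-irrefl (sym x≡y+1) x>y+1
... | no  _     = cong (hits x v +_) (cross-drop v a)

-- The flag `p` retains the entry `y` just before the current position: of the entries already
-- passed it is the only one that a remaining letter can exceed by 1.
cross-letters : ∀ p {y z} L R → y ℤ.+ 1ℤ ≡ z → length L ≡ length R →
                cross (letters z L) (opt p y ++ letters z R) ≡ adj p L R
cross-letters O [] R refl eq = refl
cross-letters I [] R refl eq = refl
cross-letters p {y} (l ∷ L) (r ∷ R) refl eq = go p l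
  where
  z = y ℤ.+ 1ℤ
  shifted : cross (letters (z ℤ.+ 1ℤ) L) (letters z (r ∷ R)) ≡ adj r L R
  shifted = cross-letters r L R refl (suc-injective eq)
  rest : ∀ p → cross (letters (z ℤ.+ 1ℤ) L) (opt p y ++ letters z (r ∷ R)) ≡ adj r L R
  rest O = shifted
  rest I =
    trans (cross-drop (letters z (r ∷ R))
        (All.map (ℤ.<-≤-trans (i<i+1 z)) (letters≥ (z ℤ.+ 1ℤ) L))) shifted
  go : ∀ p l → cross (letters z (l ∷ L)) (opt p y ++ letters z (r ∷ R)) ≡ adj p (l ∷ L) (r ∷ R)
  go O O = rest O
  go I O = rest I
  go O I = cong₂ _+_ (hits-letters (r ∷ R) ℤ.≤-refl) (rest O)
  go I I =
    cong₂ _+_ (trans (hits-++ z (y ∷ []) (letters z (r ∷ R)))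
        (cong₂ _+_ one (hits-letters (r ∷ R) ℤ.≤-refl))) (rest I)
    where
    one : hits z (y ∷ []) ≡ 1
    one with z ℤ.≟ y ℤ.+ 1ℤ
    ... | yes _ = refl
    ... | no ≢ with () ← ≢ refl

di-letters-++ : ∀ z L R → length L ≡ length R → di (letters z L ++ letters z R) ≡ adj O L R
di-letters-++ z L R eq rewrite di-++ (letters z L) (letters z R) | di-letters z L | di-letters z R =
  trans (+-identityʳ _) (cross-letters O {z ℤ.- 1ℤ} L R (z-1+1 z) eq)
  where
  z-1+1 : ∀ z → (z ℤ.- 1ℤ) ℤ.+ 1ℤ ≡ z
  z-1+1 z = trans (ℤ.+-assoc z (ℤ.- 1ℤ) 1ℤ) (ℤ.+-identityʳ z)

-- Merging two rows integer by integer gives a list that does not change at all when a run changes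
-- rows. This yields equality of contents without building a permutation run by run.
inter : ℤ → List Bool → List Bool → Word
inter z (l ∷ L) (r ∷ R) = opt l z ++ opt r z ++ inter (z ℤ.+ 1ℤ) L R
inter z _       _       = []

letters-inter : ∀ z L R → length L ≡ length R → letters z L ++ letters z R ↭ inter z L R
letters-inter z [] [] eq = ↭-refl
letters-inter z (l ∷ L) (r ∷ R) eq = ↭-trans
  (↭-trans (↭-reflexive (++-assoc (opt l z) _ _))
           (↭.++⁺ˡ (opt l z) (↭-trans (↭.shifts (letters _ L) (opt r z)) ↭-refl)))
  (↭.++⁺ˡ (opt l z) (↭.++⁺ˡ (opt r z) (letters-inter (z ℤ.+ 1ℤ) L R (suc-injective eq))))

length-odd : ∀ s t n {K K′} → length K ≡ length K′ →
  length (oddBits s n K) ≡ length (oddBits t n K′)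
length-odd s t zero    eq = cong (λ k → suc (suc k)) eq
length-odd s t (suc n) eq = cong (λ k → suc (suc k)) (length-odd s t n eq)

length-lefts-rights : ∀ b → length (lefts b) ≡ length (rights b)
length-lefts-rights []             = refl
length-lefts-rights (gap ∷ b)      = cong suc (length-lefts-rights b)
length-lefts-rights (pair ∷ b)     = cong (λ k → suc (suc k)) (length-lefts-rights b)
length-lefts-rights (odd s n ∷ b)  = length-odd _ _ n (length-lefts-rights b)
length-lefts-rights (even s n ∷ b) = cong suc (length-odd _ _ n (length-lefts-rights b))

length-queue : Queue d b c e → length (lefts b) ≡ length (lefts c)
length-queue []             = refl
length-queue (gap q)        = cong suc (length-queue q)
length-queue (pair q)       = cong (λ k → suc (suc k)) (length-queue q)
length-queue (even {n = n} q)   = cong suc (length-odd _ _ n (length-queue q))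
length-queue (arrive {n} q) = length-odd _ _ n (length-queue q)
length-queue (serve {n} q)  = length-odd _ _ n (length-queue q)
length-queue (flip {n} q)   = length-odd _ _ n (length-queue q)

adj-I : ∀ p n L R → adj p (oddBits I n L) (oddBits O n R) ≡ weight p + (n + adj O L R)
adj-I O zero    L R = refl
adj-I I zero    L R = refl
adj-I O (suc n) L R = adj-I I n L R
adj-I I (suc n) L R = cong suc (adj-I I n L R)

adj-O : ∀ p n L R → adj p (oddBits O n L) (oddBits I n R) ≡ n + adj O L R
adj-O O zero    L R = refl
adj-O I zero    L R = refl
adj-O O (suc n) L R = cong suc (adj-O O n L R)
adj-O I (suc n) L R = cong suc (adj-O O n L R)

-- Every block ends with an empty position, so no pair counted by `adj` straddles two blocks and the
-- counts can be compared block by block.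
adj-queue : Queue d b c e → adj O (lefts b) (rights b) ≡ adj O (lefts c) (rights c)
adj-queue []       = refl
adj-queue (gap q)  = adj-queue q
adj-queue (pair q) = adj-queue q
adj-queue (even {O} {n} {b = b} {c} q) =
  trans (adj-I I n (lefts b) (rights b))
      (trans (cong (λ k → suc (n + k)) (adj-queue q)) (sym (adj-I I n (lefts c) (rights c))))
adj-queue (even {I} {n} {b = b} {c} q) =
  trans (adj-O O n (lefts b) (rights b))
      (trans (cong (n +_) (adj-queue q)) (sym (adj-O O n (lefts c) (rights c))))
adj-queue (arrive {n} {b = b} {c} q) =
  trans (adj-O O n (lefts b) (rights b))
      (trans (cong (n +_) (adj-queue q)) (sym (adj-O O n (lefts c) (rights c))))
adj-queue (serve {n} {b = b} {c} q) =
  trans (adj-I O n (lefts b) (rights b))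
      (trans (cong (n +_) (adj-queue q)) (sym (adj-I O n (lefts c) (rights c))))
adj-queue (flip {n} {b = b} {c} q) =
  trans (adj-I O n (lefts b) (rights b))
      (trans (cong (n +_) (adj-queue q)) (sym (adj-O O n (lefts c) (rights c))))

inter-odd : ∀ s t n z {L R A B} → (∀ z → inter z L R ≡ inter z A B) →
            inter z (oddBits s n L) (oddBits (not s) n R) ≡ inter z (oddBits t n A)
            (oddBits (not t) n B)
inter-odd O O zero z h = cong (z ∷_) (h _)
inter-odd O I zero z h = cong (z ∷_) (h _)
inter-odd I O zero z h = cong (z ∷_) (h _)
inter-odd I I zero z h = cong (z ∷_) (h _)
inter-odd O O (suc n) z h = cong (λ w → z ∷ _ ∷ w) (inter-odd O O n _ h)
inter-odd O I (suc n) z h = cong (λ w → z ∷ _ ∷ w) (inter-odd O I n _ h)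
inter-odd I O (suc n) z h = cong (λ w → z ∷ _ ∷ w) (inter-odd I O n _ h)
inter-odd I I (suc n) z h = cong (λ w → z ∷ _ ∷ w) (inter-odd I I n _ h)

inter-queue : Queue d b c e → ∀ z → inter z (lefts b) (rights b) ≡ inter z (lefts c) (rights c)
inter-queue []             z = refl
inter-queue (gap q)        z = inter-queue q _
inter-queue (pair q)       z = cong (λ w → z ∷ z ∷ w) (inter-queue q _)
inter-queue (even {O} {n} q) z = cong (z ∷_) (inter-odd I I n _ (inter-queue q))
inter-queue (even {I} {n} q) z = cong (z ∷_) (inter-odd O O n _ (inter-queue q))
inter-queue (arrive {n} q) z = inter-odd O O n z (inter-queue q)
inter-queue (serve {n} q)  z = inter-odd I I n z (inter-queue q)
inter-queue (flip {n} q)   z = inter-odd I O n z (inter-queue q)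

queue-~ : ∀ z → Queue d b c e →
  letters z (lefts b) ++ letters z (rights b) ~ letters z (lefts c) ++ letters z (rights c)
queue-~ {b = b} {c} z q =
  ↭-trans (letters-inter z (lefts b) (rights b) (length-lefts-rights b))
    (↭-trans (↭-reflexive (inter-queue q z))
        (↭-sym (letters-inter z (lefts c) (rights c) (length-lefts-rights c)))) ,
  trans (di-letters-++ z (lefts b) (rights b) (length-lefts-rights b))
    (trans (adj-queue q) (sym (di-letters-++ z (lefts c) (rights c) (length-lefts-rights c))))

-- Row lengths under a queue

IsRow : ℕ → Row → Set
IsRow n T = length T ≡ n × Chain T

ones : Row → ℕ
ones []      = 0
ones (x ∷ L) = weight x + ones L

_⊵_ : Row → Row → Set
T ⊵ T′ = ∃ λ e → Tab 1 T′ T (suc e)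

tab-ones : Tab x A B e → x + ones B ≡ e + ones A
tab-ones done = refl
tab-ones (neither t) = tab-ones t
tab-ones {x} (upper t) = trans (+-suc x _) (tab-ones t)
tab-ones {e = e} (lower t) = trans (cong suc (tab-ones t)) (sym (+-suc e _))
tab-ones {suc x} {e = e} (both t) =
  trans (+-suc (suc x) _) (trans (cong suc (tab-ones t)) (sym (+-suc e _)))

ones-odd : ∀ s n K → ones (oddBits s n K) ≡ weight s + (n + ones K)
ones-odd O zero K = refl
ones-odd I zero K = refl
ones-odd O (suc n) K = cong suc (ones-odd O n K)
ones-odd I (suc n) K = cong suc (ones-odd I n K)

+-suc-swap : ∀ d n k → d + suc (n + k) ≡ suc (n + (d + k))
+-suc-swap d n k = trans (+-suc d (n + k)) (cong suc (x∙yz≈y∙xz d n k))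

queue-ones : Queue d b c e → e + ones (lefts b) ≡ d + ones (rights c)
queue-ones [] = refl
queue-ones (gap q) = queue-ones q
queue-ones {d} {e = e} (pair q) =
  trans (+-suc e _) (trans (cong suc (queue-ones q)) (sym (+-suc d _)))
queue-ones {d} {e = e} (even {O} {n} {b = b} {c} q) rewrite ones-odd I n (lefts b) | ones-odd O n
    (rights c) =
  trans (+-suc-swap e n (ones (lefts b)))
      (trans (cong (λ k → suc (n + k)) (queue-ones q)) (sym (+-suc-swap d n _)))
queue-ones {d} {e = e} (even {I} {n} {b = b} {c} q) rewrite ones-odd O n (lefts b) | ones-odd I n
    (rights c) =
  trans (+-suc-swap e n (ones (lefts b)))
      (trans (cong (λ k → suc (n + k)) (queue-ones q)) (sym (+-suc-swap d n _)))
queue-ones {d} {e = e} (arrive {n} {b = b} {c} q) rewrite ones-odd O n (lefts b) | ones-odd I n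
    (rights c) =
  trans (x∙yz≈y∙xz e n (ones (lefts b)))
      (trans (cong (n +_) (queue-ones q)) (trans (+-suc-swap n d _) (sym (+-suc d _))))
queue-ones {suc d} {e = e} (serve {n} {b = b} {c} q) rewrite ones-odd I n (lefts b) | ones-odd O n
    (rights c) =
  trans (+-suc-swap e n (ones (lefts b)))
      (trans (cong (λ k → suc (n + k)) (queue-ones q)) (cong suc (x∙yz≈y∙xz n d _)))
queue-ones {e = e} (flip {n} {b = b} {c} q) rewrite ones-odd I n (lefts b) | ones-odd I n (rights c) =
  trans (+-suc-swap e n (ones (lefts b))) (cong (λ k → suc (n + k)) (queue-ones q))

ones-A≤L : Queue d b c e → ones (lefts c) ≤ ones (lefts b)
ones-A≤L [] = z≤n
ones-A≤L (gap q) = ones-A≤L q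
ones-A≤L (pair q) = s≤s (ones-A≤L q)
ones-A≤L (even {s} {n} {b = b} {c} q) rewrite ones-odd (not s) n (lefts b) | ones-odd (not s) n
    (lefts c) =
  +-monoʳ-≤ (weight s) (+-monoʳ-≤ (weight (not s)) (+-monoʳ-≤ n (ones-A≤L q)))
ones-A≤L (arrive {n} {b = b} {c} q) rewrite ones-odd O n (lefts b) | ones-odd O n (lefts c) =
  +-monoʳ-≤ n (ones-A≤L q)
ones-A≤L (serve {n} {b = b} {c} q) rewrite ones-odd I n (lefts b) | ones-odd I n (lefts c) =
  +-monoʳ-≤ (suc n) (ones-A≤L q)
ones-A≤L (flip {n} {b = b} {c} q) rewrite ones-odd I n (lefts b) | ones-odd O n (lefts c) =
  m≤n⇒m≤1+n (+-monoʳ-≤ n (ones-A≤L q))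

ones-A≤R : Queue d b c e → ones (lefts c) ≤ d + ones (rights b)
ones-A≤R [] = z≤n
ones-A≤R (gap q) = ones-A≤R q
ones-A≤R {d} (pair q) = ≤-trans (s≤s (ones-A≤R q)) (≤-reflexive (sym (+-suc d _)))
ones-A≤R {d} (even {O} {n} {b = b} {c} q) rewrite ones-odd I n (lefts c) | ones-odd O n (rights b) =
  ≤-trans (s≤s (+-monoʳ-≤ n (ones-A≤R q))) (≤-reflexive (sym (+-suc-swap d n _)))
ones-A≤R {d} (even {I} {n} {b = b} {c} q) rewrite ones-odd O n (lefts c) | ones-odd I n (rights b) =
  ≤-trans (s≤s (+-monoʳ-≤ n (ones-A≤R q))) (≤-reflexive (sym (+-suc-swap d n _)))
ones-A≤R {d} (arrive {n} {b = b} {c} q) rewrite ones-odd O n (lefts c) | ones-odd I n (rights b) =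
  ≤-trans (+-monoʳ-≤ n (ones-A≤R q)) (≤-reflexive (trans (+-suc-swap n d _) (sym (+-suc d _))))
ones-A≤R {suc d} (serve {n} {b = b} {c} q) rewrite ones-odd I n (lefts c) | ones-odd O n (rights b) =
  ≤-trans (s≤s (+-monoʳ-≤ n (ones-A≤R q))) (≤-reflexive (cong suc (x∙yz≈y∙xz n d _)))
ones-A≤R (flip {n} {b = b} {c} q) rewrite ones-odd O n (lefts c) | ones-odd O n (rights b) =
  +-monoʳ-≤ n (ones-A≤R q)

-- Insertion of a chain into a tableau

-- Ins ds P C P′ out es: the chain C passes through the rows of P from top to bottom, leaving P′
-- and out; ds and es list the arrivals waiting at the start and at the end of each row.
data Ins : List ℕ → List Row → Row → List Row → Row → List ℕ → Set where
  []   : Ins [] [] C [] C []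
  step : Queue d b c e → lefts c ≡ A → Ins ds Ts A Ts′ out es →
         Ins (d ∷ ds) (lefts b ∷ Ts) (rights b) (rights c ∷ Ts′) out (e ∷ es)

word : ℤ → List Row → Word
word z []       = []
word z (T ∷ Ts) = word z Ts ++ letters z T

ins-~ : ∀ z → Ins ds P C P′ out es → word z P ++ letters z C ~ letters z out ++ word z P′
ins-~ {C = C} z [] = ~-reflexive (sym (++-identityʳ (letters z C)))
ins-~ {out = out} z (step {b = b} {c} {Ts = Ts} {Ts′ = Ts′} q refl i) =
  ~-trans (~-reflexive (++-assoc (word z Ts) _ _))
  (~-trans (~-++ {word z Ts} ~-refl (queue-~ z q))
  (~-trans (~-reflexive (sym (++-assoc (word z Ts) _ _)))
  (~-trans (~-++ (ins-~ z i) ~-refl)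
  (~-reflexive (++-assoc (letters z out) (word z Ts′) (letters z (rights c)))))))

insert : List Row → Row → List Row × Row
insert []       C = [] , C
insert (T ∷ Ts) C =
  let c         = proj₁ (forward 0 (parse T C))
      Ts′ , out = insert Ts (lefts c)
  in rights c ∷ Ts′ , out

-- The chain is rebuilt from the bottom row upwards; `es` prescribes how many wait at the end of
-- each row. The last clause is the base case and also a default for lists of unequal lengths.
remove : List ℕ → List Row → Row → List Row × Row
remove (e ∷ es) (T′ ∷ Ts′) A =
  let Ts , A′ = remove es Ts′ A
      b       = proj₂ (backward e (parse A′ T′))
  in lefts b ∷ Ts , rights b
remove _ _ C = [] , C

Zeros : List ℕ → Set
Zeros = All (_≡ 0)

ins-insert : IsRow n C → All (IsRow n) P →
  let P′ , out = insert P C in ∃ λ ds → ∃ λ es → Zeros ds × Ins ds P C P′ out es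
ins-insert {P = []} c ps = [] , [] , [] , []
ins-insert {n} {C} {T ∷ Ts} (l , c) ((l′ , c′) ∷ ps) =
  let b        = parse T C
      p , r    = bits-parse c′ c (trans l′ (sym l))
      c₁       = proj₁ (forward 0 b)
      q        = forward-queue 0 b
      ds , es , z , i =
        ins-insert (trans (sym (length-queue q)) (trans (cong length p) l′) , chain-lefts c₁) ps
  in _ , _ , refl ∷ z ,
     subst₂ (λ T₁ C₁ → Ins (0 ∷ ds) (T₁ ∷ Ts) C₁ (rights c₁ ∷ proj₁ (insert Ts (lefts c₁)))
                             (proj₂ (insert Ts (lefts c₁))) (proj₂ (forward 0 b) ∷ es)) p r
                                 (step q refl i)

ins-rows : Ins ds P C P′ out es → IsRow n C → All (IsRow n) P → All (IsRow n) P′ × IsRow n out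
ins-rows [] c ps = [] , c
ins-rows (step {b = b} {c} q refl i) (l , _) ((l′ , _) ∷ ps) =
  let rs , o = ins-rows i (trans (sym (length-queue q)) l′ , chain-lefts c) ps
  in (trans (sym (length-lefts-rights c)) (trans (sym (length-queue q)) l′) , chain-rights c) ∷ rs , o

ins-rows⁻ : Ins ds P C P′ out es → IsRow n out → All (IsRow n) P′ → All (IsRow n) P × IsRow n C
ins-rows⁻ [] c ps = [] , c
ins-rows⁻ (step {b = b} {c} q refl i) o ((l′ , _) ∷ ps) =
  let rs , (l , _) = ins-rows⁻ i o ps
      lb = trans (length-queue q) l
  in (lb , chain-lefts b) ∷ rs , (trans (sym (length-lefts-rights b)) lb , chain-rights b)

ins-remove : IsRow n out → All (IsRow n) P′ → length es ≡ length P′ →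
  let P , C = remove es P′ out in ∃ λ ds → Ins ds P C P′ out es
ins-remove {P′ = []} {es = []} o ps eq = [] , []
ins-remove {n} {out} {P′ = T′ ∷ Ts′} {es = e ∷ es} o ((l′ , c′) ∷ ps) eq =
  let Ts , A        = remove es Ts′ out
      x             = parse A T′
      b             = proj₂ (backward e x)
      ds , i        = ins-remove {es = es} o ps (suc-injective eq)
      _ , (l , c)   = ins-rows⁻ i o ps
      p , r         = bits-parse c c′ (trans l (sym l′))
      q             = backward-queue e x
  in _ , subst (λ T → Ins (proj₁ (backward e x) ∷ ds) (lefts b ∷ Ts) (rights b) (T ∷ Ts′) out
       (e ∷ es)) r (step q p i)

insert-unique : Ins ds P C P′ out es → Zeros ds → insert P C ≡ (P′ , out)
insert-unique [] z = refl
insert-unique (step {b = b} q refl i) (refl ∷ z)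
  rewrite parse-bits b | queue-forward q | insert-unique i z = refl

remove-unique : Ins ds P C P′ out es → remove es P′ out ≡ (P , C)
remove-unique [] = refl
remove-unique (step {c = c} q refl i)
  rewrite remove-unique i | parse-bits c | queue-backward q = refl

shapes : List Row → List ℕ
shapes = map ones

data Below : List ℕ → ℕ → Set where
  []  : ∀ {a} → Below [] a
  [_] : ∀ {a b ν} → b ≤ a → Below (b ∷ ν) a

data HStrip : List ℕ → List ℕ → Set where
  []  : HStrip [] []
  step : ∀ {a b κ ν} → a ≤ b → Below ν a → HStrip κ ν → HStrip (a ∷ κ) (b ∷ ν)

below-≤ : ∀ {ν a a′} → a ≤ a′ → Below ν a → Below ν a′
below-≤ p []    = []
below-≤ p [ q ] = [ ≤-trans q p ]

-- The growth is a horizontal strip because the `k` returned at the right end is a natural number: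
-- the lower row gains `e′`, while the upper row was longer by `e′ + k`.
ins-tableau : Ins ds P C P′ out es → Zeros ds → Linked _⊵_ P →
              Linked _⊵_ P′ × HStrip (shapes P) (shapes P′)
ins-tableau [] z ps = [] , []
ins-tableau (step {e = e} q _ []) (refl ∷ z) ps = [-] , step
    (subst (_ ≤_) (queue-ones q) (m≤n+m _ e)) [] []
ins-tableau (step {b = b} {e = e} q eq i@(step {b = b′} {c = c′} {e = e′} q′ _ _))
    (refl ∷ z@(refl ∷ _)) ((x , t) ∷ ps) =
  let k , p , t′ = tab-queue q q′ eq 0 t
      ls , hs    = ins-tableau i z ps
      below = begin
        ones (rights c′)                       ≡⟨ queue-ones q′ ⟨
        e′ + ones (lefts b′)                   ≤⟨ +-monoˡ-≤ (ones (lefts b′)) (m≤m+n e′ k) ⟩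
        e′ + k + ones (lefts b′)               ≡⟨ cong (_+ ones (lefts b′)) (suc-injective p) ⟨
        x + ones (lefts b′)                    ≡⟨ suc-injective (tab-ones t) ⟨
        ones (lefts b)                         ∎
  in (_ , t′) ∷ ls , step (subst (_ ≤_) (queue-ones q) (m≤n+m _ e)) [ below ] hs
  where open ≤-Reasoning

gaps : ℕ → List Block
gaps m = replicate m gap

queue-gaps : ∀ m → Queue 0 (gaps m) (gaps m) 0
queue-gaps zero    = []
queue-gaps (suc m) = gap (queue-gaps m)

lefts-gaps : ∀ L → ones L ≡ 0 → L ≡ rights (gaps (length L))
lefts-gaps []      eq = refl
lefts-gaps (O ∷ L) eq = cong (O ∷_) (lefts-gaps L eq)

tab-gaps : ∀ x m B → length B ≡ m → Tab (suc x) (rights (gaps m)) B (suc (x + ones B))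
tab-gaps x zero    []      refl =
  subst (λ e → Tab (suc x) [] [] (suc e)) (sym (+-identityʳ x)) done
tab-gaps x (suc m) (O ∷ B) eq = neither (tab-gaps x m B (suc-injective eq))
tab-gaps x (suc m) (I ∷ B) eq =
  upper (subst (λ e → Tab (suc (suc x)) (rights (gaps m)) B (suc e)) (sym (+-suc x (ones B)))
      (tab-gaps (suc x) m B (suc-injective eq)))

-- At the left end the counter of the new rows is 1, and `tab-queue⁻` writes it as `1 + d + j`.
-- Hence nobody waits there, and `j = 0` makes the resulting `Tab` the column condition for the old
-- rows. The induction comes from below, so the lower queue is already known to start empty.
ins-tableau⁻ : Ins ds P C P′ out es → ones out ≡ 0 → Linked _⊵_ P′ → HStrip lam (shapes P′) →
               es ≡ zipWith _∸_ (shapes P′) lam → Zeros ds × Linked _⊵_ P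
ins-tableau⁻ [] o ps [] eq = [] , []
ins-tableau⁻ (step {d = d} {c = c} {e = e} {A = A} q eq []) o ps
    (step {a = l} l≤ _ hs) eqs with ∷-injective eqs
... | refl , _ =
  -- The last row is compared with an imaginary empty row below it, through which an empty chain
  -- passes. With `k = l` the counter ends at `1 + e + l`, that is, at one more than the length of
  -- the new row.
  let m = length A
      j , p , _ = tab-queue⁻ q (queue-gaps m) (trans eq (lefts-gaps A o)) l
                    (subst (λ k → Tab 1 (rights (gaps m)) (rights c) (suc k)) (sym (m∸n+n≡m l≤))
                      (tab-gaps 0 m (rights c) (trans (sym (length-lefts-rights c))
                          (cong length eq))))
  in m+n≡0⇒m≡0 d (suc-injective (sym p)) ∷ [] , [-]
ins-tableau⁻ (step {d = d} {c = c} q eq i@(step {c = c′} q′ _ _)) o ((x , t) ∷ ps)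
    (step {a = l} l≤ [ ≤l ] hs) eqs
  with ∷-injective eqs
... | refl , eqs′ with ins-tableau⁻ i o ps hs eqs′
... | z@(refl ∷ _) , ls =
  -- The truncated difference is a true one by `≤l`, which is exactly the condition for a horizontal
  -- strip.
  let k = l ∸ ones (rights c′)
      x≡ = +-cancelʳ-≡ (ones (rights c′)) x _ (begin
        x + ones (rights c′)                                   ≡⟨ suc-injective (tab-ones t) ⟨
        ones (rights c)                                        ≡⟨ m∸n+n≡m l≤ ⟨
        ones (rights c) ∸ l + l                                ≡⟨ cong (ones (rights c) ∸ l +_)
            (m∸n+n≡m ≤l) ⟨
        ones (rights c) ∸ l + (k + ones (rights c′))           ≡⟨ +-assoc (ones (rights c) ∸ l) k _ ⟨
        ones (rights c) ∸ l + k + ones (rights c′)             ∎)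
      j , p , t′ = tab-queue⁻ q q′ eq k (subst (λ x → Tab 1 _ _ (suc x)) x≡ t)
      d≡0 = m+n≡0⇒m≡0 d (suc-injective (sym p))
      j≡0 = m+n≡0⇒n≡0 d (suc-injective (sym p))
  in d≡0 ∷ z , (_ , subst (λ j → Tab (suc j) _ _ _) j≡0 t′) ∷ ls
  where open ≡-Reasoning

ins-out : Ins ds P C P′ out es → Zeros ds → All (λ T → ones out ≤ ones T) P × ones out ≤ ones C
ins-out [] z = [] , ≤-refl
ins-out (step q refl i) (refl ∷ z) =
  let ps , p = ins-out i z
  in ≤-trans p (ones-A≤L q) ∷ ps , ≤-trans p (ones-A≤R q)

zeros-shapes : Ins ds P C P′ out es → Zeros ds → HStrip lam (shapes P′) →
               es ≡ zipWith _∸_ (shapes P′) lam → shapes P ≡ lam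
zeros-shapes [] z [] eq = refl
zeros-shapes (step {b = b} {c = c} q refl i) (refl ∷ z) (step {a = l} l≤ _ hs) refl =
  cong₂ _∷_ (+-cancelˡ-≡ (ones (rights c) ∸ l) _ _ (trans (queue-ones q) (sym (m∸n+n≡m l≤))))
            (zeros-shapes i z hs refl)

ins-es : Ins ds P C P′ out es → Zeros ds → es ≡ zipWith _∸_ (shapes P′) (shapes P)
ins-es [] z = refl
ins-es (step {b = b} {e = e} q refl i) (refl ∷ z) =
  cong₂ _∷_ (trans (sym (m+n∸n≡m e (ones (lefts b)))) (cong (_∸ ones (lefts b)) (queue-ones q)))
      (ins-es i z)

-- Sums over enumerations

unique-↭ : {xs ys : List X} → Unique xs → Unique ys → (∀ {x} → x ∈ xs → x ∈ ys) →
  (∀ {x} → x ∈ ys → x ∈ xs) → xs ↭ ys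
unique-↭ {xs = []} {[]} u v f g = ↭-refl
unique-↭ {xs = []} {y ∷ ys} u v f g with () ← g (here refl)
unique-↭ {X} {x ∷ xs} {ys} (x∉ ∷ u) v f g with us , vs , refl ← ∈-∃++ (f (here refl))
  with x∉′ ∷ v′ ← ↭ₛ.Unique-resp-↭ (setoid X) (↭⇒↭ₛ (shift x us vs)) v =
  ↭-trans (prep x (unique-↭ u v′ to from)) (↭-sym (shift x us vs))
  where
  to : ∀ {z} → z ∈ xs → z ∈ us ++ vs
  to z∈ with ∈-resp-↭ (shift x us vs) (f (there z∈))
  ... | here refl = contradiction refl (All.lookup x∉ z∈)
  ... | there z∈′ = z∈′
  from : ∀ {z} → z ∈ us ++ vs → z ∈ xs
  from z∈ with g (∈-resp-↭ (↭-sym (shift x us vs)) (there z∈))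
  ... | here refl = contradiction refl (All.lookup x∉′ z∈)
  ... | there z∈′ = z∈′

unique-map : {f : X → Y} {xs : List X} → (∀ {x y} → x ∈ xs → y ∈ xs → f x ≡ f y → x ≡ y) →
  Unique xs → Unique (map f xs)
unique-map inj [] = []
unique-map {f = f} {x ∷ xs} inj (x∉ ∷ u) =
  All.tabulate (λ fy∈ fx≡ → let y , y∈ , eq = ∈-map⁻ f fy∈ in
    All.lookup x∉ y∈ (inj (here refl) (there y∈) (trans fx≡ eq)))
  ∷ unique-map (λ p q → inj (there p) (there q)) u

∑∈ : {P : X → Set} → Enumeration P → (X → ℕ) → ℕ
∑∈ E w = sum (map w (list E))

∑-cong : {P : X → Set} (E : Enumeration P) {v w : X → ℕ} → (∀ {x} → P x → v x ≡ w x) →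
  ∑∈ E v ≡ ∑∈ E w
∑-cong E h = cong sum (map-cong-local (All.tabulate (λ x∈ → h (sound E x∈))))

transport : {P : X → Set} {Q : Y → Set} (f : X → Y) (g : Y → X) → (∀ {x} → P x → Q (f x)) →
  (∀ {y} → Q y → P (g y)) →
  (∀ {x} → P x → g (f x) ≡ x) → (∀ {y} → Q y → f (g y) ≡ y) → Enumeration P → Enumeration Q
transport {Q = Q} f g pq qp gf fg E = record
  { list     = map f (list E)
  ; unique   = unique-map (λ p q eq → trans (sym (gf (sound E p)))
      (trans (cong g eq) (gf (sound E q)))) (unique E)
  ; sound    = λ y∈ → let x , x∈ , eq = ∈-map⁻ f y∈ in subst Q (sym eq) (pq (sound E x∈))
  ; complete = λ q → subst (_∈ map f (list E)) (fg q) (∈-map⁺ f (complete E (qp q)))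
  }

∑-⇔ : {P Q : X → Set} (E : Enumeration P) (F : Enumeration Q) → (∀ {x} → P x → Q x) →
  (∀ {x} → Q x → P x) → (w : X → ℕ) → ∑∈ E w ≡ ∑∈ F w
∑-⇔ E F pq qp w = sum-↭ (↭.map⁺ w (unique-↭ (unique E) (unique F)
  (complete F ∘ pq ∘ sound E) (complete E ∘ qp ∘ sound F)))

∑-bij : {P : X → Set} {Q : Y → Set} (E : Enumeration P) (F : Enumeration Q)
  (f : X → Y) (g : Y → X) → (∀ {x} → P x → Q (f x)) → (∀ {y} → Q y → P (g y)) →
  (∀ {x} → P x → g (f x) ≡ x) → (∀ {y} → Q y → f (g y) ≡ y) →
  {v : X → ℕ} {w : Y → ℕ} → (∀ {x} → P x → v x ≡ w (f x)) → ∑∈ E v ≡ ∑∈ F w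
∑-bij E F f g pq qp gf fg {v} {w} h = begin
  ∑∈ E v                                   ≡⟨ ∑-cong E h ⟩
  ∑∈ E (w ∘ f)                             ≡⟨ cong sum (map-∘ (list E)) ⟩
  ∑∈ (transport f g pq qp gf fg E) w       ≡⟨ ∑-⇔ (transport f g pq qp gf fg E) F id id w ⟩
  ∑∈ F w                                   ∎
  where open ≡-Reasoning

∑-⊎ : {P Q R : X → Set} (E : Enumeration P) (F : Enumeration Q) (G : Enumeration R) →
      (∀ {x} → P x → Q x ⊎ R x) → (∀ {x} → Q x → P x) → (∀ {x} → R x → P x) → (∀ {x} → Q x → ¬ R x) →
      (w : X → ℕ) → ∑∈ E w ≡ ∑∈ F w + ∑∈ G w
∑-⊎ E F G split qp rp disjoint w = begin
  sum (map w (list E))                          ≡⟨ sum-↭ (↭.map⁺ w perm) ⟩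
  sum (map w (list F ++ list G))                ≡⟨ cong sum (map-++ w (list F) (list G)) ⟩
  sum (map w (list F) ++ map w (list G))        ≡⟨ sum-++ (map w (list F)) _ ⟩
  ∑∈ F w + ∑∈ G w                               ∎
  where
  open ≡-Reasoning
  perm = unique-↭ (unique E)
    (Unique.++⁺ (unique F) (unique G) (λ (p , q) → disjoint (sound F p) (sound G q)))
    (λ x∈ → [ ∈-++⁺ˡ ∘ complete F , ∈-++⁺ʳ (list F) ∘ complete G ]′ (split (sound E x∈)))
    (λ x∈ → [ complete E ∘ qp ∘ sound F , complete E ∘ rp ∘ sound G ]′ (∈-++⁻ (list F) x∈))

restrict : {P Q : X → Set} → Decidable Q → (∀ {x} → Q x → P x) → Enumeration P → Enumeration Q
restrict Q? Q⇒P E = record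
  { list     = filter Q? (list E)
  ; unique   = Unique.filter⁺ Q? (unique E)
  ; sound    = λ x∈ → proj₂ (∈-filter⁻ Q? {xs = list E} x∈)
  ; complete = λ q → ∈-filter⁺ Q? (complete E (Q⇒P q)) q
  }

refine : {P Q : X → Set} → Decidable Q → Enumeration P → Enumeration (λ x → P x × Q x)
refine Q? E = record
  { list     = filter Q? (list E)
  ; unique   = Unique.filter⁺ Q? (unique E)
  ; sound    = λ x∈ → let x∈E , q = ∈-filter⁻ Q? {xs = list E} x∈ in sound E x∈E , q
  ; complete = λ (p , q) → ∈-filter⁺ Q? (complete E p) q
  }

∑-zero : {P : X → Set} (E : Enumeration P) {w : X → ℕ} → (∀ {x} → P x → w x ≡ 0) → ∑∈ E w ≡ 0
∑-zero E {w} h = zeros (list E) (λ x∈ → h (sound E x∈))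
  where
  zeros : ∀ xs → (∀ {x} → x ∈ xs → w x ≡ 0) → sum (map w xs) ≡ 0
  zeros []       h = refl
  zeros (x ∷ xs) h rewrite h (here refl) = zeros xs (h ∘ there)

∑-refine : {P Q : X → Set} (E : Enumeration P) (Q? : Decidable Q) {w : X → ℕ} →
           (∀ {x} → P x → ¬ Q x → w x ≡ 0) → ∑∈ E w ≡ ∑∈ (refine Q? E) w
∑-refine {P = P} {Q = Q} E Q? {w} vanish = begin
  ∑∈ E w                                                 ≡⟨ ∑-⊎ E (refine Q? E)
      (refine (¬? ∘ Q?) E) split proj₁ proj₁ (λ (_ , q) (_ , ¬q) → ¬q q) w ⟩
  ∑∈ (refine Q? E) w + ∑∈ (refine (¬? ∘ Q?) E) w         ≡⟨ cong (∑∈ (refine Q? E) w +_)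
      (∑-zero (refine (¬? ∘ Q?) E) (λ (p , ¬q) → vanish p ¬q)) ⟩
  ∑∈ (refine Q? E) w + 0                                 ≡⟨ +-identityʳ _ ⟩
  ∑∈ (refine Q? E) w                                     ∎
  where
  open ≡-Reasoning
  split : ∀ {x} → P x → (P x × Q x) ⊎ (P x × ¬ Q x)
  split {x} p with Q? x
  ... | yes q = inj₁ (p , q)
  ... | no ¬q = inj₂ (p , ¬q)

module _ {P : X → Set} {S : X → Y → Set} (F : ∀ x → Enumeration (S x)) where

  pairs : List X → List (X × Y)
  pairs []       = []
  pairs (x ∷ xs) = map (x ,_) (list (F x)) ++ pairs xs

  ∈-pairs⁺ : ∀ {x y xs} → x ∈ xs → S x y → (x , y) ∈ pairs xs
  ∈-pairs⁺ (here {x} refl) s = ∈-++⁺ˡ (∈-map⁺ (x ,_) (complete (F x) s))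
  ∈-pairs⁺ (there {x} x∈)  s = ∈-++⁺ʳ (map (x ,_) (list (F x))) (∈-pairs⁺ x∈ s)

  ∈-pairs⁻ : ∀ {z} xs → z ∈ pairs xs → proj₁ z ∈ xs × S (proj₁ z) (proj₂ z)
  ∈-pairs⁻ (x ∷ xs) z∈ with ∈-++⁻ (map (x ,_) (list (F x))) z∈
  ... | inj₁ z∈ˡ with y , y∈ , refl ← ∈-map⁻ (x ,_) z∈ˡ = here refl , sound (F x) y∈
  ... | inj₂ z∈ʳ = let p , s = ∈-pairs⁻ xs z∈ʳ in there p , s

  unique-pairs : ∀ {xs} → Unique xs → Unique (pairs xs)
  unique-pairs [] = []
  unique-pairs {x ∷ xs} (x∉ ∷ u) =
    Unique.++⁺ (Unique.map⁺ (cong proj₂) (unique (F x))) (unique-pairs u) disjoint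
    where
    disjoint : ∀ {z} → ¬ (z ∈ map (x ,_) (list (F x)) × z ∈ pairs xs)
    disjoint (p , q) with y , y∈ , refl ← ∈-map⁻ (x ,_) p =
      All.lookup x∉ (proj₁ (∈-pairs⁻ xs q)) refl

  ∑-pairs : ∀ (w : X → Y → ℕ) xs →
            sum (map (λ (x , y) → w x y) (pairs xs)) ≡ sum (map (λ x → ∑∈ (F x) (w x)) xs)
  ∑-pairs w []       = refl
  ∑-pairs w (x ∷ xs) = begin
    sum (map w′ (map (x ,_) (list (F x)) ++ pairs xs))
      ≡⟨ cong sum (map-++ w′ (map (x ,_) (list (F x))) (pairs xs)) ⟩
    sum (map w′ (map (x ,_) (list (F x))) ++ map w′ (pairs xs))
      ≡⟨ sum-++ (map w′ (map (x ,_) (list (F x)))) _ ⟩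
    sum (map w′ (map (x ,_) (list (F x)))) + sum (map w′ (pairs xs))
      ≡⟨ cong₂ _+_ (cong sum (sym (map-∘ (list (F x))))) (∑-pairs w xs) ⟩
    ∑∈ (F x) (w x) + sum (map (λ x → ∑∈ (F x) (w x)) xs) ∎
    where
    open ≡-Reasoning
    w′ : X × Y → ℕ
    w′ (x , y) = w x y

  sigma : Enumeration P → Enumeration (λ (x , y) → P x × S x y)
  sigma E = record
    { list     = pairs (list E)
    ; unique   = unique-pairs (unique E)
    ; sound    = λ z∈ → let p , s = ∈-pairs⁻ (list E) z∈ in sound E p , s
    ; complete = λ (p , s) → ∈-pairs⁺ (complete E p) s
    }

  ∑-sigma : (E : Enumeration P) (w : X → Y → ℕ) →
            ∑∈ (sigma E) (λ (x , y) → w x y) ≡ ∑∈ E (λ x → ∑∈ (F x) (w x))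
  ∑-sigma E w = ∑-pairs w (list E)

∑-*ʳ : {P : X → Set} (E : Enumeration P) (w : X → ℕ) (k : ℕ) → ∑∈ E (λ x → w x * k) ≡ ∑∈ E w * k
∑-*ʳ E w k = go (list E)
  where
  go : ∀ xs → sum (map (λ x → w x * k) xs) ≡ sum (map w xs) * k
  go []       = refl
  go (x ∷ xs) = trans (cong (w x * k +_) (go xs)) (sym (*-distribʳ-+ k (w x) _))

singleton : (x : X) → Enumeration (x ≡_)
singleton x =
  record { list = x ∷ [] ; unique = []
      ∷ [] ; sound = λ { (here refl) → refl } ; complete = λ { refl → here refl } }

Listed : ℕ → (X → Set) → List X → Set
Listed m P xs = length xs ≡ m × All P xs

listed : {P : X → Set} → ∀ m → Enumeration P → Enumeration (Listed m P)
listed zero E = record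
  { list     = [] ∷ []
  ; unique   = [] ∷ []
  ; sound    = λ { (here refl) → refl , [] }
  ; complete = λ { {[]} _ → here refl }
  }
listed {P = P} (suc m) E = record
  { list     = cartesianProductWith _∷_ (list E) (list E′)
  ; unique   = Unique.cartesianProductWith⁺ _∷_ ∷-injective (unique E) (unique E′)
  ; sound    = snd
  ; complete = λ { {x ∷ xs} (l , p ∷ ps) →
      ∈-cartesianProductWith⁺ _∷_ (complete E p) (complete E′ (suc-injective l , ps)) }
  }
  where
  E′ = listed m E
  snd : ∀ {xs} → xs ∈ cartesianProductWith _∷_ (list E) (list E′) → Listed (suc m) P xs
  snd xs∈ with ∈-cartesianProductWith⁻ _∷_ (list E) (list E′) xs∈
  ... | _ , _ , y∈ , ys∈ , refl with l , ps ← sound E′ ys∈ = cong suc l , sound E y∈ ∷ ps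

-- Horizontal and vertical strips

Decr : List ℕ → Set
Decr = Linked _≥_

data VStrip : List ℕ → List ℕ → Set where
  []   : VStrip [] []
  keep : VStrip κ ν → VStrip (a ∷ κ) (a ∷ ν)
  grow : VStrip κ ν → VStrip (a ∷ κ) (suc a ∷ ν)

-- κ/lam is a horizontal and ν/κ a vertical strip, and in the first row where lam and ν differ the
-- last cell belongs to the former (true) or to the latter (false).
data Mixed : Bool → (lam κ ν : List ℕ) → Set where
  skip : Below ν a → Mixed s lam κ ν → Mixed s (a ∷ lam) (a ∷ κ) (a ∷ ν)
  high : ∀ {a b lam κ ν} → a ≤ b → Below κ a → HStrip lam κ → VStrip κ ν →
    Mixed true (a ∷ lam) (suc b ∷ κ) (suc b ∷ ν)
  low  : ∀ {a b lam κ ν} → a ≤ b → Below κ a → HStrip lam κ → VStrip κ ν → Mixed false (a ∷ lam)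
      (b ∷ κ) (suc b ∷ ν)

below? : ∀ ν a → Dec (Below ν a)
below? []      a = yes []
below? (b ∷ ν) a = map′ [_] (λ { [ p ] → p }) (b ≤? a)

hstrip? : ∀ κ ν → Dec (HStrip κ ν)
hstrip? []      []      = yes []
hstrip? []      (b ∷ ν) = no λ ()
hstrip? (a ∷ κ) []      = no λ ()
hstrip? (a ∷ κ) (b ∷ ν) =
  map′ (λ (p , q , r) → step p q r) (λ { (step p q r) → p , q , r })
      (a ≤? b ×-dec below? ν a ×-dec hstrip? κ ν)

vstrip? : ∀ κ ν → Dec (VStrip κ ν)
vstrip? []      []      = yes []
vstrip? []      (b ∷ ν) = no λ ()
vstrip? (a ∷ κ) []      = no λ ()
vstrip? (a ∷ κ) (b ∷ ν) with b ≟ a | b ≟ suc a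
... | yes refl | _ = map′ keep (λ { (keep v) → v }) (vstrip? κ ν)
... | no _ | yes refl = map′ grow (λ { (grow v) → v }) (vstrip? κ ν)
... | no ≢₁ | no ≢₂ = no λ { (keep _) → ≢₁ refl ; (grow _) → ≢₂ refl }

decr? : Decidable Decr
decr? = Linked.linked? (λ x y → y ≤? x)

vstrip-refl : ∀ ν → VStrip ν ν
vstrip-refl []      = []
vstrip-refl (a ∷ ν) = keep (vstrip-refl ν)

hstrip-sum : HStrip κ ν → sum κ ≤ sum ν
hstrip-sum [] = z≤n
hstrip-sum (step p _ h) = +-mono-≤ p (hstrip-sum h)

vstrip-sum : VStrip κ ν → sum κ ≤ sum ν
vstrip-sum []       = z≤n
vstrip-sum (keep v) = +-monoʳ-≤ _ (vstrip-sum v)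
vstrip-sum (grow v) = m≤n⇒m≤1+n (+-monoʳ-≤ _ (vstrip-sum v))

hstrip-≡ : HStrip κ ν → sum ν ≡ sum κ → κ ≡ ν
hstrip-≡ [] eq = refl
hstrip-≡ (step {a} {b} p _ h) eq with ≤-antisym p
    (≮⇒≥ (λ a<b → <-irrefl (sym eq) (+-mono-<-≤ a<b (hstrip-sum h))))
... | refl = cong (a ∷_) (hstrip-≡ h (+-cancelˡ-≡ a _ _ eq))

vstrip-≡ : VStrip κ ν → sum ν ≡ sum κ → κ ≡ ν
vstrip-≡ [] eq = refl
vstrip-≡ (keep {a = a} v) eq = cong (a ∷_) (vstrip-≡ v (+-cancelˡ-≡ a _ _ eq))
vstrip-≡ (grow {a = a} v) eq = contradiction (sym eq) (<⇒≢ (s≤s (+-monoʳ-≤ a (vstrip-sum v))))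

below-vstrip : VStrip κ ν → Below ν a → Below κ a
below-vstrip []       []    = []
below-vstrip (keep v) [ p ] = [ p ]
below-vstrip (grow v) [ p ] = [ ≤-trans (n≤1+n _) p ]

decr-below : Decr (a ∷ ν) → Below ν a
decr-below [-]     = []
decr-below (p ∷ _) = [ p ]

decr-tail : Decr (a ∷ ν) → Decr ν
decr-tail [-]     = []
decr-tail (_ ∷ d) = d

below-decr : Below ν a → Decr ν → Decr (a ∷ ν)
below-decr []    d = [-]
below-decr [ p ] d = p ∷ d

hstrip-refl : Decr κ → HStrip κ κ
hstrip-refl {[]}    d = []
hstrip-refl {a ∷ κ} d = step ≤-refl (decr-below d) (hstrip-refl (decr-tail d))

hstrip-decr : HStrip κ ν → Decr ν
hstrip-decr []           = []
hstrip-decr (step p q h) = below-decr (below-≤ p q) (hstrip-decr h)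

hstrip-length : HStrip κ ν → length κ ≡ length ν
hstrip-length []           = refl
hstrip-length (step _ _ h) = cong suc (hstrip-length h)

vstrip-length : VStrip κ ν → length κ ≡ length ν
vstrip-length []       = refl
vstrip-length (keep v) = cong suc (vstrip-length v)
vstrip-length (grow v) = cong suc (vstrip-length v)

-- Where `lam` and `ν` agree, `κ` lies between them and agrees too. There `skip` needs a bound on
-- the next part of `ν`, which is the purpose of `Decr ν`.
mixed : HStrip lam κ → VStrip κ ν → Decr ν → lam ≢ ν → Mixed true lam κ ν ⊎ Mixed false lam κ ν
mixed [] [] d ≢ = contradiction refl ≢
mixed (step {a} {b} p q h) (grow v) d ≢ = inj₂ (low p q h v)
mixed (step {a} {b} p q h) (keep v) d ≢ with a ≟ b
mixed (step {a} {zero} p q h) (keep v) d ≢ | no a≢b = contradiction (n≤0⇒n≡0 p) a≢b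
mixed (step {a} {suc b} p q h) (keep v) d ≢ | no a≢b = inj₁ (high (≤-pred (≤∧≢⇒< p a≢b)) q h v)
mixed (step {a} {b} p q h) (keep v) d ≢ | yes refl with mixed h v (decr-tail d) (λ { refl → ≢ refl })
... | inj₁ m = inj₁ (skip (decr-below d) m)
... | inj₂ m = inj₂ (skip (decr-below d) m)

mixed-v : Mixed s lam κ ν → VStrip κ ν
mixed-v (skip _ m)     = keep (mixed-v m)
mixed-v (high _ _ _ v) = keep v
mixed-v (low _ _ _ v)  = grow v

mixed-h : Mixed s lam κ ν → HStrip lam κ
mixed-h (skip q m)     = step ≤-refl (below-vstrip (mixed-v m) q) (mixed-h m)
mixed-h (high p q h _) = step (m≤n⇒m≤1+n p) q h
mixed-h (low p q h _)  = step p q h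

mixed-disjoint : Mixed true lam κ ν → ¬ Mixed false lam κ ν
mixed-disjoint (skip _ m)     (skip _ m′)    = mixed-disjoint m m′
mixed-disjoint (high p _ _ _) (skip _ m)     = 1+n≰n p

mixed-< : Mixed s lam κ ν → sum lam < sum ν
mixed-< (skip {a = a} _ m) = +-monoʳ-< a (mixed-< m)
mixed-< (high p _ h v) = s≤s (+-mono-≤ p (≤-trans (hstrip-sum h) (vstrip-sum v)))
mixed-< (low p _ h v)  = s≤s (+-mono-≤ p (≤-trans (hstrip-sum h) (vstrip-sum v)))

-- Move the last cell of the first row where `lam` and `ν` differ from the vertical to the
-- horizontal strip, or back. Both remain strips: the rows above bound this one by way of `ν`, as
-- `skip` is formulated, and the next row is bounded by a part of `lam`; neither changes.
raiseTop lowerTop : List ℕ → List ℕ → List ℕ → List ℕ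
raiseTop (a ∷ lam) (b ∷ κ) (c ∷ ν) with a ≟ c
... | yes _ = b ∷ raiseTop lam κ ν
... | no  _ = suc b ∷ κ
raiseTop _ κ _ = κ
lowerTop (a ∷ lam) (b ∷ κ) (c ∷ ν) with a ≟ c
... | yes _ = b ∷ lowerTop lam κ ν
... | no  _ = pred b ∷ κ
lowerTop _ κ _ = κ

raiseTop-mixed : Mixed false lam κ ν →
  Mixed true lam (raiseTop lam κ ν) ν × sum (raiseTop lam κ ν) ≡ suc (sum κ) × lowerTop lam
  (raiseTop lam κ ν) ν ≡ κ
raiseTop-mixed (skip {a = a} q m) with a ≟ a
... | no ≢  = contradiction refl ≢
... | yes _ with a ≟ a
...   | no ≢ = contradiction refl ≢
...   | yes _ = let m′ , s , l = raiseTop-mixed m in skip q m′ , trans (cong (a +_) s) (+-suc a _) , cong (a ∷_) l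
raiseTop-mixed (low {a} {b} p q h v) with a ≟ suc b
... | yes refl = contradiction p 1+n≰n
... | no _ with a ≟ suc b
...   | yes refl = contradiction p 1+n≰n
...   | no _ = high p q h v , refl , refl

lowerTop-mixed : Mixed true lam κ ν →
  Mixed false lam (lowerTop lam κ ν) ν × sum κ ≡ suc (sum (lowerTop lam κ ν)) × raiseTop lam
  (lowerTop lam κ ν) ν ≡ κ
lowerTop-mixed (skip {a = a} q m) with a ≟ a
... | no ≢  = contradiction refl ≢
... | yes _ with a ≟ a
...   | no ≢ = contradiction refl ≢
...   | yes _ = let m′ , s , l = lowerTop-mixed m in skip q m′ , trans (cong (a +_) s) (+-suc a _) , cong (a ∷_) l
lowerTop-mixed (high {a} {b} p q h v) with a ≟ suc b
... | yes refl = contradiction p 1+n≰n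
... | no _ with a ≟ suc b
...   | yes refl = contradiction p 1+n≰n
...   | no _ = low p q h v , refl , refl

entries≤sum : ∀ ν → All (_≤ sum ν) ν
entries≤sum []      = []
entries≤sum (a ∷ ν) = m≤m+n a _ ∷ All.map (λ p → ≤-trans p (m≤n+m _ a)) (entries≤sum ν)

below-enum : ∀ m → Enumeration (_< m)
below-enum m =
  record { list = upTo m ; unique = Unique.upTo⁺ m ; sound = ∈-upTo⁻ ; complete = ∈-upTo⁺ }

compositions : ∀ m N → Enumeration (λ ν → length ν ≡ m × sum ν ≡ N)
compositions m N = restrict (λ ν → length ν ≟ m ×-dec sum ν ≟ N)
  (λ { {ν} (refl , refl) → refl , All.map s≤s (entries≤sum ν) }) (listed m (below-enum (suc N)))

hstrips : ∀ lam k → Enumeration (λ ν → HStrip lam ν × sum ν ≡ sum lam + k)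
hstrips lam k = restrict (λ ν → hstrip? lam ν ×-dec sum ν ≟ sum lam + k)
  (λ (h , s) → sym (hstrip-length h) , s) (compositions (length lam) (sum lam + k))

IsVStrip : List ℕ → ℕ → List ℕ → Set
IsVStrip lam k ν = VStrip lam ν × Decr ν × sum ν ≡ sum lam + k

vstrips : ∀ lam k → Enumeration (IsVStrip lam k)
vstrips lam k = restrict (λ ν → vstrip? lam ν ×-dec decr? ν ×-dec sum ν ≟ sum lam + k)
  (λ (h , _ , s) → sym (vstrip-length h) , s) (compositions (length lam) (sum lam + k))

IsMixed : Bool → List ℕ → ℕ → ℕ → List ℕ × List ℕ → Set
IsMixed s lam n k (κ , ν) = (Mixed s lam κ ν × Decr ν) × sum κ ≡ sum lam + n × sum ν ≡ sum κ + k

mixed? : ∀ s lam κ ν → Dec (Mixed s lam κ ν × Decr ν)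
mixed? s lam κ ν with hstrip? lam κ | vstrip? κ ν | decr? ν | ≡-dec _≟_ lam ν
... | no ¬h | _     | _     | _        = no λ (m , _) → ¬h (mixed-h m)
... | yes h | no ¬v | _     | _        = no λ (m , _) → ¬v (mixed-v m)
... | yes h | yes v | no ¬d | _        = no λ (_ , d) → ¬d d
... | yes h | yes v | yes d | yes refl = no λ (m , _) → <-irrefl refl (mixed-< m)
mixed? true  lam κ ν | yes h | yes v | yes d | no ≢ with mixed h v d ≢
... | inj₁ m = yes (m , d)
... | inj₂ m = no λ (m′ , _) → mixed-disjoint m′ m
mixed? false lam κ ν | yes h | yes v | yes d | no ≢ with mixed h v d ≢
... | inj₁ m = no λ (m′ , _) → mixed-disjoint m m′
... | inj₂ m = yes (m , d)

mixeds : ∀ s lam n k → Enumeration (IsMixed s lam n k)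
mixeds s lam n k = restrict
  (λ (κ , ν) → mixed? s lam κ ν ×-dec sum κ ≟ sum lam + n ×-dec sum ν ≟ sum κ + k)
  (λ ((m , d) , s , t) → (mixed-h m , s) , mixed-v m , d , t)
  (sigma (λ κ → vstrips κ k) (hstrips lam n))

∑-toggle : ∀ lam n k (w : List ℕ → ℕ) →
           ∑∈ (mixeds false lam n (suc k)) (λ (_ , ν) → w ν) ≡ ∑∈ (mixeds true lam (suc n) k)
           (λ (_ , ν) → w ν)
∑-toggle lam n k w = ∑-bij (mixeds false lam n (suc k)) (mixeds true lam (suc n) k)
  (λ (κ , ν) → raiseTop lam κ ν , ν) (λ (κ , ν) → lowerTop lam κ ν , ν)
  (λ { {κ , ν} ((m , d) , s , t) → let m′ , r , _ = raiseTop-mixed m in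
       (m′ , d) , trans r (trans (cong suc s) (sym (+-suc (sum lam) n))) ,
       trans t (trans (+-suc (sum κ) k) (cong (_+ k) (sym r))) })
  (λ { {κ , ν} ((m , d) , s , t) → let m′ , r , _ = lowerTop-mixed m in
       (m′ , d) , suc-injective (trans (sym r) (trans s (+-suc (sum lam) n))) ,
       trans t (trans (cong (_+ k) r) (sym (+-suc _ k))) })
  (λ { {κ , ν} ((m , _) , _) → cong (_, ν) (proj₂ (proj₂ (raiseTop-mixed m))) })
  (λ { {κ , ν} ((m , _) , _) → cong (_, ν) (proj₂ (proj₂ (lowerTop-mixed m))) })
  (λ _ → refl)

-- If both strips are empty, there is no first differing row; this is the reason for excluding
-- `n + k = 0`.
∑-strips : ∀ lam n k (w : List ℕ → ℕ) → n + k ≢ 0 →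
           ∑∈ (hstrips lam n) (λ κ → ∑∈ (vstrips κ k) w) ≡
           ∑∈ (mixeds true lam n k) (λ (_ , ν) → w ν) + ∑∈ (mixeds false lam n k) (λ (_ , ν) → w ν)
∑-strips lam n k w n+k≢0 =
  trans (sym (∑-sigma (λ κ → vstrips κ k) (hstrips lam n) (λ _ → w)))
    (∑-⊎ (sigma (λ κ → vstrips κ k) (hstrips lam n)) (mixeds true lam n k) (mixeds false lam n k)
      split
      (λ ((m , d) , s , t) → (mixed-h m , s) , mixed-v m , d , t)
      (λ ((m , d) , s , t) → (mixed-h m , s) , mixed-v m , d , t)
      (λ ((m , _) , _) ((m′ , _) , _) → mixed-disjoint m m′)
      (λ (_ , ν) → w ν))
  where
  split : ∀ {z} →
    (HStrip lam (proj₁ z) × sum (proj₁ z) ≡ sum lam + n) × IsVStrip (proj₁ z) k (proj₂ z) →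
    IsMixed true lam n k z ⊎ IsMixed false lam n k z
  split {κ , ν} ((h , s) , v , d , t) with mixed h v d (λ { refl → n+k≢0 (+-cancelˡ-≡ (sum lam) _ _
    (trans (sym (+-assoc (sum lam) n k))
        (trans (cong (_+ k) (sym s)) (trans (sym t) (sym (+-identityʳ _)))))) })
  ... | inj₁ m = inj₁ ((m , d) , s , t)
  ... | inj₂ m = inj₂ ((m , d) , s , t)

low-≢ : ¬ Mixed false lam ν ν
low-≢ (skip _ m) = low-≢ m

high-≢ : ¬ Mixed true lam lam ν
high-≢ (skip _ m)     = high-≢ m
high-≢ (high p _ _ _) = 1+n≰n p

∑-vstrips-0 : ∀ lam (w : List ℕ → ℕ) → Decr lam → ∑∈ (vstrips lam 0) w ≡ w lam
∑-vstrips-0 lam w d = trans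
  (∑-⇔ (vstrips lam 0) (singleton lam)
    (λ (v , _ , s) → vstrip-≡ v (trans s (+-identityʳ _)))
    (λ { refl → vstrip-refl lam , d , sym (+-identityʳ _) }) w)
  (+-identityʳ (w lam))

-- Without vertical cells the distinguished cell is always horizontal, so the `false` pairs
-- disappear. `∑-vstrips` is the opposite extreme.
∑-hstrips : ∀ lam n (w : List ℕ → ℕ) →
  ∑∈ (hstrips lam (suc n)) w ≡ ∑∈ (mixeds true lam (suc n) 0) (λ (_ , ν) → w ν)
∑-hstrips lam n w = begin
  ∑∈ (hstrips lam (suc n)) w
    ≡⟨ ∑-cong (hstrips lam (suc n)) (λ {κ} (h , _) → ∑-vstrips-0 κ w (hstrip-decr h)) ⟨
  ∑∈ (hstrips lam (suc n)) (λ κ → ∑∈ (vstrips κ 0) w)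
    ≡⟨ ∑-strips lam (suc n) 0 w (λ ()) ⟩
  ∑∈ (mixeds true lam (suc n) 0) (λ (_ , ν) → w ν) + ∑∈ (mixeds false lam (suc n) 0) (λ (_ , ν) → w ν)
    ≡⟨ cong (∑∈ (mixeds true lam (suc n) 0) (λ (_ , ν) → w ν) +_)
        (∑-zero (mixeds false lam (suc n) 0) none) ⟩
  ∑∈ (mixeds true lam (suc n) 0) (λ (_ , ν) → w ν) + 0
    ≡⟨ +-identityʳ _ ⟩
  ∑∈ (mixeds true lam (suc n) 0) (λ (_ , ν) → w ν) ∎
  where
  open ≡-Reasoning
  none : ∀ {z} → IsMixed false lam (suc n) 0 z → w (proj₂ z) ≡ 0
  none ((m , _) , _ , t) with refl ← vstrip-≡ (mixed-v m) (trans t (+-identityʳ _)) =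
    ⊥-elim (low-≢ m)

∑-vstrips : ∀ lam k (w : List ℕ → ℕ) → Decr lam →
            ∑∈ (mixeds false lam 0 (suc k)) (λ (_ , ν) → w ν) ≡ ∑∈ (vstrips lam (suc k)) w
∑-vstrips lam k w d = ∑-bij (mixeds false lam 0 (suc k)) (vstrips lam (suc k)) proj₂ (lam ,_)
  (λ { {κ , ν} p@((m , d) , _ , t) → subst (λ κ → IsVStrip κ (suc k) ν) (sym (same p))
      (mixed-v m , d , t) })
  (λ { {ν} (v , d′ , s) → (lows v d′ s , d′) , sym (+-identityʳ _) , s })
  (λ p → cong (_, _) (same p)) (λ _ → refl) (λ _ → refl)
  where
  same : ∀ {z} → IsMixed false lam 0 (suc k) z → lam ≡ proj₁ z
  same ((m , _) , s , _) = hstrip-≡ (mixed-h m) (trans s (+-identityʳ _))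
  lows : ∀ {ν} → VStrip lam ν → Decr ν → sum ν ≡ sum lam + suc k → Mixed false lam lam ν
  lows v d′ s with mixed (hstrip-refl d) v d′ (λ { refl → m≢1+m+n (sum lam) (trans s (+-suc _ k)) })
  ... | inj₁ m = ⊥-elim (high-≢ m)
  ... | inj₂ m = m

-- Chains as bit strings, hooks

-- The last position z + (m − 1) is excluded since the last bit of a row is O.
Within : ℤ → ℕ → ℤ → Set
Within z m x = ∃ λ i → suc i < m × x ≡ z ℤ.+ pos i

within-≥ : ∀ {z m x} → Within z m x → z ℤ.≤ x
within-≥ {z} (i , _ , refl) = ℤ.i≤i+j z (pos i)

within-suc : ∀ z {m x} → Within (z ℤ.+ 1ℤ) m x → Within z (suc m) x
within-suc z (i , p , refl) = suc i , s≤s p , ℤ.+-assoc z 1ℤ (pos i)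

within-pred : ∀ z {m x} → Within z (suc m) x → z ≢ x → Within (z ℤ.+ 1ℤ) m x
within-pred z (zero , p , refl)        ≢ = contradiction (sym (ℤ.+-identityʳ z)) ≢
within-pred z (suc i , s≤s p , refl)   ≢ = i , p , sym (ℤ.+-assoc z 1ℤ (pos i))

z+1+1 : ∀ z → z ℤ.+ 1ℤ ℤ.+ 1ℤ ≡ z ℤ.+ pos 2
z+1+1 z = ℤ.+-assoc z 1ℤ 1ℤ

dual-cons : ∀ {x w} → All (x ℤ.+ pos 2 ℤ.≤_) w → DualDyck w → DualDyck (x ∷ w)
dual-cons []      d = [-]
dual-cons (p ∷ _) d = p ∷ d

x≤x+2 : ∀ x → x ℤ.≤ x ℤ.+ pos 2
x≤x+2 x = ℤ.i≤i+j x (pos 2)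

dual-bound : ∀ {x w} → DualDyck (x ∷ w) → All (x ℤ.+ pos 2 ℤ.≤_) w
dual-bound [-] = []
dual-bound (p ∷ d) = p ∷ All.map (λ q → ℤ.≤-trans p (ℤ.≤-trans (x≤x+2 _) q)) (dual-bound d)

dual-tail : ∀ {x w} → DualDyck (x ∷ w) → DualDyck w
dual-tail [-]     = []
dual-tail (_ ∷ d) = d

chain-letters : ∀ z {T} → Chain T →
  DualDyck (letters z T) × All (Within z (length T)) (letters z T) × length (letters z T) ≡ ones T
chain-letters z [] = [] , [] , refl
chain-letters z (O∷ c) =
  let d , a , l = chain-letters (z ℤ.+ 1ℤ) c in d , All.map (within-suc z) a , l
chain-letters z (I∷_ {L} c) =
  let d , a , l = chain-letters (z ℤ.+ 1ℤ ℤ.+ 1ℤ) c in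
  dual-cons (subst (λ y → All (y ℤ.≤_) (letters (z ℤ.+ 1ℤ ℤ.+ 1ℤ) L)) (z+1+1 z)
      (letters≥ (z ℤ.+ 1ℤ ℤ.+ 1ℤ) L)) d ,
  (0 , s≤s (s≤s z≤n) , sym (ℤ.+-identityʳ z)) ∷ All.map
      (λ p → within-suc z (within-suc (z ℤ.+ 1ℤ) p)) a ,
  cong suc l

bits : ℕ → ℤ → Word → Row
bits zero    z w       = []
bits (suc m) z []      = O ∷ bits m (z ℤ.+ 1ℤ) []
bits (suc m) z (x ∷ w) with z ℤ.≟ x
... | yes _ = I ∷ bits m (z ℤ.+ 1ℤ) w
... | no  _ = O ∷ bits m (z ℤ.+ 1ℤ) (x ∷ w)

bits-skip : ∀ m z w → All (z ℤ.<_) w → bits (suc m) z w ≡ O ∷ bits m (z ℤ.+ 1ℤ) w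
bits-skip m z []      _       = refl
bits-skip m z (x ∷ w) (p ∷ _) with z ℤ.≟ x
... | yes refl = contradiction p (ℤ.<-irrefl refl)
... | no  _    = refl

bits-letters : ∀ z T → bits (length T) z (letters z T) ≡ T
bits-letters z []      = refl
bits-letters z (O ∷ T) = trans
  (bits-skip (length T) z (letters (z ℤ.+ 1ℤ) T)
      (All.map (ℤ.<-≤-trans (i<i+1 z)) (letters≥ (z ℤ.+ 1ℤ) T)))
  (cong (O ∷_) (bits-letters (z ℤ.+ 1ℤ) T))
bits-letters z (I ∷ T) with z ℤ.≟ z
... | yes _ = cong (I ∷_) (bits-letters (z ℤ.+ 1ℤ) T)
... | no ≢  = contradiction refl ≢

letters-bits : ∀ m z w → All (Within z m) w → DualDyck w → letters z (bits m z w) ≡ w × IsRow m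
      (bits m z w)
letters-bits zero z [] a d = refl , refl , []
letters-bits zero z (x ∷ w) ((_ , () , _) ∷ _) d
letters-bits (suc m) z [] a d = let p , l , c = letters-bits m (z ℤ.+ 1ℤ) [] [] [] in p , cong suc l , O∷ c
letters-bits (suc m) z (x ∷ w) a d with z ℤ.≟ x
letters-bits (suc m) z (x ∷ w) (p ∷ a) d | no ≢ =
  let e , l , c = letters-bits m (z ℤ.+ 1ℤ) (x ∷ w)
        (within-pred z p ≢ ∷ All.zipWith shrink (a , dual-bound d)) d
  in e , cong suc l , O∷ c
  where
  shrink : ∀ {y} → Within z (suc m) y × x ℤ.+ pos 2 ℤ.≤ y → Within (z ℤ.+ 1ℤ) m y
  shrink (q , le) =
    within-pred z q λ { refl → ≢ (ℤ.≤-antisym (within-≥ p) (ℤ.≤-trans (x≤x+2 x) le)) }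
letters-bits (suc zero) z (x ∷ w) ((_ , s≤s () , _) ∷ a) d | yes refl
-- The next letter is at least `z + 2`, so the bit after this `I` is `O`, as `I∷_` requires.
letters-bits (suc (suc m)) z (x ∷ w) (p ∷ a) d | yes refl
  rewrite bits-skip m (z ℤ.+ 1ℤ) w
      (All.map (ℤ.<-≤-trans (subst (z ℤ.+ 1ℤ ℤ.<_) (z+1+1 z) (i<i+1 (z ℤ.+ 1ℤ)))) (dual-bound d)) =
  let e , l , c = letters-bits m (z ℤ.+ 1ℤ ℤ.+ 1ℤ) w (All.zipWith shrink (a , dual-bound d))
        (dual-tail d)
  in cong (z ∷_) e , cong (λ k → suc (suc k)) l , I∷ c
  where
  shrink : ∀ {y} → Within z (suc (suc m)) y × z ℤ.+ pos 2 ℤ.≤ y → Within (z ℤ.+ 1ℤ ℤ.+ 1ℤ) m y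
  shrink (q , le) = within-pred (z ℤ.+ 1ℤ) (within-pred z q
    (λ { refl → ℤ.<-irrefl refl (ℤ.<-≤-trans (ℤ.<-trans (i<i+1 z) (i<i+1 (z ℤ.+ 1ℤ)))
        (subst (ℤ._≤ z) (sym (z+1+1 z)) le)) }))
    (λ { refl → ℤ.<-irrefl refl (ℤ.<-≤-trans (i<i+1 (z ℤ.+ 1ℤ))
        (subst (ℤ._≤ z ℤ.+ 1ℤ) (sym (z+1+1 z)) le)) })

-- One of the hooks into which e(n) h(k) splits.
Rises : ℕ → Word → Set
Rises zero    w           = AffineDyck w
Rises (suc n) (x ∷ y ∷ w) = x ℤ.+ pos 2 ℤ.≤ y × Rises n (y ∷ w)
Rises (suc n) _           = ⊥

-- The words of e(n+1) h(k), where the step between the factors is unconstrained.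
Free : ℕ → Word → Set
Free zero    (x ∷ w)     = AffineDyck w
Free (suc n) (x ∷ y ∷ w) = x ℤ.+ pos 2 ℤ.≤ y × Free n (y ∷ w)
Free _       _           = ⊥

affine? : Decidable AffineDyck
affine? = linked? (λ x y → y ℤ.≤? x ℤ.+ 1ℤ)

dual? : Decidable DualDyck
dual? = linked? (λ x y → x ℤ.+ pos 2 ℤ.≤? y)

rises? : ∀ n → Decidable (Rises n)
rises? zero    w           = affine? w
rises? (suc n) (x ∷ y ∷ w) = x ℤ.+ pos 2 ℤ.≤? y ×-dec rises? n (y ∷ w)
rises? (suc n) []          = no λ ()
rises? (suc n) (x ∷ [])    = no λ ()

free? : ∀ n → Decidable (Free n)
free? zero    (x ∷ w)     = affine? w
free? zero    []          = no λ ()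
free? (suc n) (x ∷ y ∷ w) = x ℤ.+ pos 2 ℤ.≤? y ×-dec free? n (y ∷ w)
free? (suc n) []          = no λ ()
free? (suc n) (x ∷ [])    = no λ ()

affine-tail : ∀ {x w} → AffineDyck (x ∷ w) → AffineDyck w
affine-tail [-]     = []
affine-tail (_ ∷ d) = d

-- On single steps the two kinds of Dyck word are complementary, which is all that the decomposition
-- of e(n) h(k) into hooks needs.
step⊎ : ∀ x y → y ℤ.≤ x ℤ.+ 1ℤ ⊎ x ℤ.+ pos 2 ℤ.≤ y
step⊎ x y with y ℤ.≤? x ℤ.+ 1ℤ
... | yes p = inj₁ p
... | no ¬p = inj₂ (subst (ℤ._≤ y) (trans (ℤ.+-comm 1ℤ (x ℤ.+ 1ℤ)) (z+1+1 x))
    (ℤ.i<j⇒suc[i]≤j (ℤ.≰⇒> ¬p)))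

step-disjoint : ∀ x y → y ℤ.≤ x ℤ.+ 1ℤ → ¬ x ℤ.+ pos 2 ℤ.≤ y
step-disjoint x y p q = ℤ.<-irrefl refl
  (ℤ.<-≤-trans (subst (x ℤ.+ 1ℤ ℤ.<_) (z+1+1 x) (i<i+1 (x ℤ.+ 1ℤ))) (ℤ.≤-trans q p))

free-split : ∀ n {x w} → suc n ≤ length w → Free n (x ∷ w) →
  Rises n (x ∷ w) ⊎ Rises (suc n) (x ∷ w)
free-split zero    {x} {y ∷ w} l f with step⊎ x y
... | inj₁ p = inj₁ (p ∷ f)
... | inj₂ p = inj₂ (p , f)
free-split (suc n) {x} {y ∷ w} (s≤s l) (p , f) with free-split n l f
... | inj₁ r = inj₁ (p , r)
... | inj₂ r = inj₂ (p , r)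

rises-free : ∀ n {x w} → Rises n (x ∷ w) → Free n (x ∷ w)
rises-free zero    r = affine-tail r
rises-free (suc n) {x} {y ∷ w} (p , r) = p , rises-free n r

rises-free′ : ∀ n {x w} → Rises (suc n) (x ∷ w) → Free n (x ∷ w)
rises-free′ zero    {x} {y ∷ w} (p , r) = r
rises-free′ (suc n) {x} {y ∷ w} (p , r) = p , rises-free′ n r

rises-disjoint : ∀ n w → Rises n w → ¬ Rises (suc n) w
rises-disjoint zero    (x ∷ y ∷ w) (p ∷ _) (q , _) = step-disjoint x y p q
rises-disjoint (suc n) (x ∷ y ∷ w) (_ , r) (_ , r′) = rises-disjoint n (y ∷ w) r r′

free-++ : ∀ n u v → length u ≡ suc n → DualDyck u → AffineDyck v → Free n (u ++ v)
free-++ zero    (x ∷ [])    v l d       a = a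
free-++ (suc n) (x ∷ y ∷ u) v l (p ∷ d) a = p , free-++ n (y ∷ u) v (suc-injective l) d a

free-take : ∀ n w → Free n w → DualDyck (take (suc n) w)
free-take zero    (x ∷ w)     f       = [-]
free-take (suc n) (x ∷ y ∷ w) (p , f) = p ∷ free-take n (y ∷ w) f

free-drop : ∀ n w → Free n w → AffineDyck (drop (suc n) w)
free-drop zero    (x ∷ w)     f       = f
free-drop (suc n) (x ∷ y ∷ w) (p , f) = free-drop n (y ∷ w) f

rises-dual : ∀ n w → length w ≡ suc n → Rises n w → DualDyck w
rises-dual zero    (x ∷ [])    l r       = [-]
rises-dual (suc n) (x ∷ y ∷ w) l (p , r) = p ∷ rises-dual n (y ∷ w) (suc-injective l) r

dual-rises : ∀ n w → length w ≡ suc n → DualDyck w → Rises n w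
dual-rises zero    (x ∷ [])    l d       = [-]
dual-rises (suc n) (x ∷ y ∷ w) l (p ∷ d) = p , dual-rises n (y ∷ w) (suc-injective l) d

-- Pieri rules

chain? : Decidable Chain
chain? []          = yes []
chain? (O ∷ T)     = map′ O∷_ (λ { (O∷ c) → c }) (chain? T)
chain? (I ∷ [])    = no λ ()
chain? (I ∷ O ∷ T) = map′ I∷_ (λ { (I∷ c) → c }) (chain? T)
chain? (I ∷ I ∷ T) = no λ ()

tab? : ∀ x A B → Dec (∃ λ e → Tab x A B (suc e))
tab? zero    [] [] = no λ { (_ , ()) }
tab? (suc x) [] [] = yes (x , done)
tab? x [] (_ ∷ _) = no λ { (_ , ()) }
tab? x (_ ∷ _) [] = no λ { (_ , ()) }
tab? zero    (O ∷ A) (O ∷ B) = no λ { (_ , ()) }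
tab? (suc x) (O ∷ A) (O ∷ B) =
  map′ (λ (e , t) → e , neither t) (λ { (e , neither t) → e , t }) (tab? (suc x) A B)
tab? x       (O ∷ A) (I ∷ B) =
  map′ (λ (e , t) → e , upper t) (λ { (e , upper t) → e , t }) (tab? (suc x) A B)
tab? zero    (I ∷ A) (O ∷ B) = no λ { (_ , ()) }
tab? (suc x) (I ∷ A) (O ∷ B) =
  map′ (λ (e , t) → e , lower t) (λ { (e , lower t) → e , t }) (tab? x A B)
tab? zero    (I ∷ A) (I ∷ B) = no λ { (_ , ()) }
tab? (suc x) (I ∷ A) (I ∷ B) =
  map′ (λ (e , t) → e , both t) (λ { (e , both t) → e , t }) (tab? (suc x) A B)

_⊵?_ : ∀ T T′ → Dec (T ⊵ T′)
T ⊵? T′ = tab? 1 T′ T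

-- Formal sums of words modulo the congruence are represented by duality: two sums agree if they
-- pair equally with every function that is constant on classes. Right multiplication by the sum of
-- the words in `E` becomes the operation `E ▹ f`, which preserves invariance.
Invariant : (Word → ℕ) → Set
Invariant f = ∀ {u v} → u ~ v → f u ≡ f v

boolean : Enumeration {Bool} (λ _ → ⊤)
boolean = record
  { list     = false ∷ true ∷ []
  ; unique   = ((λ ()) ∷ []) ∷ [] ∷ []
  ; sound    = λ _ → tt
  ; complete = λ { {false} _ → here refl ; {true} _ → there (here refl) }
  }

size : List Row → ℕ
size P = sum (shapes P)

length-word : ∀ z P → All (λ T → Chain T) P → length (word z P) ≡ size P
length-word z []      []       = refl
length-word z (T ∷ P) (c ∷ cs) = trans (length-++ (word z P))
  (trans (cong₂ _+_ (length-word z P cs) (proj₂ (proj₂ (chain-letters z c))))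
      (+-comm (size P) (ones T)))

size-≥ : ∀ {P} → All (λ T → 0 < ones T) P → length P ≤ size P
size-≥ []       = z≤n
size-≥ (p ∷ ps) = +-mono-≤ p (size-≥ ps)

zeroRow : ℕ → Row
zeroRow n = rights (gaps n)

zero-isRow : ∀ n → IsRow n (zeroRow n)
zero-isRow zero    = refl , []
zero-isRow (suc n) = let l , c = zero-isRow n in cong suc l , O∷ c

zero-ones : ∀ n → ones (zeroRow n) ≡ 0
zero-ones zero    = refl
zero-ones (suc n) = zero-ones n

zero-letters : ∀ n z → letters z (zeroRow n) ≡ []
zero-letters zero    z = refl
zero-letters (suc n) z = zero-letters n _

module Window (z : ℤ) (n : ℕ) where

  In : ℤ → Set
  In = Within z n

  alphabet : Enumeration In
  alphabet = record
    { list     = map (λ i → z ℤ.+ pos i) (upTo (pred n))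
    ; unique   = Unique.map⁺ (λ eq → ℤ.+-injective (∙-cancelˡ z _ _ eq)) (Unique.upTo⁺ (pred n))
    ; sound    = snd
    ; complete = λ { (i , p , refl) → ∈-map⁺ (λ i → z ℤ.+ pos i) (∈-upTo⁺ (pred-mono-≤ p)) }
    }
    where
    fits : ∀ n {i} → i < pred n → suc i < n
    fits (suc n) p = s≤s p
    snd : ∀ {x} → _ → In x
    snd x∈ = let i , i∈ , eq = ∈-map⁻ (λ i → z ℤ.+ pos i) x∈ in i , fits n (∈-upTo⁻ i∈) , eq

  words : {Q : Word → Set} → Decidable Q → ∀ k → Enumeration (λ w → Listed k In w × Q w)
  words Q? k = refine Q? (listed k alphabet)

  chains : ∀ k → Enumeration (λ w → Listed k In w × DualDyck w)
  chains = words dual?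

  affines : ∀ k → Enumeration (λ w → Listed k In w × AffineDyck w)
  affines = words affine?

  bitRows : Enumeration (IsRow n)
  bitRows =
    restrict (λ T → length T ≟ n ×-dec chain? T)
        (λ { (refl , _) → refl , All.universal (λ _ → tt) _ })
                  (listed n boolean)

  IsTableau : List ℕ → List Row → Set
  IsTableau lam P = All (IsRow n) P × Linked _⊵_ P × shapes P ≡ lam

  isRow? : Decidable (IsRow n)
  isRow? T = length T ≟ n ×-dec chain? T

  tableaux : ∀ lam → Enumeration (IsTableau lam)
  tableaux lam = restrict
    (λ P → All.all? isRow? P ×-dec linked? _⊵?_ P ×-dec ≡-dec _≟_ (shapes P) lam)
    (λ { {P} (r , _ , refl) → sym (length-map ones P) , r }) (listed (length lam) bitRows)

  N : List ℕ → (Word → ℕ) → ℕ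
  N lam f = ∑∈ (tableaux lam) (λ P → f (word z P))

  infixr 9 _▹_
  _▹_ : {Q : Word → Set} → Enumeration Q → (Word → ℕ) → Word → ℕ
  (E ▹ f) u = ∑∈ E (λ v → f (u ++ v))

  ▹-invariant : ∀ {Q : Word → Set} (E : Enumeration Q) {f} → Invariant f → Invariant (E ▹ f)
  ▹-invariant E inv p = ∑-cong E (λ {v} _ → inv (~-++ p (~-refl {v})))

  length-insert : ∀ {ds P C P′ out es} → Ins ds P C P′ out es → IsRow n C → All (IsRow n) P →
                  IsRow n out → All (IsRow n) P′ → size P + ones C ≡ ones out + size P′
  length-insert {P = P} {C} {P′} {out} i (_ , c) ps (_ , o) ps′ = begin
    size P + ones C
      ≡⟨ cong₂ _+_ (length-word z P (All.map proj₂ ps)) (proj₂ (proj₂ (chain-letters z c))) ⟨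
    length (word z P) + length (letters z C)    ≡⟨ length-++ (word z P) ⟨
    length (word z P ++ letters z C)            ≡⟨ ↭.↭-length (proj₁ (ins-~ z i)) ⟩
    length (letters z out ++ word z P′)         ≡⟨ length-++ (letters z out) ⟩
    length (letters z out) + length (word z P′)
      ≡⟨ cong₂ _+_ (proj₂ (proj₂ (chain-letters z o))) (length-word z P′ (All.map proj₂ ps′)) ⟩
    ones out + size P′                          ∎
    where open ≡-Reasoning

  -- What leaves a row is bounded by the row and by the chain entering it. If anything left the last
  -- row, every row and `C` itself would contain a cell, one cell more than the bound allows.
  out≡0 : ∀ {ds P C P′ out es} → Ins ds P C P′ out es → Zeros ds → size P + ones C ≤ length P →
    ones out ≡ 0
  out≡0 {P = P} {out = out} i zs le with ins-out i zs | ones out ≟ 0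
  ... | _       | yes eq = eq
  ... | ps , p  | no ≢   = contradiction
    (≤-trans (+-mono-≤ (size-≥ (All.map (≤-trans (n≢0⇒n>0 ≢)) ps)) (≤-trans (n≢0⇒n>0 ≢) p)) le)
    (λ q → 1+n≰n (subst (_≤ length P) (+-comm (length P) 1) q))

  ∑-chains : ∀ lam k → sum lam + k ≤ length lam → ∀ {f} → Invariant f →
             N lam (chains k ▹ f) ≡ ∑∈ (hstrips lam k) (λ μ → N μ f)
  ∑-chains lam k fits {f} inv = begin
    N lam (chains k ▹ f)
      ≡⟨ ∑-sigma (λ _ → chains k) (tableaux lam) (λ P u → f (word z P ++ u)) ⟨
    ∑∈ (sigma (λ _ → chains k) (tableaux lam)) (λ (P , u) → f (word z P ++ u))
      ≡⟨ ∑-bij (sigma (λ _ → chains k) (tableaux lam))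
          (sigma tableaux (hstrips lam k)) to from to✓ from✓ from-to to-from
           {λ (P , u) → f (word z P ++ u)} {λ (μ , P) → f (word z P)} weights ⟩
    ∑∈ (sigma tableaux (hstrips lam k)) (λ (μ , P) → f (word z P))
      ≡⟨ ∑-sigma tableaux (hstrips lam k) (λ μ P → f (word z P)) ⟩
    ∑∈ (hstrips lam k) (λ μ → N μ f) ∎
    where
    open ≡-Reasoning
    D  : List Row × Word → Set
    D′ : List ℕ × List Row → Set
    D (P , u) = IsTableau lam P × Listed k In u × DualDyck u
    D′ (μ , P) = (HStrip lam μ × sum μ ≡ sum lam + k) × IsTableau μ P
    to : List Row × Word → List ℕ × List Row
    to (P , u) = let P′ = proj₁ (insert P (bits n z u)) in shapes P′ , P′
    from : List ℕ × List Row → List Row × Word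
    -- `zeroRow n` is what left the last row in the forward direction, by `out≡0`. The differences
    -- are true ones, since `μ` contains `lam`.
    from (μ , P′) = let P , C = remove (zipWith _∸_ μ lam) P′ (zeroRow n) in P , letters z C

    record Inserted (P : List Row) (u : Word) : Set where
      row    = bits n z u
      result = proj₁ (insert P row)
      field
        {before after} : List ℕ
        zs      : Zeros before
        ins     : Ins before P row result (zeroRow n) after
        spells  : letters z row ≡ u
        rowsP′  : All (IsRow n) result
        sizes   : size result ≡ sum lam + k

    inserted : ∀ {P u} → D (P , u) → Inserted P u
    inserted {P} {u} ((rs , ls , refl) , (refl , w) , d) =
      let p , r = letters-bits n z u w d
          ds , es , zs , i = ins-insert r rs
          rs′ , ro = ins-rows i r rs
          oC = trans (sym (proj₂ (proj₂ (chain-letters z (proj₂ r))))) (cong length p)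
          o = out≡0 i zs (subst₂ (λ a b → size P + a ≤ b) (sym oC) (length-map ones P) fits)
          out≡ = trans (lefts-gaps _ o) (cong (λ m → rights (gaps m)) (proj₁ ro))
      in record
        { zs = zs ; ins = subst (λ out → Ins ds P (bits n z u)
            (proj₁ (insert P (bits n z u))) out es) out≡ i ; spells = p ; rowsP′ = rs′
        ; sizes = trans (cong (_+ size (proj₁ (insert P (bits n z u)))) (sym o))
            (trans (sym (length-insert i r rs ro rs′)) (cong (λ m → size P + m) oC)) }

    to✓ : ∀ {x} → D x → D′ (to x)
    to✓ x@((rs , ls , refl) , _) =
      let open Inserted (inserted x)
          ls′ , h = ins-tableau ins zs ls
      in (h , sizes) , rowsP′ , ls′ , refl

    record Removed (μ : List ℕ) (P′ : List Row) : Set where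
      rest = proj₁ (remove (zipWith _∸_ μ lam) P′ (zeroRow n))
      row  = proj₂ (remove (zipWith _∸_ μ lam) P′ (zeroRow n))
      field
        {before after} : List ℕ
        zs      : Zeros before
        ins     : Ins before rest row P′ (zeroRow n) after
        tab     : IsTableau lam rest
        rowC    : IsRow n row
        sizeC   : ones row ≡ k

    removed : ∀ {μ P′} → D′ (μ , P′) → Removed μ P′
    removed {μ} {P′} ((h , s) , rs , ls , refl) =
      let zr       = zero-isRow n
          oz       = zero-ones n
          ds , i   = ins-remove {es = zipWith _∸_ μ lam} zr rs
                       (trans (length-zipWith _∸_ μ lam)
                           (trans (cong (length μ ⊓_) (hstrip-length h))
                           (trans (⊓-idem _) (length-map ones P′))))
          zs , ls′ = ins-tableau⁻ i oz ls h refl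
          rs′ , rC = ins-rows⁻ i zr rs
          sh       = zeros-shapes i zs h refl
      in record
        { zs = zs ; ins = i ; tab = rs′ , ls′ , sh ; rowC = rC
        ; sizeC = +-cancelˡ-≡ (sum lam) _ _
            (trans (cong (λ l → sum l + ones (proj₂ (remove (zipWith _∸_ μ lam) P′ (zeroRow n))))
            (sym sh))
                    (trans (length-insert i rC rs′ zr rs) (trans (cong (_+ size P′) oz) s))) }

    from✓ : ∀ {y} → D′ y → D (from y)
    from✓ d′ =
      let open Removed (removed d′)
          d , w , l = chain-letters z (proj₂ rowC)
      in tab , (trans l sizeC , subst (λ m → All (Within z m) (letters z row)) (proj₁ rowC) w) , d

    from-to : ∀ {x} → D x → from (to x) ≡ x
    from-to {P , u} d@((_ , _ , refl) , _) =
      let open Inserted (inserted d)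
      in trans (cong (λ (P , C) → P , letters z C)
                 (trans (cong (λ es → remove es result (zeroRow n)) (sym (ins-es ins zs)))
                     (remove-unique ins)))
               (cong (P ,_) spells)

    to-from : ∀ {y} → D′ y → to (from y) ≡ y
    to-from {μ , P′} d@(_ , _ , _ , refl) =
      let open Removed (removed d)
          eq = trans (cong (λ C → proj₁ (insert rest C))
                       (trans (cong (λ m → bits m z (letters z row)) (sym (proj₁ rowC)))
                           (bits-letters z row)))
                     (cong proj₁ (insert-unique ins zs))
      in cong₂ _,_ (cong shapes eq) eq

    weights : ∀ {x} → D x → f (word z (proj₁ x) ++ proj₂ x) ≡ f (word z (proj₂ (to x)))
    weights {P , u} d =
      let open Inserted (inserted d)
      in trans (cong (λ u → f (word z P ++ u)) (sym spells))
         (trans (inv (ins-~ z ins)) (cong (λ w → f (w ++ word z result)) (zero-letters n z)))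

∑-+ : {A : Set} {P : A → Set} (E : Enumeration P) (v w : A → ℕ) →
  ∑∈ E (λ x → v x + w x) ≡ ∑∈ E v + ∑∈ E w
∑-+ {A} E v w = go (list E)
  where
  go : (xs : List A) → sum (map (λ x → v x + w x) xs) ≡ sum (map v xs) + sum (map w xs)
  go []       = refl
  go (x ∷ xs) = trans (cong (λ s → v x + w x + s) (go xs)) (interchange (v x) (w x) _ _)

take-length-++ : ∀ {A : Set} (u v : List A) → take (length u) (u ++ v) ≡ u
take-length-++ []      v = refl
take-length-++ (x ∷ u) v = cong (x ∷_) (take-length-++ u v)

drop-length-++ : ∀ {A : Set} (u v : List A) → drop (length u) (u ++ v) ≡ v
drop-length-++ []      v = refl
drop-length-++ (x ∷ u) v = drop-length-++ u v

module _ (z : ℤ) (n : ℕ) where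

  open Window z n

  risers : ∀ m k → Enumeration (λ w → Listed (suc m + k) In w × Rises m w)
  risers m k = words (rises? m) (suc m + k)

  frees : ∀ m k → Enumeration (λ w → Listed (suc m + suc k) In w × Free m w)
  frees m k = words (free? m) (suc m + suc k)

  ∑-frees : ∀ m k (g : Word → ℕ) →
            ∑∈ (chains (suc m)) (λ u → ∑∈ (affines (suc k)) (λ v → g (u ++ v))) ≡ ∑∈
            (frees m k) g
  ∑-frees m k g =
    trans (sym (∑-sigma (λ _ → affines (suc k)) (chains (suc m)) (λ u v → g (u ++ v))))
    (∑-bij (sigma (λ _ → affines (suc k)) (chains (suc m))) (frees m k)
      (λ (u , v) → u ++ v) (λ w → take (suc m) w , drop (suc m) w)
      (λ { {u , v} (((l , a) , d) , (l′ , a′) , d′) →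
        (trans (length-++ u) (cong₂ _+_ l l′) , All.++⁺ a a′) , free-++ m u v l d d′ })
      (λ { {w} ((l , a) , f) →
        ((trans (length-take (suc m) w)
            (trans (cong (suc m ⊓_) l) (m≤n⇒m⊓n≡m (m≤m+n (suc m) (suc k)))) , All.take⁺
            (suc m) a) , free-take m w f) ,
        (trans (length-drop (suc m) w) (trans (cong (_∸ suc m) l)
            (m+n∸m≡n (suc m) (suc k))) , All.drop⁺ (suc m) a) , free-drop m w f })
      (λ { {u , v} (((l , _) , _) , _) → cong₂ _,_
        (trans (cong (λ i → take i (u ++ v)) (sym l)) (take-length-++ u v))
        (trans (cong (λ i → drop i (u ++ v)) (sym l)) (drop-length-++ u v)) })
      (λ {w} _ → take++drop≡id (suc m) w)
      (λ _ → refl))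

  frees-split : ∀ m k (g : Word → ℕ) →
    ∑∈ (frees m k) g ≡ ∑∈ (risers m (suc k)) g + ∑∈ (risers (suc m) k) g
  frees-split m k = ∑-⊎ (frees m k) (risers m (suc k)) (risers (suc m) k)
    (λ { {x ∷ w} ((l , a) , f) → split {x} {w} l a f })
    (λ { {x ∷ w} (la , r) → la , rises-free m r })
    (λ { {x ∷ w} ((l , a) , r) → (trans l (cong suc (sym (+-suc m k))) , a) , rises-free′ m r })
    (λ { {w} (_ , r) (_ , r′) → rises-disjoint m w r r′ })
    where
    split : ∀ {x w} → length (x ∷ w) ≡ suc m + suc k → All In (x ∷ w) → Free m (x ∷ w) →
            (Listed (suc m + suc k) In (x ∷ w) × Rises m (x ∷ w)) ⊎
            (Listed (suc (suc m) + k) In (x ∷ w) × Rises (suc m) (x ∷ w))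
    split l a f with free-split m (≤-trans
        (≤-trans (m≤m+n (suc m) k) (≤-reflexive (sym (+-suc m k))))
        (≤-reflexive (sym (suc-injective l)))) f
    ... | inj₁ r = inj₁ ((l , a) , r)
    ... | inj₂ r = inj₂ ((trans l (cong suc (+-suc m k)) , a) , r)

  N-cong : ∀ lam {f g : Word → ℕ} → (∀ w → f w ≡ g w) → N lam f ≡ N lam g
  N-cong lam h = ∑-cong (tableaux lam) (λ {P} _ → h (word z P))

  chains-affines : ∀ m k (f : Word → ℕ) u →
    (chains (suc m) ▹ affines (suc k) ▹ f) u
    ≡ (risers m (suc k) ▹ f) u + (risers (suc m) k ▹ f) u
  chains-affines m k f u = begin
    ∑∈ (chains (suc m)) (λ v → ∑∈ (affines (suc k)) (λ w → f ((u ++ v) ++ w)))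
      ≡⟨ ∑-cong (chains (suc m)) (λ {v} _ → ∑-cong (affines (suc k))
          (λ {w} _ → cong f (++-assoc u v w))) ⟩
    ∑∈ (chains (suc m)) (λ v → ∑∈ (affines (suc k)) (λ w → f (u ++ (v ++ w))))
      ≡⟨ ∑-frees m k (λ w → f (u ++ w)) ⟩
    ∑∈ (frees m k) (λ w → f (u ++ w))
      ≡⟨ frees-split m k (λ w → f (u ++ w)) ⟩
    (risers m (suc k) ▹ f) u + (risers (suc m) k ▹ f) u ∎
    where open ≡-Reasoning

  ∑-affines : ∀ k lam → Decr lam → sum lam + k ≤ length lam → ∀ {f} → Invariant f →
              N lam (affines k ▹ f) ≡ ∑∈ (vstrips lam k) (λ ν → N ν f)
  -- The hook with `m` initial rises matches the pairs of strips of sizes `m + 1` and `k` whose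
  -- distinguished cell is horizontal. Both sides obey the same recursion: the product e(m+1) h(k+1)
  -- minus the hook for `m + 1` and `k`. As weights are natural numbers, the subtraction is carried
  -- out by adding that hook and cancelling it.
  ∑-risers : ∀ m k lam → Decr lam → sum lam + (suc m + k) ≤ length lam → ∀ {f} → Invariant f →
             N lam (risers m k ▹ f) ≡ ∑∈ (mixeds true lam (suc m) k) (λ (_ , ν) → N ν f)

  ∑-affines zero lam d fits {f} inv = trans
    (N-cong lam (λ u → trans
      (∑-⇔ (affines 0) (singleton []) (λ { {[]} _ → refl }) (λ { refl → (refl , []) , [] })
          (λ v → f (u ++ v)))
      (trans (+-identityʳ _) (cong f (++-identityʳ u)))))
    (sym (∑-vstrips-0 lam (λ ν → N ν f) d))
  ∑-affines (suc k) lam d fits {f} inv = begin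
    N lam (affines (suc k) ▹ f)
      ≡⟨ N-cong lam (λ u → ∑-⇔ (affines (suc k)) (risers 0 k) (λ p → p) (λ p → p)
          (λ v → f (u ++ v))) ⟩
    N lam (risers 0 k ▹ f)
      ≡⟨ ∑-risers 0 k lam d fits inv ⟩
    ∑∈ (mixeds true lam 1 k) (λ (_ , ν) → N ν f)
      ≡⟨ ∑-toggle lam 0 k (λ ν → N ν f) ⟨
    ∑∈ (mixeds false lam 0 (suc k)) (λ (_ , ν) → N ν f)
      ≡⟨ ∑-vstrips lam k (λ ν → N ν f) d ⟩
    ∑∈ (vstrips lam (suc k)) (λ ν → N ν f) ∎
    where open ≡-Reasoning

  ∑-risers m zero lam d fits {f} inv = begin
    N lam (risers m 0 ▹ f)
      ≡⟨ N-cong lam (λ u → ∑-⇔ (risers m 0) (chains (suc m))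
           (λ { {w} ((l , a) , r) → (trans l (+-identityʳ _) , a) , rises-dual m w
               (trans l (+-identityʳ _)) r })
           (λ { {w} ((l , a) , c) → (trans l (sym (+-identityʳ _)) , a) , dual-rises m w l c })
           (λ v → f (u ++ v))) ⟩
    N lam (chains (suc m) ▹ f)
      ≡⟨ ∑-chains lam (suc m) (subst (λ i → sum lam + i ≤ length lam)
          (+-identityʳ (suc m)) fits) inv ⟩
    ∑∈ (hstrips lam (suc m)) (λ ν → N ν f)
      ≡⟨ ∑-hstrips lam m (λ ν → N ν f) ⟩
    ∑∈ (mixeds true lam (suc m) 0) (λ (_ , ν) → N ν f) ∎
    where open ≡-Reasoning
  ∑-risers m (suc k) lam d fits {f} inv =
    +-cancelʳ-≡ (N lam (risers (suc m) k ▹ f)) _ _ (begin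
    N lam (risers m (suc k) ▹ f) + N lam (risers (suc m) k ▹ f)
      ≡⟨ ∑-+ (tableaux lam) (λ P → (risers m (suc k) ▹ f) (word z P))
          (λ P → (risers (suc m) k ▹ f) (word z P)) ⟨
    N lam (λ u → (risers m (suc k) ▹ f) u + (risers (suc m) k ▹ f) u)
      ≡⟨ N-cong lam (chains-affines m k f) ⟨
    N lam (chains (suc m) ▹ affines (suc k) ▹ f)
      ≡⟨ ∑-chains lam (suc m) (≤-trans (+-monoʳ-≤ (sum lam) (m≤m+n (suc m) (suc k))) fits)
           (▹-invariant (affines (suc k)) inv) ⟩
    ∑∈ (hstrips lam (suc m)) (λ κ → N κ (affines (suc k) ▹ f))
      -- The call with the same `suc k` is well-founded, since `∑-affines` reduces it to the hooks
      -- of `∑-risers 0 k`.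
      ≡⟨ ∑-cong (hstrips lam (suc m)) (λ {κ} (h , s) → ∑-affines (suc k) κ (hstrip-decr h)
           (subst₂ _≤_ (trans (sym (+-assoc (sum lam) (suc m) (suc k))) (cong (_+ suc k) (sym s)))
               (hstrip-length h) fits) inv) ⟩
    ∑∈ (hstrips lam (suc m)) (λ κ → ∑∈ (vstrips κ (suc k)) (λ ν → N ν f))
      ≡⟨ ∑-strips lam (suc m) (suc k) (λ ν → N ν f) (λ ()) ⟩
    ∑∈ (mixeds true lam (suc m) (suc k)) (λ (_ , ν) → N ν f) + ∑∈
        (mixeds false lam (suc m) (suc k)) (λ (_ , ν) → N ν f)
      ≡⟨ cong (∑∈ (mixeds true lam (suc m) (suc k)) (λ (_ , ν) → N ν f) +_)
           (trans (∑-toggle lam (suc m) k (λ ν → N ν f))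
                  (sym (∑-risers (suc m) k lam d (subst (λ i → sum lam + i ≤ length lam)
                      (cong suc (+-suc m k)) fits) inv))) ⟩
    ∑∈ (mixeds true lam (suc m) (suc k)) (λ (_ , ν) → N ν f) + N lam (risers (suc m) k ▹ f) ∎)
    where open ≡-Reasoning

-- Conjugate partitions

exceeding : ℕ → List ℕ → ℕ
exceeding j ν = length (filter (j <?_) ν)

-- The conjugate padded to `c` parts, so that conjugates of different shapes have equal length and
-- can be compared as strips.
conj : ℕ → List ℕ → List ℕ
conj c ν = applyUpTo (λ j → exceeding j ν) c

-- The Iverson bracket, which turns the counting of rows into summation.
[_<_]ᵇ : ℕ → ℕ → ℕ
[ j < x ]ᵇ with j <? x
... | yes _ = 1
... | no  _ = 0

bracket-yes : ∀ {j x} → j < x → [ j < x ]ᵇ ≡ 1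
bracket-yes {j} {x} p with j <? x
... | yes _ = refl
... | no ¬p = contradiction p ¬p

bracket-no : ∀ {j x} → ¬ j < x → [ j < x ]ᵇ ≡ 0
bracket-no {j} {x} ¬p with j <? x
... | yes p = contradiction p ¬p
... | no _  = refl

bracket-⇔ : ∀ {i x j y} → (i < x → j < y) → (j < y → i < x) → [ i < x ]ᵇ ≡ [ j < y ]ᵇ
bracket-⇔ {i} {x} {j} {y} f g with j <? y
... | yes p = bracket-yes (g p)
... | no ¬p = bracket-no (¬p ∘ f)

exceeding-∷ : ∀ j x ν → exceeding j (x ∷ ν) ≡ [ j < x ]ᵇ + exceeding j ν
exceeding-∷ j x ν with j <? x
... | yes p = cong length (filter-accept (j <?_) p)
... | no ¬p = cong length (filter-reject (j <?_) ¬p)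

bracket-mono : ∀ {i x j y} → (i < x → j < y) → [ i < x ]ᵇ ≤ [ j < y ]ᵇ
bracket-mono {i} {x} f with i <? x
... | yes p rewrite bracket-yes (f p) = ≤-refl
... | no ¬p = z≤n

bracket-≤1 : ∀ j x → [ j < x ]ᵇ ≤ 1
bracket-≤1 j x with j <? x
... | yes _ = ≤-refl
... | no  _ = z≤n

∑< : ℕ → (ℕ → ℕ) → ℕ
∑< zero    f = 0
∑< (suc c) f = f 0 + ∑< c (f ∘ suc)

∑<-cong : ∀ c {f g} → (∀ j → f j ≡ g j) → ∑< c f ≡ ∑< c g
∑<-cong zero    h = refl
∑<-cong (suc c) h = cong₂ _+_ (h 0) (∑<-cong c (h ∘ suc))

∑<-+ : ∀ c f g → ∑< c (λ j → f j + g j) ≡ ∑< c f + ∑< c g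
∑<-+ zero    f g = refl
∑<-+ (suc c) f g =
  trans (cong (f 0 + g 0 +_) (∑<-+ c (f ∘ suc) (g ∘ suc))) (interchange (f 0) (g 0) _ _)

∑<-bracket : ∀ {c x} → x ≤ c → ∑< c (λ j → [ j < x ]ᵇ) ≡ x
∑<-bracket {zero}  z≤n = refl
∑<-bracket {suc c} {zero}  p =
  cong₂ _+_ (bracket-no {0} {0} λ ())
      (trans (∑<-cong c (λ j → bracket-⇔ {suc j} {0} {j} {0} (λ ()) (λ ()))) (∑<-bracket {c} z≤n))
∑<-bracket {suc c} {suc x} (s≤s p) =
  cong₂ _+_ (bracket-yes {0} {suc x} (s≤s z≤n))
      (trans (∑<-cong c (λ j → bracket-⇔ ≤-pred s≤s)) (∑<-bracket p))

exceeding-applyUpTo : ∀ i g c → exceeding i (applyUpTo g c) ≡ ∑< c (λ j → [ i < g j ]ᵇ)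
exceeding-applyUpTo i g zero    = refl
exceeding-applyUpTo i g (suc c) =
  trans (exceeding-∷ i (g 0) _) (cong ([ i < g 0 ]ᵇ +_) (exceeding-applyUpTo i (g ∘ suc) c))

sum-applyUpTo : ∀ g c → sum (applyUpTo g c) ≡ ∑< c g
sum-applyUpTo g zero    = refl
sum-applyUpTo g (suc c) = cong (g 0 +_) (sum-applyUpTo (g ∘ suc) c)

-- Double counting of the cells; each row contributes its length because all of its columns lie
-- among the first `c`.
sum-conj : ∀ c {ν} → All (_≤ c) ν → sum (conj c ν) ≡ sum ν
sum-conj c {ν} a = trans (sum-applyUpTo _ c) (go a)
  where
  zeros : ∀ c → ∑< c (λ _ → 0) ≡ 0
  zeros zero    = refl
  zeros (suc c) = zeros c
  go : ∀ {ν} → All (_≤ c) ν → ∑< c (λ j → exceeding j ν) ≡ sum ν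
  go []             = zeros c
  go {x ∷ ν} (p ∷ a) = begin
    ∑< c (λ j → exceeding j (x ∷ ν))                      ≡⟨ ∑<-cong c (λ j → exceeding-∷ j x ν) ⟩
    ∑< c (λ j → [ j < x ]ᵇ + exceeding j ν)               ≡⟨ ∑<-+ c _ _ ⟩
    ∑< c (λ j → [ j < x ]ᵇ) + ∑< c (λ j → exceeding j ν)  ≡⟨ cong₂ _+_ (∑<-bracket p) (go a) ⟩
    x + sum ν                                             ∎
    where open ≡-Reasoning

decr-all : ∀ {x ν} → Decr (x ∷ ν) → All (_≤ x) ν
decr-all [-]     = []
decr-all (p ∷ d) = p ∷ All.map (λ q → ≤-trans q p) (decr-all d)

exceeding-pos : ∀ {x j ν} → All (_≤ x) ν → 0 < exceeding j ν → j < x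
exceeding-pos {ν = y ∷ ν} (p ∷ a) 0<e with _ <? y
... | yes j<y = <-≤-trans j<y p
exceeding-pos {x} {j} {y ∷ ν} (p ∷ a) 0<e | no j≮y =
  exceeding-pos a (subst (0 <_) (trans (exceeding-∷ j y ν)
      (cong (_+ exceeding j ν) (bracket-no j≮y))) 0<e)

-- In a decreasing list every column reached by a row of `ν` is also reached by the first row `x`.
-- So exactly `x` columns are nonempty, and deleting the first row lowers each of them by one.
conj-involutive : ∀ c {ν} → Decr ν → All (_≤ c) ν → conj (length ν) (conj c ν) ≡ ν
conj-involutive c {[]}    d a = refl
conj-involutive c {x ∷ ν} d (p ∷ a) =
  cong₂ _∷_ first (trans (applyUpTo-cong (length ν) rest) (conj-involutive c (decr-tail d) a))
  where
  applyUpTo-cong : ∀ m {f g : ℕ → ℕ} → (∀ i → f i ≡ g i) → applyUpTo f m ≡ applyUpTo g m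
  applyUpTo-cong zero    h = refl
  applyUpTo-cong (suc m) h = cong₂ _∷_ (h 0) (applyUpTo-cong m (h ∘ suc))
  below : ∀ {j} → 0 < exceeding j ν → j < x
  below = exceeding-pos (decr-all d)
  first : exceeding 0 (conj c (x ∷ ν)) ≡ x
  first = begin
    exceeding 0 (conj c (x ∷ ν))             ≡⟨ exceeding-applyUpTo 0 _ c ⟩
    ∑< c (λ j → [ 0 < exceeding j (x ∷ ν) ]ᵇ) ≡⟨ ∑<-cong c
        (λ j → trans (cong [ 0 <_]ᵇ (exceeding-∷ j x ν)) (bracket-⇔ (to j) (from j))) ⟩
    ∑< c (λ j → [ j < x ]ᵇ)                   ≡⟨ ∑<-bracket p ⟩
    x                                         ∎
    where
    open ≡-Reasoning
    to : ∀ j → 0 < [ j < x ]ᵇ + exceeding j ν → j < x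
    to j q with j <? x
    ... | yes r = r
    ... | no  _ = below q
    from : ∀ j → j < x → 0 < [ j < x ]ᵇ + exceeding j ν
    from j q rewrite bracket-yes q = s≤s z≤n
  rest : ∀ i → exceeding (suc i) (conj c (x ∷ ν)) ≡ exceeding i (conj c ν)
  rest i = begin
    exceeding (suc i) (conj c (x ∷ ν))              ≡⟨ exceeding-applyUpTo (suc i) _ c ⟩
    ∑< c (λ j → [ suc i < exceeding j (x ∷ ν) ]ᵇ)   ≡⟨ ∑<-cong c
        (λ j → trans (cong [ suc i <_]ᵇ (exceeding-∷ j x ν)) (bracket-⇔ (to j) (from j))) ⟩
    ∑< c (λ j → [ i < exceeding j ν ]ᵇ)             ≡⟨ exceeding-applyUpTo i _ c ⟨
    exceeding i (conj c ν)                          ∎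
    where
    open ≡-Reasoning
    to : ∀ j → suc i < [ j < x ]ᵇ + exceeding j ν → i < exceeding j ν
    to j q = ≤-pred (≤-trans q (+-monoˡ-≤ (exceeding j ν) (bracket-≤1 j x)))
    from : ∀ j → i < exceeding j ν → suc i < [ j < x ]ᵇ + exceeding j ν
    from j q rewrite bracket-yes (below {j} (≤-<-trans z≤n q)) = s≤s q

vstrip-≥ : ∀ {κ ν} → VStrip κ ν → ∀ j → exceeding j κ ≤ exceeding j ν
vstrip-≥ [] j = z≤n
vstrip-≥ (keep {κ} {ν} {a} v) j rewrite exceeding-∷ j a κ | exceeding-∷ j a ν =
  +-monoʳ-≤ [ j < a ]ᵇ (vstrip-≥ v j)
vstrip-≥ (grow {κ} {ν} {a} v) j rewrite exceeding-∷ j a κ | exceeding-∷ j (suc a) ν =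
  +-mono-≤ (bracket-mono {j} {a} m≤n⇒m≤1+n) (vstrip-≥ v j)

-- A row grows by at most one cell, so a row of `ν` with more than `suc j` cells already had more
-- than `j` in `κ`. Together with `vstrip-≥` this is the interlacing of column lengths that defines
-- a horizontal strip.
vstrip-≤ : ∀ {κ ν} → VStrip κ ν → ∀ j → exceeding (suc j) ν ≤ exceeding j κ
vstrip-≤ [] j = z≤n
vstrip-≤ (keep {κ} {ν} {a} v) j rewrite exceeding-∷ j a κ | exceeding-∷ (suc j) a ν =
  +-mono-≤ (bracket-mono {suc j} {a} (<-trans (n<1+n j))) (vstrip-≤ v j)
vstrip-≤ (grow {κ} {ν} {a} v) j rewrite exceeding-∷ j a κ | exceeding-∷ (suc j) (suc a) ν =
  +-mono-≤ (bracket-mono {suc j} {suc a} ≤-pred) (vstrip-≤ v j)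

applyUpTo-hstrip : ∀ c {f g : ℕ → ℕ} → (∀ j → f j ≤ g j) → (∀ j → g (suc j) ≤ f j) →
  HStrip (applyUpTo f c) (applyUpTo g c)
applyUpTo-hstrip zero          p q = []
applyUpTo-hstrip (suc zero)    p q = step (p 0) [] []
applyUpTo-hstrip (suc (suc c)) p q =
  step (p 0) [ q 0 ] (applyUpTo-hstrip (suc c) (p ∘ suc) (q ∘ suc))

conj-vstrip : ∀ c {κ ν} → VStrip κ ν → HStrip (conj c κ) (conj c ν)
conj-vstrip c v = applyUpTo-hstrip c (vstrip-≥ v) (vstrip-≤ v)

conj-decr : ∀ c ν → Decr (conj c ν)
conj-decr c ν = hstrip-decr (conj-vstrip c (vstrip-refl ν))

hstrip-≥ : ∀ {κ ν} → HStrip κ ν → ∀ i → exceeding i κ ≤ exceeding i ν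
hstrip-≥ [] i = z≤n
hstrip-≥ (step {a} {b} {κ} {ν} p _ h) i rewrite exceeding-∷ i a κ | exceeding-∷ i b ν =
  +-mono-≤ (bracket-mono {i} {a} (λ q → <-≤-trans q p)) (hstrip-≥ h i)

hstrip-≤ : ∀ {κ ν} → HStrip κ ν → ∀ i → exceeding i ν ≤ suc (exceeding i κ)
hstrip-≤ [] i = z≤n
hstrip-≤ (step {a} {b} {κ} {ν} p q h) i rewrite exceeding-∷ i a κ | exceeding-∷ i b ν with i <? a
... | yes r = +-mono-≤ (bracket-≤1 i b) (hstrip-≤ h i)
-- If the part `a` of `κ` does not reach column `i`, then no later row of `ν` does, and only the
-- present row can gain a cell there.
... | no ¬r = ≤-trans (+-mono-≤ (bracket-≤1 i b) (≤-reflexive none)) (s≤s z≤n)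
  where
  none : exceeding i ν ≡ 0
  none with exceeding i ν in eq
  ... | zero  = refl
  ... | suc _ = contradiction (exceeding-pos (decr-all (below-decr q (hstrip-decr h)))
      (subst (0 <_) (sym eq) (s≤s z≤n))) ¬r

applyUpTo-vstrip : ∀ c {f g : ℕ → ℕ} → (∀ j → f j ≤ g j) → (∀ j → g j ≤ suc (f j)) →
  VStrip (applyUpTo f c) (applyUpTo g c)
applyUpTo-vstrip zero    p q = []
applyUpTo-vstrip (suc c) {f} {g} p q with g 0 ≟ f 0
... | yes eq = subst (λ m → VStrip (applyUpTo f (suc c)) (m ∷ applyUpTo (g ∘ suc) c)) (sym eq)
    (keep (applyUpTo-vstrip c (p ∘ suc) (q ∘ suc)))
... | no  ≢  = subst (λ m → VStrip (applyUpTo f (suc c)) (m ∷ applyUpTo (g ∘ suc) c))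
    (≤-antisym (≤∧≢⇒< (p 0) (≢ ∘ sym)) (q 0)) (grow (applyUpTo-vstrip c (p ∘ suc) (q ∘ suc)))

conj-hstrip : ∀ c {κ ν} → HStrip κ ν → VStrip (conj c κ) (conj c ν)
conj-hstrip c h = applyUpTo-vstrip c (hstrip-≥ h) (hstrip-≤ h)

-- Semistandard tableaux without their largest letter

Tableau : Set
Tableau = List (List ℕ)

#-∑ : {A : Set} {P : A → Set} (E : Enumeration P) → # E ≡ ∑∈ E (λ _ → 1)
#-∑ {A} E = go (list E)
  where
  go : (xs : List A) → length xs ≡ sum (map (λ _ → 1) xs)
  go []       = refl
  go (x ∷ xs) = cong suc (go xs)

multiplicity-yes : ∀ i xs → multiplicity i (i ∷ xs) ≡ suc (multiplicity i xs)
multiplicity-yes i xs = cong length (filter-accept (i ≟_) refl)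

multiplicity-no : ∀ {i x} xs → i ≢ x → multiplicity i (x ∷ xs) ≡ multiplicity i xs
multiplicity-no xs ≢ = cong length (filter-reject (_ ≟_) ≢)

multiplicity-none : ∀ {i xs} → All (i ≢_) xs → multiplicity i xs ≡ 0
multiplicity-none a = cong length (filter-none (_ ≟_) a)

multiplicity-∈ : ∀ {i xs} → i ∈ xs → multiplicity i xs ≢ 0
multiplicity-∈ {i} {xs} i∈ eq with filter (i ≟_) xs | ∈-filter⁺ (i ≟_) i∈ refl
multiplicity-∈ i∈ () | _ ∷ _ | _

exponent-≥ : ∀ α {i} → length α ≤ i → exponent α i ≡ 0
exponent-≥ []      _       = refl
exponent-≥ (_ ∷ α) (s≤s l) = exponent-≥ α l

exponent-∷ʳ-< : ∀ α a {i} → i < length α → exponent (α ∷ʳ a) i ≡ exponent α i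
exponent-∷ʳ-< (b ∷ α) a {zero}  _       = refl
exponent-∷ʳ-< (b ∷ α) a {suc i} (s≤s p) = exponent-∷ʳ-< α a p

exponent-∷ʳ-≡ : ∀ α a → exponent (α ∷ʳ a) (length α) ≡ a
exponent-∷ʳ-≡ []      a = refl
exponent-∷ʳ-≡ (b ∷ α) a = exponent-∷ʳ-≡ α a

content-< : ∀ {α T} → HasContent α T → All (_< length α) (concat T)
content-< {α} {T} h = All.tabulate below
  where
  below : ∀ {i} → i ∈ concat T → i < length α
  below {i} i∈ with i <? length α
  ... | yes p = p
  ... | no ¬p = contradiction (trans (h i) (exponent-≥ α (≮⇒≥ ¬p))) (multiplicity-∈ i∈)

module _ (r : ℕ) where

  small : List ℕ → List ℕ
  small = filter (_<? r)

  small-yes : ∀ {x xs} → x < r → small (x ∷ xs) ≡ x ∷ small xs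
  small-yes = filter-accept (_<? r)

  small-no : ∀ {x xs} → ¬ x < r → small (x ∷ xs) ≡ small xs
  small-no = filter-reject (_<? r)

  small-concat : ∀ T → concat (map small T) ≡ small (concat T)
  small-concat []      = refl
  small-concat (R ∷ T) =
    trans (cong (small R ++_) (small-concat T)) (sym (filter-++ (_<? r) R (concat T)))

  multiplicity-small : ∀ {i} xs → i < r → multiplicity i (small xs) ≡ multiplicity i xs
  multiplicity-small []       p = refl
  multiplicity-small {i} (x ∷ xs) p with x <? r | i ≟ x
  ... | yes q | yes refl = trans (cong (multiplicity i) (small-yes q))
      (trans (multiplicity-yes x (small xs))
                             (trans (cong suc (multiplicity-small xs p))
                                 (sym (multiplicity-yes x xs))))
  ... | yes q | no ≢     = trans (cong (multiplicity i) (small-yes q))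
      (trans (multiplicity-no (small xs) ≢)
                             (trans (multiplicity-small xs p) (sym (multiplicity-no xs ≢))))
  ... | no ¬q | yes refl = contradiction p ¬q
  ... | no ¬q | no ≢     = trans (cong (multiplicity i) (small-no ¬q))
                             (trans (multiplicity-small xs p) (sym (multiplicity-no xs ≢)))

  multiplicity-small-≥ : ∀ {i} xs → r ≤ i → multiplicity i (small xs) ≡ 0
  multiplicity-small-≥ xs p =
    multiplicity-none (All.map (λ q → λ { refl → <-irrefl refl (<-≤-trans q p) })
        (All.all-filter (_<? r) xs))

  length-small : ∀ {xs} → All (_≤ r) xs → length xs ≡ length (small xs) + multiplicity r xs
  length-small []               = refl
  length-small {x ∷ xs} (p ∷ a) with x <? r | r ≟ x
  ... | yes q | yes refl = contradiction q (<-irrefl refl)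
  ... | yes q | no ≢     = trans (cong suc (length-small a))
                             (sym (cong₂ _+_ (cong length (small-yes q)) (multiplicity-no xs ≢)))
  ... | no ¬q | yes refl = trans (cong suc (length-small a)) (trans (sym (+-suc _ _))
                             (sym (cong₂ _+_ (cong length (small-no ¬q)) (multiplicity-yes r xs))))
  ... | no ¬q | no ≢     = contradiction (≤∧≢⇒< p (≢ ∘ sym)) ¬q

  small-split : ∀ {R} → Linked _≤_ R → All (_≤ r) R →
    R ≡ small R ++ replicate (length R ∸ length (small R)) r
  small-split {[]}    l a = refl
  small-split {x ∷ R} l (p ∷ a) with x <? r
  ... | yes q = trans (cong (x ∷_) (small-split (Linked.tail l) a))
                      (sym (cong (λ S → S ++ replicate (suc (length R) ∸ length S) r) (small-yes q)))
  ... | no ¬q with refl ← ≤-antisym p (≮⇒≥ ¬q) =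
    trans (cong (x ∷_) (all-r l a))
        (cong (λ S → S ++ replicate (suc (length R) ∸ length S) x) (sym (trans (small-no ¬q) none)))
    where
    ≥r : ∀ {R} → Linked _≤_ (x ∷ R) → All (x ≤_) R
    ≥r [-] = []
    ≥r (q ∷ l) = Linked.Linked⇒All ≤-trans q l
    none : small R ≡ []
    none = filter-none (_<? r) (All.map ≤⇒≯ (≥r l))
    all-r : ∀ {R} → Linked _≤_ (x ∷ R) → All (_≤ x) R → R ≡ replicate (length R) x
    all-r {[]}    l a = refl
    all-r {y ∷ R} (q ∷ l) (p ∷ a) with refl ← ≤-antisym p q = cong (y ∷_) (all-r l a)

  fill : List ℕ → ℕ → List ℕ
  fill R m = R ++ replicate (m ∸ length R) r

  length-fill : ∀ R {m} → length R ≤ m → length (fill R m) ≡ m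
  length-fill R {m} p =
    trans (length-++ R) (trans (cong (length R +_) (length-replicate (m ∸ length R))) (m+[n∸m]≡n p))

  small-fill : ∀ {R} m → All (_< r) R → small (fill R m) ≡ R
  small-fill {R} m a = trans (filter-++ (_<? r) R _) (trans (cong₂ _++_ (filter-all (_<? r) a)
    (filter-none (_<? r) (All.replicate⁺ (m ∸ length R) (<-irrefl refl)))) (++-identityʳ R))

  fill-≤ : ∀ {R} m → All (_< r) R → All (_≤ r) (fill R m)
  fill-≤ {R} m a = All.++⁺ (All.map <⇒≤ a) (All.replicate⁺ (m ∸ length R) ≤-refl)

  linked-replicate : ∀ m → Linked _≤_ (replicate m r)
  linked-replicate zero          = []
  linked-replicate (suc zero)    = [-]
  linked-replicate (suc (suc m)) = ≤-refl ∷ linked-replicate (suc m)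

  linked-fill : ∀ {R} m → Linked _≤_ R → All (_< r) R → Linked _≤_ (R ++ replicate m r)
  linked-fill m       []      []      = linked-replicate m
  linked-fill zero    [-]     (p ∷ a) = [-]
  linked-fill (suc m) [-]     (p ∷ a) = <⇒≤ p ∷ linked-replicate (suc m)
  linked-fill m       (q ∷ l) (p ∷ a) = q ∷ linked-fill m l a

  zip-prefix : ∀ (xs ys : List ℕ) {us vs} → All (uncurry _<_) (zip (xs ++ us) (ys ++ vs)) →
    All (uncurry _<_) (zip xs ys)
  zip-prefix []       ys       a       = []
  zip-prefix (x ∷ xs) []       a       = []
  zip-prefix (x ∷ xs) (y ∷ ys) (p ∷ a) = p ∷ zip-prefix xs ys a

  -- The filled lower row is no longer than the unfilled upper row, so each new letter `r` stands
  -- below an old entry, which is smaller. Whatever is appended to the upper row has no cell below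
  -- it.
  zip-fill : ∀ {xs ys} us m → All (uncurry _<_) (zip xs ys) → All (_< r) xs →
    length ys + m ≤ length xs →
    All (uncurry _<_) (zip (xs ++ us) (ys ++ replicate m r))
  zip-fill {[]}     {[]} []       zero    a b l = []
  zip-fill {[]}     {[]} (u ∷ us) zero    a b l = []
  zip-fill {x ∷ xs} {[]} us zero    a b l = []
  zip-fill {x ∷ xs} {[]} us (suc m) a (p ∷ b) (s≤s l) = p ∷ zip-fill {xs} {[]} us m (empty xs) b l
    where
    empty : ∀ xs → All (uncurry _<_) (zip xs [])
    empty []       = []
    empty (x ∷ xs) = []
  zip-fill {x ∷ xs} {y ∷ ys} us m (q ∷ a) (p ∷ b) (s≤s l) = q ∷ zip-fill us m a b l

  -- An entry above an entry `≤ r` is itself `< r` and survives the filter. Hence the cells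
  -- containing `r` form a horizontal strip.
  zip-small : ∀ {xs ys} → All (uncurry _<_) (zip xs ys) → length ys ≤ length xs → All (_≤ r) ys →
    length ys ≤ length (small xs)
  zip-small {xs}     {[]}     a l b = z≤n
  zip-small {x ∷ xs} {y ∷ ys} (q ∷ a) (s≤s l) (p ∷ b) rewrite filter-accept (_<? r) {x} {xs}
      (<-≤-trans q p) = s≤s (zip-small a l b)

  small-columns : ∀ {T} → All (Linked _≤_) T → All (All (_≤ r)) T → Columns _<_ T →
    Columns _<_ (map small T)
  small-columns {[]}         ls as c = []
  small-columns {R ∷ []}     ls as c = [-]
  small-columns {R ∷ R′ ∷ T} (l ∷ ls@(l′ ∷ _)) (a ∷ as@(a′ ∷ _)) (q ∷ c) =
    zip-prefix (small R) (small R′)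
        (subst₂ (λ X Y → All (uncurry _<_) (zip X Y)) (small-split l a) (small-split l′ a′) q)
    ∷ small-columns ls as c

  small-hstrip : ∀ {T} → All (All (_≤ r)) T → Columns _<_ T → Decr (shape T) →
    HStrip (shape (map small T)) (shape T)
  small-hstrip {[]}         as c d = []
  small-hstrip {R ∷ []}     as c d = step (length-filter (_<? r) R) [] []
  small-hstrip {R ∷ R′ ∷ T} (a ∷ as@(a′ ∷ _)) (q ∷ c) (l ∷ d) =
    step (length-filter (_<? r) R) [ zip-small q l a′ ] (small-hstrip as c d)

  extend : Tableau → List ℕ → Tableau
  extend = zipWith fill

  extend-small : ∀ {T} → All (Linked _≤_) T → All (All (_≤ r)) T →
    extend (map small T) (shape T) ≡ T
  extend-small []       []       = refl
  extend-small (l ∷ ls) (a ∷ as) = cong₂ _∷_ (sym (small-split l a)) (extend-small ls as)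

  small-extend : ∀ {T μ} → HStrip (shape T) μ → All (All (_< r)) T → map small (extend T μ) ≡ T
  small-extend {[]}    []           []       = refl
  small-extend {R ∷ T} (step _ _ h) (a ∷ as) = cong₂ _∷_ (small-fill _ a) (small-extend h as)

  shape-extend : ∀ {T μ} → HStrip (shape T) μ → shape (extend T μ) ≡ μ
  shape-extend {[]}    []           = refl
  shape-extend {R ∷ T} (step p _ h) = cong₂ _∷_ (length-fill R p) (shape-extend h)

  extend-rows : ∀ {T μ} → All (Linked _≤_) T → All (All (_< r)) T → All (Linked _≤_) (extend T μ)
  extend-rows []       []       = []
  extend-rows {μ = []}    (l ∷ ls) (a ∷ as) = []
  extend-rows {μ = m ∷ μ} (l ∷ ls) (a ∷ as) = linked-fill _ l a ∷ extend-rows ls as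

  extend-≤ : ∀ {T μ} → All (All (_< r)) T → All (All (_≤ r)) (extend T μ)
  extend-≤ {μ = []}    []       = []
  extend-≤ {μ = []}    (a ∷ as) = []
  extend-≤ {μ = m ∷ μ} []       = []
  extend-≤ {μ = m ∷ μ} (a ∷ as) = fill-≤ m a ∷ extend-≤ as

  extend-columns : ∀ {T μ} → HStrip (shape T) μ → All (All (_< r)) T → Columns _<_ T →
    Columns _<_ (extend T μ)
  extend-columns {[]} [] as c = []
  extend-columns {R ∷ []} (step _ _ []) as c = [-]
  extend-columns {R ∷ R′ ∷ T} (step _ [ q ] h@(step p _ _)) (a ∷ as) (x ∷ c) =
    zip-fill _ _ x a (≤-trans (≤-reflexive (m+[n∸m]≡n p)) q) ∷ extend-columns h as c

sum-shape : (T : Tableau) → sum (shape T) ≡ length (concat T)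
sum-shape []      = refl
sum-shape (R ∷ T) = trans (cong (length R +_) (sum-shape T)) (sym (length-++ R))

costrips : ∀ μ a → Enumeration (λ κ → HStrip κ μ × sum μ ≡ sum κ + a)
costrips μ a = restrict (λ κ → hstrip? κ μ ×-dec sum μ ≟ sum κ + a)
  (λ { {κ} (h , s) → hstrip-length h , All.map (λ p → s≤s (≤-trans p (hstrip-sum h)))
      (entries≤sum κ) })
  (listed (length μ) (below-enum (suc (sum μ))))

-- The branching rule for Schur functions. The last exponent of `α ∷ʳ a` belongs to the largest
-- letter `length α`, which `small` deletes and `extend` puts back.
schur-∷ʳ : ∀ {μ} → Decr μ → ∀ α a → schur μ (α ∷ʳ a) ≡ ∑∈ (costrips μ a) (λ κ → schur κ α)
schur-∷ʳ {μ} d α a = begin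
  schur μ (α ∷ʳ a)                                              ≡⟨ #-∑ (semistandard μ (α ∷ʳ a)) ⟩
  ∑∈ (semistandard μ (α ∷ʳ a)) (λ _ → 1)
    ≡⟨ ∑-bij (semistandard μ (α ∷ʳ a)) (sigma (λ κ → semistandard κ α) (costrips μ a))
         (λ T → shape (map (small r) T) , map (small r) T) (λ (κ , T) → extend r T μ)
         to from (λ { (t , h) → trans (cong (extend r _) (sym (IsSSYT.hasShape t)))
             (extend-small r (IsSSYT.rows t) (entries≤ h)) })
         (λ { {κ , T} ((hs , _) , t , h) → let e = small-extend r (hstrip t hs) (entries< h) in
              cong₂ _,_ (trans (cong shape e) (IsSSYT.hasShape t)) e })
         (λ _ → refl) ⟩
  ∑∈ (sigma (λ κ → semistandard κ α) (costrips μ a)) (λ _ → 1)  ≡⟨ ∑-sigma (λ κ → semistandard κ α)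
      (costrips μ a) (λ _ _ → 1) ⟩
  ∑∈ (costrips μ a) (λ κ → ∑∈ (semistandard κ α) (λ _ → 1))     ≡⟨ ∑-cong (costrips μ a)
      (λ {κ} _ → #-∑ (semistandard κ α)) ⟨
  ∑∈ (costrips μ a) (λ κ → schur κ α)                           ∎
  where
  open ≡-Reasoning
  r = length α

  entries< : ∀ {T} → HasContent α T → All (All (_< r)) T
  entries< {T} h = All.concat⁻ (content-< {α} {T} h)

  entries≤ : ∀ {T} → HasContent (α ∷ʳ a) T → All (All (_≤ r)) T
  entries≤ {T} h =
    All.concat⁻ {xss = T} (All.map (λ p → ≤-pred
        (≤-trans p (≤-reflexive (trans (length-++ α) (+-comm r 1))))) (content-< {α ∷ʳ a} {T} h))

  hstrip : ∀ {κ T} → IsSSYT κ T → HStrip κ μ → HStrip (shape T) μ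
  hstrip t = subst (λ κ → HStrip κ μ) (sym (IsSSYT.hasShape t))

  to : ∀ {T} → IsSSYT μ T × HasContent (α ∷ʳ a) T →
       (HStrip (shape (map (small r) T)) μ × sum μ ≡ sum (shape (map (small r) T)) + a) ×
       IsSSYT (shape (map (small r) T)) (map (small r) T) × HasContent α (map (small r) T)
  to {T} (t , h) =
    (subst (HStrip _) hasShape (small-hstrip r (entries≤ h) columns
        (subst Decr (sym hasShape) d)) , sizes) ,
    record { hasShape = refl
           ; rows     = All.map⁺ (All.map (Linked.filter⁺ (_<? r) ≤-trans) rows)
           ; columns  = small-columns r rows (entries≤ h) columns } ,
    content
    where
    open IsSSYT t
    sizes : sum μ ≡ sum (shape (map (small r) T)) + a
    sizes = begin
      sum μ                                                  ≡⟨ cong sum hasShape ⟨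
      sum (shape T)                                          ≡⟨ sum-shape T ⟩
      length (concat T)                                      ≡⟨ length-small r
          (All.concat⁺ (entries≤ {T} h)) ⟩
      length (small r (concat T)) + multiplicity r (concat T)
        ≡⟨ cong₂ _+_ (cong length (sym (small-concat r T))) (trans (h r) (exponent-∷ʳ-≡ α a)) ⟩
      length (concat (map (small r) T)) + a                  ≡⟨ cong (_+ a)
          (sum-shape (map (small r) T)) ⟨
      sum (shape (map (small r) T)) + a                      ∎
    content : HasContent α (map (small r) T)
    content i rewrite small-concat r T with i <? r
    ... | yes p = trans (multiplicity-small r (concat T) p) (trans (h i) (exponent-∷ʳ-< α a p))
    ... | no ¬p = trans (multiplicity-small-≥ r (concat T) (≮⇒≥ ¬p)) (sym (exponent-≥ α (≮⇒≥ ¬p)))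

  from : ∀ {x} →
    (HStrip (proj₁ x) μ × sum μ ≡ sum (proj₁ x) + a) × IsSSYT (proj₁ x) (proj₂ x) × HasContent α
    (proj₂ x) →
    IsSSYT μ (extend r (proj₂ x) μ) × HasContent (α ∷ʳ a) (extend r (proj₂ x) μ)
  from {κ , T} ((hs , s) , t , h) =
    record { hasShape = shape-extend r hs′ ; rows = extend-rows r rows
        (entries< h) ; columns = extend-columns r hs′ (entries< h) columns } ,
    content
    where
    open IsSSYT t
    hs′ = hstrip t hs
    T′ = extend r T μ
    all≤ : All (_≤ r) (concat T′)
    all≤ = All.concat⁺ (extend-≤ r {T} {μ} (entries< h))
    smalls : small r (concat T′) ≡ concat T
    smalls = trans (sym (small-concat r T′)) (cong concat (small-extend r hs′ (entries< h)))
    top : multiplicity r (concat T′) ≡ a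
    top = +-cancelˡ-≡ (sum κ) _ _ (begin
      sum κ + multiplicity r (concat T′)           ≡⟨ cong
          (λ k → sum k + multiplicity r (concat T′)) hasShape ⟨
      sum (shape T) + multiplicity r (concat T′)   ≡⟨ cong (_+ multiplicity r (concat T′))
          (trans (sum-shape T) (cong length (sym smalls))) ⟩
      length (small r (concat T′)) + multiplicity r (concat T′) ≡⟨ length-small r all≤ ⟨
      length (concat T′)                           ≡⟨ sum-shape T′ ⟨
      sum (shape T′)                               ≡⟨ cong sum (shape-extend r hs′) ⟩
      sum μ                                        ≡⟨ s ⟩
      sum κ + a                                    ∎)
    content : HasContent (α ∷ʳ a) T′
    content i with <-cmp i r
    ... | tri< p _ _ = trans (sym (multiplicity-small r (concat T′) p))
        (trans (cong (multiplicity i) smalls) (trans (h i) (sym (exponent-∷ʳ-< α a p))))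
    ... | tri≈ _ refl _ = trans top (sym (exponent-∷ʳ-≡ α a))
    ... | tri> _ _ p = trans (multiplicity-none
        (All.map (λ q → λ { refl → <-irrefl refl (<-≤-trans p q) }) all≤))
                             (sym (exponent-≥ (α ∷ʳ a) (≤-trans
                                 (≤-reflexive (trans (length-++ α) (+-comm r 1))) p)))

∑-*ˡ : {A : Set} {P : A → Set} (E : Enumeration P) (k : ℕ) (w : A → ℕ) →
  k * ∑∈ E w ≡ ∑∈ E (λ x → k * w x)
∑-*ˡ E k w = trans (*-comm k _) (trans (sym (∑-*ʳ E w k)) (∑-cong E (λ {x} _ → *-comm (w x) k)))

-- Trailing zeros in the shape of a Schur function

zip-[] : ∀ {A B : Set} {P : A × B → Set} (xs : List A) → All P (Data.List.zip xs [])
zip-[] []       = []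
zip-[] (x ∷ xs) = []

columns-∷ʳ : ∀ {T : Tableau} → Columns _<_ T → Columns _<_ (T ∷ʳ [])
columns-∷ʳ []                   = [-]
columns-∷ʳ {R ∷ []} [-]         = zip-[] R ∷ [-]
columns-∷ʳ {R ∷ R′ ∷ T} (p ∷ c) = p ∷ columns-∷ʳ c

columns-init : ∀ {T : Tableau} → Columns _<_ (T ∷ʳ []) → Columns _<_ T
columns-init {[]}         c       = []
columns-init {R ∷ []}     c       = [-]
columns-init {R ∷ R′ ∷ T} (p ∷ c) = p ∷ columns-init c

concat-∷ʳ-[] : (T : Tableau) → concat (T ∷ʳ []) ≡ concat T
concat-∷ʳ-[] T = trans (sym (concat-++ T ([] ∷ []))) (++-identityʳ (concat T))

shape-init : ∀ (T : Tableau) μ → shape T ≡ μ ∷ʳ 0 →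
  take (length μ) T ∷ʳ [] ≡ T × shape (take (length μ) T) ≡ μ
shape-init ([] ∷ [])  []      eq = refl , refl
shape-init (R ∷ [])   (m ∷ []) ()
shape-init (R ∷ [])   (m ∷ _ ∷ _) ()
shape-init (R ∷ R′ ∷ T) []    eq with () ← proj₂ (∷-injective eq)
shape-init (R ∷ R′ ∷ T) (m ∷ μ) eq =
  let p , q = ∷-injective eq
      e , s = shape-init (R′ ∷ T) μ q
  in cong (R ∷_) e , cong₂ _∷_ p s

shape-∷ʳ : (T : Tableau) → shape (T ∷ʳ []) ≡ shape T ∷ʳ 0
shape-∷ʳ []      = refl
shape-∷ʳ (R ∷ T) = cong (length R ∷_) (shape-∷ʳ T)

schur-0 : ∀ μ α → schur (μ ∷ʳ 0) α ≡ schur μ α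
schur-0 μ α = trans (#-∑ (semistandard (μ ∷ʳ 0) α)) (trans
  (∑-bij (semistandard (μ ∷ʳ 0) α) (semistandard μ α) (take (length μ)) (_∷ʳ [])
    to from (λ { {T} (t , _) → proj₁ (shape-init T μ (IsSSYT.hasShape t)) })
    (λ { {T} (t , _) → proj₂ (∷ʳ-take T (IsSSYT.hasShape t)) }) (λ _ → refl))
  (sym (#-∑ (semistandard μ α))))
  where
  ∷ʳ-take : ∀ T → shape T ≡ μ → shape (T ∷ʳ []) ≡ μ ∷ʳ 0 × take (length μ) (T ∷ʳ []) ≡ T
  ∷ʳ-take T refl =
    shape-∷ʳ T , trans (cong (λ m → take m (T ∷ʳ [])) (length-map length T))
        (take-length-++ T ([] ∷ []))
  to : ∀ {T} → IsSSYT (μ ∷ʳ 0) T × HasContent α T →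
    IsSSYT μ (take (length μ) T) × HasContent α (take (length μ) T)
  to {T} (t , h) with e , s ← shape-init T μ (IsSSYT.hasShape t) =
    record { hasShape = s
           ; rows = proj₁ (All.∷ʳ⁻ (subst (All (Linked _≤_)) (sym e) rows))
           ; columns = columns-init (subst (Columns _<_) (sym e) columns) } ,
    λ i → trans (cong (multiplicity i)
        (trans (sym (concat-∷ʳ-[] (take (length μ) T))) (cong concat e))) (h i)
    where
    open IsSSYT t
  from : ∀ {T} → IsSSYT μ T × HasContent α T → IsSSYT (μ ∷ʳ 0) (T ∷ʳ []) × HasContent α (T ∷ʳ [])
  from {T} (t , h) =
    record { hasShape = proj₁
        (∷ʳ-take T hasShape) ; rows = All.∷ʳ⁺ rows [] ; columns = columns-∷ʳ columns } ,
    λ i → trans (cong (multiplicity i) (concat-∷ʳ-[] T)) (h i)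
    where open IsSSYT t

-- Shapes inside the proof carry zeros, which stand for empty rows, while the Schur functions of the
-- theorem are indexed by lists of positive parts.
schur-zeros : ∀ k μ α → schur (μ ++ replicate k 0) α ≡ schur μ α
schur-zeros zero    μ α = cong (λ ν → schur ν α) (++-identityʳ μ)
schur-zeros (suc k) μ α =
  trans (cong (λ ν → schur ν α) (sym (++-assoc μ (0 ∷ []) (replicate k 0))))
                                (trans (schur-zeros k (μ ∷ʳ 0) α) (schur-0 μ α))

-- Iterated vertical strips

IsPart : ℕ → ℕ → List ℕ → Set
IsPart m s ν = (length ν ≡ m × sum ν ≡ s) × Decr ν

parts : ∀ m s → Enumeration (IsPart m s)
parts m s = refine decr? (compositions m s)

hstrip-decrˡ : ∀ {κ ν} → HStrip κ ν → Decr κ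
hstrip-decrˡ []                                = []
hstrip-decrˡ (step _ _ [])                     = [-]
hstrip-decrˡ (step _ [ q ] h@(step p _ _)) = ≤-trans p q ∷ hstrip-decrˡ h

Covers : ℕ → List ℕ → List ℕ → Set
Covers a ν κ = Decr κ × VStrip κ ν × sum ν ≡ sum κ + a

covers : ∀ ν a → Enumeration (Covers a ν)
covers ν a = restrict (λ κ → decr? κ ×-dec vstrip? κ ν ×-dec sum ν ≟ sum κ + a)
  (λ { {κ} (_ , v , s) → vstrip-length v , All.map (λ p → s≤s (≤-trans p (vstrip-sum v)))
      (entries≤sum κ) })
  (listed (length ν) (below-enum (suc (sum ν))))

-- The number `m` bounds both the rows and, by `s ≤ m`, the columns. So `conj m` is an involution on
-- all shapes involved and exchanges the two kinds of strip.
schur-conj : ∀ {m s ν} → s ≤ m → IsPart m s ν → ∀ α a →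
             schur (conj m ν) (α ∷ʳ a) ≡ ∑∈ (covers ν a) (λ κ → schur (conj m κ) α)
schur-conj {m} {s} {ν} s≤m ((l , refl) , d) α a = trans (schur-∷ʳ (conj-decr m ν) α a)
  (∑-bij (costrips (conj m ν) a) (covers ν a) (conj m) (conj m) to from
    (λ p → conj-inv (trans (hstrip-length (proj₁ p)) (length-applyUpTo _ m))
        (hstrip-decrˡ (proj₁ p)) (costrip-≤ p))
    (λ (d′ , v , _) → conj-inv (trans (vstrip-length v) l) d′ (bounded (≤-trans (vstrip-sum v) s≤m)))
    (λ p → cong (λ κ → schur κ α) (sym
        (conj-inv (trans (hstrip-length (proj₁ p)) (length-applyUpTo _ m)) (hstrip-decrˡ (proj₁ p))
        (costrip-≤ p)))))
  where
  bounded : ∀ {κ} → sum κ ≤ m → All (_≤ m) κ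
  bounded {κ} p = All.map (λ q → ≤-trans q p) (entries≤sum κ)
  conj-inv : ∀ {κ} → length κ ≡ m → Decr κ → All (_≤ m) κ → conj m (conj m κ) ≡ κ
  conj-inv {κ} l d a = trans (cong (λ k → conj k (conj m κ)) (sym l)) (conj-involutive m d a)
  sum-ν : sum (conj m ν) ≡ sum ν
  sum-ν = sum-conj m {ν} (bounded s≤m)
  costrip-≤ : ∀ {κ} → HStrip κ (conj m ν) × sum (conj m ν) ≡ sum κ + a → All (_≤ m) κ
  costrip-≤ (h , _) = bounded (≤-trans (hstrip-sum h) (≤-trans (≤-reflexive sum-ν) s≤m))
  to : ∀ {κ} → HStrip κ (conj m ν) × sum (conj m ν) ≡ sum κ + a → Covers a ν (conj m κ)
  to {κ} p@(h , s) =
    conj-decr m κ , subst (VStrip (conj m κ)) (conj-inv l d (bounded s≤m)) (conj-hstrip m h) ,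
    trans (sym sum-ν) (trans s (cong (_+ a) (sym (sum-conj m (costrip-≤ p)))))
  from : ∀ {κ} → Covers a ν κ → HStrip (conj m κ) (conj m ν) × sum (conj m ν) ≡ sum (conj m κ) + a
  from {κ} (d , v , s) = conj-vstrip m v ,
    trans sum-ν (trans s (cong (_+ a) (sym (sum-conj m {κ} (bounded (≤-trans (vstrip-sum v) s≤m))))))

module _ (z : ℤ) (n : ℕ) where

  open Window z n

  iterate : Monomial → (Word → ℕ) → ℕ
  iterate []      f = f []
  iterate (a ∷ α) f = ∑∈ (affines a) (λ v → iterate α (λ w → f (v ++ w)))

  iterate-cong : ∀ α {f g : Word → ℕ} → (∀ w → f w ≡ g w) → iterate α f ≡ iterate α g
  iterate-cong []      h = h []
  iterate-cong (a ∷ α) h = ∑-cong (affines a) (λ {v} _ → iterate-cong α (λ w → h (v ++ w)))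

  -- The last factor is the one to split off, because the Pieri rules multiply by a word on the
  -- right.
  iterate-∷ʳ : ∀ α a f → iterate (α ∷ʳ a) f ≡ iterate α (affines a ▹ f)
  iterate-∷ʳ []      a f = ∑-cong (affines a) (λ {v} _ → cong f (++-identityʳ v))
  iterate-∷ʳ (b ∷ α) a f =
    ∑-cong (affines b) (λ {v} _ → trans (iterate-∷ʳ α a (λ w → f (v ++ w)))
    (iterate-cong α (λ u → ∑-cong (affines a) (λ {w} _ → cong f (sym (++-assoc v u w))))))

  zero-tableau : ∀ m P → All (IsRow n) P → shapes P ≡ replicate m 0 → P ≡ replicate m (zeroRow n)
  zero-tableau zero    []      []            eq = refl
  zero-tableau (suc m) (T ∷ P) ((l , _) ∷ r) eq =
    let o , eq′ = ∷-injective eq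
    in cong₂ _∷_ (trans (lefts-gaps T o) (cong (λ k → rights (gaps k)) l)) (zero-tableau m P r eq′)

  zero-⊵ : zeroRow n ⊵ zeroRow n
  zero-⊵ = _ , tab-gaps 0 n (zeroRow n) (proj₁ (zero-isRow n))

  zero-linked : ∀ m → Linked _⊵_ (replicate m (zeroRow n))
  zero-linked zero          = []
  zero-linked (suc zero)    = [-]
  zero-linked (suc (suc m)) = zero-⊵ ∷ zero-linked (suc m)

  zero-shapes : ∀ m → shapes (replicate m (zeroRow n)) ≡ replicate m 0
  zero-shapes zero    = refl
  zero-shapes (suc m) = cong₂ _∷_ (zero-ones n) (zero-shapes m)

  zero-word : ∀ m → word z (replicate m (zeroRow n)) ≡ []
  zero-word zero    = refl
  zero-word (suc m) = cong₂ _++_ (zero-word m) (zero-letters n z)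

  N-zero : ∀ m f → N (replicate m 0) f ≡ f []
  N-zero m f = trans
    (∑-⇔ (tableaux (replicate m 0)) (singleton (replicate m (zeroRow n)))
      (λ {P} (r , _ , s) → sym (zero-tableau m P r s))
      (λ { refl → All.replicate⁺ m (zero-isRow n) , zero-linked m , zero-shapes m })
      (λ P → f (word z P)))
    (trans (+-identityʳ _) (cong f (zero-word m)))

  -- With the monomial written in reverse, structural induction removes its last exponent: the last
  -- factor on one side and the largest letter of the semistandard tableaux on the other. The
  -- removed factor is absorbed into the weight, which is why `f` ranges over all invariant
  -- functions.
  ∑-iterate : ∀ m αs → sum αs ≤ m → ∀ {f} → Invariant f →
    iterate (reverse αs) f ≡ ∑∈ (parts m (sum αs)) (λ ν → schur (conj m ν) (reverse αs) * N ν f)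
  ∑-iterate m [] fits {f} inv = sym (begin
    ∑∈ (parts m 0) (λ ν → schur (conj m ν) [] * N ν f)
      -- Only the zero shape is left. Its Schur coefficient at the empty monomial is 1, and its only
      -- tableau has the empty reading word.
      ≡⟨ ∑-⇔ (parts m 0) (singleton (replicate m 0)) (λ { {ν} ((l , s) , _) → sym (sum-zero l s) })
           (λ { refl → (length-replicate m , sum-replicate m) , decr-replicate m }) _ ⟩
    schur (conj m (replicate m 0)) [] * N (replicate m 0) f + 0
      ≡⟨ +-identityʳ _ ⟩
    schur (conj m (replicate m 0)) [] * N (replicate m 0) f
      ≡⟨ cong₂ _*_ (trans (cong (λ μ → schur μ []) (conj-zero m)) (schur-zeros m [] []))
          (N-zero m f) ⟩
    1 * f []
      ≡⟨ *-identityˡ _ ⟩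
    f [] ∎)
    where
    open ≡-Reasoning
    sum-zero : ∀ {m ν} → length ν ≡ m → sum ν ≡ 0 → ν ≡ replicate m 0
    sum-zero {zero}  {[]}       l s = refl
    sum-zero {suc m} {zero ∷ ν} l s = cong (0 ∷_) (sum-zero (suc-injective l) s)
    sum-replicate : ∀ m → sum (replicate m 0) ≡ 0
    sum-replicate zero    = refl
    sum-replicate (suc m) = sum-replicate m
    decr-replicate : ∀ m → Decr (replicate m 0)
    decr-replicate zero          = []
    decr-replicate (suc zero)    = [-]
    decr-replicate (suc (suc m)) = z≤n ∷ decr-replicate (suc m)
    exceeding-zero : ∀ j m → exceeding j (replicate m 0) ≡ 0
    exceeding-zero j zero    = refl
    exceeding-zero j (suc m) =
      trans (exceeding-∷ j 0 (replicate m 0))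
          (cong₂ _+_ (bracket-no {j} {0} λ ()) (exceeding-zero j m))
    applyUpTo-zero : ∀ c {g : ℕ → ℕ} → (∀ j → g j ≡ 0) → applyUpTo g c ≡ replicate c 0
    applyUpTo-zero zero    h = refl
    applyUpTo-zero (suc c) h = cong₂ _∷_ (h 0) (applyUpTo-zero c (λ j → h (suc j)))
    conj-zero : ∀ m → conj m (replicate m 0) ≡ replicate m 0
    conj-zero m = applyUpTo-zero m (λ j → exceeding-zero j m)
  ∑-iterate m (a ∷ αs) fits {f} inv = begin
    iterate (reverse (a ∷ αs)) f
      ≡⟨ cong (λ α → iterate α f) (unfold-reverse a αs) ⟩
    iterate (α ∷ʳ a) f
      ≡⟨ iterate-∷ʳ α a f ⟩
    iterate α (affines a ▹ f)
      ≡⟨ ∑-iterate m αs (≤-trans (m≤n+m _ a) fits) (▹-invariant (affines a) inv) ⟩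
    ∑∈ (parts m total) (λ κ → V κ * N κ (affines a ▹ f))
      ≡⟨ ∑-cong (parts m total) (λ { {κ} ((l , t) , d) → trans
           (cong (V κ *_) (∑-affines z n a κ d
               (subst₂ _≤_ (trans (+-comm a total) (cong (_+ a) (sym t))) (sym l) fits) inv))
           (∑-*ˡ (vstrips κ a) (V κ) (λ ν → N ν f)) }) ⟩
    ∑∈ (parts m total) (λ κ → ∑∈ (vstrips κ a) (λ ν → V κ * N ν f))
      ≡⟨ ∑-sigma (λ κ → vstrips κ a) (parts m total) (λ κ ν → V κ * N ν f) ⟨
    ∑∈ (sigma (λ κ → vstrips κ a) (parts m total)) (λ (κ , ν) → V κ * N ν f)
      -- The same vertical strips are now indexed by the larger shape first, so that the inner sum
      -- becomes the one in `schur-conj`.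
      ≡⟨ ∑-bij (sigma (λ κ → vstrips κ a) (parts m total))
          (sigma (λ ν → covers ν a) (parts m (a + total))) swap swap
           (λ { {κ , ν} (((l , t′) , d) , v , d′ , t) → ((trans (sym (vstrip-length v)) l , trans t
               (trans (cong (_+ a) t′) (+-comm total a))) , d′) , d , v , t })
           (λ { {ν , κ} (((l , t) , d′) , d , v , t′) →
             ((trans (vstrip-length v) l , +-cancelʳ-≡ a _ _
                 (trans (sym t′) (trans t (+-comm a total)))) , d) , v , d′ , t′ })
           (λ _ → refl) (λ _ → refl) (λ _ → refl) ⟩
    ∑∈ (sigma (λ ν → covers ν a) (parts m (a + total))) (λ (ν , κ) → V κ * N ν f)
      ≡⟨ ∑-sigma (λ ν → covers ν a) (parts m (a + total)) (λ ν κ → V κ * N ν f) ⟩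
    ∑∈ (parts m (a + total)) (λ ν → ∑∈ (covers ν a) (λ κ → V κ * N ν f))
      ≡⟨ ∑-cong (parts m (a + total)) (λ {ν} p → trans (∑-*ʳ (covers ν a) V (N ν f))
           (cong (_* N ν f) (trans (sym (schur-conj fits p α a))
               (cong (schur (conj m ν)) (sym (unfold-reverse a αs)))))) ⟩
    ∑∈ (parts m (a + total)) (λ ν → schur (conj m ν) (reverse (a ∷ αs)) * N ν f) ∎
    where
    open ≡-Reasoning
    total = sum αs
    α = reverse αs
    V : List ℕ → ℕ
    V κ = schur (conj m κ) α

-- Dyck tableaux as padded lists of bit strings

_↭?_ : (u v : Word) → Dec (u ↭ v)
[]      ↭? []      = yes ↭-refl
[]      ↭? (_ ∷ _) = no λ p → contradiction (↭.↭-length p) λ ()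
(x ∷ u) ↭? v with x ∈? v
... | no x∉ = no λ p → x∉ (↭.∈-resp-↭ p (here refl))
... | yes x∈ with v₁ , v₂ , refl ← ∈-∃++ x∈ =
  map′ (λ p → ↭-trans (prep x p) (↭-sym (↭.shift x v₁ v₂)))
       (λ p → ↭.drop-∷ (↭-trans p (↭.shift x v₁ v₂)))
       (u ↭? (v₁ ++ v₂))

indicator : {P : Set} → Dec P → ℕ
indicator (yes _) = 1
indicator (no _)  = 0

indicator-yes : {P : Set} (P? : Dec P) → P → indicator P? ≡ 1
indicator-yes (yes _) p = refl
indicator-yes (no ¬p) p = contradiction p ¬p

indicator-no : {P : Set} (P? : Dec P) → ¬ P → indicator P? ≡ 0
indicator-no (yes p) ¬p = contradiction p ¬p
indicator-no (no _)  ¬p = refl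

indicator-⇔ : {P Q : Set} (P? : Dec P) (Q? : Dec Q) → (P → Q) → (Q → P) →
  indicator P? ≡ indicator Q?
indicator-⇔ (yes p) Q? f g = sym (indicator-yes Q? (f p))
indicator-⇔ (no ¬p) Q? f g = sym (indicator-no Q? (¬p ∘ g))

_≼_ : ℤ → ℤ → Set
x ≼ y = x ℤ.≤ y ℤ.+ 1ℤ

Aligned : Word → Word → Set
Aligned u v = All (uncurry _≼_) (zip u v)

length-∷ʳ : ∀ p (z : ℤ) → length (p ∷ʳ z) ≡ suc (length p)
length-∷ʳ []      z = refl
length-∷ʳ (_ ∷ p) z = cong suc (length-∷ʳ p z)

-- p lists the entries of B that are not yet compared with an entry of A.
tab-aligned : ∀ p z {A B e} → Tab (suc (length p)) A B (suc e) → All (ℤ._≤ z) p →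
  Aligned (p ++ letters z B) (letters z A)
aligned-step : ∀ p z {A B e} → Tab (suc (length p)) A B (suc e) → All (ℤ._≤ z) p →
  Aligned (p ++ letters (z ℤ.+ 1ℤ) B) (letters (z ℤ.+ 1ℤ) A)
snoc-aligned : ∀ p z {A B e} → Tab (suc (suc (length p))) A B (suc e) → All (ℤ._≤ z) p →
  Aligned ((p ∷ʳ z) ++ letters (z ℤ.+ 1ℤ) B) (letters (z ℤ.+ 1ℤ) A)

tab-aligned p z done        a = zip-[] (p ++ [])
tab-aligned p z (neither t) a = aligned-step p z t a
tab-aligned p z {O ∷ A} {I ∷ B} (upper t) a =
  subst (λ w → Aligned w (letters (z ℤ.+ 1ℤ) A)) (∷ʳ-++ p z _) (snoc-aligned p z t a)
tab-aligned []      z (lower (upper t)) a = ℤ.≤-refl ∷ aligned-step [] (z ℤ.+ 1ℤ) t []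
tab-aligned (q ∷ p) z (lower t) (b ∷ a) = ℤ.≤-trans b (ℤ.<⇒≤ (i<i+1 z)) ∷ aligned-step p z t a
tab-aligned []      z (both t) a = ℤ.<⇒≤ (i<i+1 z) ∷ aligned-step [] z t []
tab-aligned (q ∷ p) z {I ∷ A} {I ∷ B} (both t) (b ∷ a) =
  ℤ.≤-trans b (ℤ.<⇒≤ (i<i+1 z)) ∷ subst (λ w → Aligned w (letters (z ℤ.+ 1ℤ) A)) (∷ʳ-++ p z _)
      (snoc-aligned p z t a)

aligned-step p z t a =
  tab-aligned p (z ℤ.+ 1ℤ) t (All.map (λ q → ℤ.≤-trans q (ℤ.<⇒≤ (i<i+1 z))) a)
snoc-aligned p z {A} {B} {e} t a =
  aligned-step (p ∷ʳ z) z (subst (λ k → Tab (suc k) A B (suc e)) (sym (length-∷ʳ p z)) t)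
      (All.∷ʳ⁺ a ℤ.≤-refl)

-- Since `zip` ignores entries of `A` without a partner in `B`, the bound on `ones A` has to be
-- assumed. `Chain A` supplies the empty bit after an entry that brings the counter to 0.
aligned-tab : ∀ p z {A B} → Chain A → length A ≡ length B → ones A ≤ length p + ones B →
              Aligned (p ++ letters z B) (letters z A) → ∃ λ e → Tab (suc (length p)) A B (suc e)
aligned-tab p z {[]} {[]} c l o a = length p , done
aligned-tab p z {O ∷ A} {O ∷ B} (O∷ c) l o a =
  let e , t = aligned-tab p (z ℤ.+ 1ℤ) c (suc-injective l) o a in e , neither t
aligned-tab p z {O ∷ A} {I ∷ B} (O∷ c) l o a =
  let e , t = aligned-tab (p ∷ʳ z) (z ℤ.+ 1ℤ) c (suc-injective l)
        (≤-trans o (≤-reflexive (trans (+-suc (length p) (ones B))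
        (cong (_+ ones B) (sym (length-∷ʳ p z))))))
                (subst (λ w → Aligned w (letters (z ℤ.+ 1ℤ) A)) (sym (∷ʳ-++ p z _)) a)
  in e , upper (subst (λ k → Tab (suc k) A B (suc e)) (length-∷ʳ p z) t)
aligned-tab [] z {I ∷ O ∷ A} {O ∷ I ∷ B} (I∷ c) l (s≤s o) (_ ∷ a) =
  let e , t = aligned-tab [] (z ℤ.+ 1ℤ ℤ.+ 1ℤ) c (suc-injective (suc-injective l)) o a in e , lower
        (upper t)
-- The partner of the entry `z` exists by the bound on `ones A`, but here it would be at least
-- `z + 2`.
aligned-tab [] z {I ∷ O ∷ A} {O ∷ O ∷ B} (I∷ c) l o a =
  contradiction a (late (letters≥ (z ℤ.+ 1ℤ ℤ.+ 1ℤ) B) (some B o))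
  where
  some : ∀ {z} B → suc (ones A) ≤ ones B → 0 < length (letters z B)
  some (O ∷ B) o = some B o
  some (I ∷ B) o = s≤s z≤n
  late : ∀ {w v} → All (z ℤ.+ 1ℤ ℤ.+ 1ℤ ℤ.≤_) w → 0 < length w → ¬ Aligned w (z ∷ v)
  late (p ∷ _) _ (q ∷ _) = ℤ.<-irrefl refl (ℤ.<-≤-trans (i<i+1 (z ℤ.+ 1ℤ)) (ℤ.≤-trans p q))
aligned-tab (q ∷ p) z {I ∷ A} {O ∷ B} c l (s≤s o) (_ ∷ a) =
  let e , t = aligned-tab p (z ℤ.+ 1ℤ) (tail-chain c) (suc-injective l) o a in e , lower t
aligned-tab [] z {I ∷ A} {I ∷ B} c l (s≤s o) (_ ∷ a) =
  let e , t = aligned-tab [] (z ℤ.+ 1ℤ) (tail-chain c) (suc-injective l) o a in e , both t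
aligned-tab (q ∷ p) z {I ∷ A} {I ∷ B} c l (s≤s o) (_ ∷ a) =
  let e , t = aligned-tab (p ∷ʳ z) (z ℤ.+ 1ℤ) (tail-chain c) (suc-injective l)
        (≤-trans o (≤-reflexive (trans (+-suc (length p) (ones B))
        (cong (_+ ones B) (sym (length-∷ʳ p z))))))
                (subst (λ w → Aligned w (letters (z ℤ.+ 1ℤ) A)) (sym (∷ʳ-++ p z _)) a)
  in e , both (subst (λ k → Tab (suc k) A B (suc e)) (length-∷ʳ p z) t)

RR-∷ : ∀ R (T : List Word) → RR (R ∷ T) ≡ RR T ++ R
RR-∷ R T = begin
  concat (reverse (R ∷ T))          ≡⟨ cong concat (unfold-reverse R T) ⟩
  concat (reverse T ∷ʳ R)           ≡⟨ concat-++ (reverse T) (R ∷ []) ⟨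
  RR T ++ (R ++ [])                 ≡⟨ cong (RR T ++_) (++-identityʳ R) ⟩
  RR T ++ R                         ∎
  where open ≡-Reasoning

RR-↭ : (T : List Word) → concat T ↭ RR T
RR-↭ []      = ↭-refl
RR-↭ (R ∷ T) =
  subst (R ++ concat T ↭_) (sym (RR-∷ R T)) (↭-trans (↭.++⁺ˡ R (RR-↭ T)) (↭.++-comm R (RR T)))

⊵-ones : ∀ {R R′} → R ⊵ R′ → ones R′ ≤ ones R
⊵-ones {R} {R′} (e , t) =
  subst (ones R′ ≤_) (sym (suc-injective (tab-ones t))) (m≤n+m (ones R′) e)

shapes-decr : ∀ {P} → Linked _⊵_ P → Decr (shapes P)
shapes-decr []      = []
shapes-decr [-]     = [-]
shapes-decr (p ∷ l) = ⊵-ones p ∷ shapes-decr l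

Zip≼ : List Word → Set
Zip≼ = Columns _≼_

-- Removing and restoring the empty rows

module _ (z : ℤ) (n : ℕ) where

  open Window z n

  consNonempty : Word → List Word → List Word
  consNonempty []      T = T
  consNonempty (x ∷ w) T = (x ∷ w) ∷ T

  trim : List Row → List Word
  trim []      = []
  trim (R ∷ P) = consNonempty (letters z R) (trim P)

  pad : ℕ → List Word → List Row
  pad zero    T       = []
  pad (suc m) []      = zeroRow n ∷ pad m []
  pad (suc m) (R ∷ T) = bits n z R ∷ pad m T

  pad-[] : ∀ m → pad m [] ≡ replicate m (zeroRow n)
  pad-[] zero    = refl
  pad-[] (suc m) = cong (zeroRow n ∷_) (pad-[] m)

  trim-RR : ∀ P → RR (trim P) ≡ word z P
  trim-RR []      = refl
  trim-RR (R ∷ P) with letters z R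
  ... | []    = trans (trim-RR P) (sym (++-identityʳ _))
  ... | x ∷ w = trans (RR-∷ (x ∷ w) (trim P)) (cong (_++ (x ∷ w)) (trim-RR P))

  length-letters : ∀ {R} → IsRow n R → length (letters z R) ≡ ones R
  length-letters (_ , c) = proj₂ (proj₂ (chain-letters z c))

  -- An empty row has no cell in any column, so column lengths do not see the padding.
  exceeding-trim : ∀ {P} → All (IsRow n) P →
    ∀ j → exceeding j (shapes P) ≡ exceeding j (shape (trim P))
  exceeding-trim {[]}    []       j = refl
  exceeding-trim {R ∷ P} (r ∷ rs) j with letters z R | length-letters r
  ... | []    | eq = trans (exceeding-∷ j (ones R) (shapes P))
                       (trans (cong (_+ exceeding j (shapes P))
                           (bracket-no {j} {ones R} (λ p → n≮0 (subst (j <_) (sym eq) p))))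
                           (exceeding-trim rs j))
  ... | x ∷ w | eq = trans (exceeding-∷ j (ones R) (shapes P))
                       (trans (cong₂ _+_ (cong [ j <_]ᵇ (sym eq)) (exceeding-trim rs j))
                           (sym (exceeding-∷ j (length (x ∷ w)) (shape (trim P)))))

  -- Lengths decrease weakly along `⊵`, so empty rows occur only at the bottom. Hence `trim` forgets
  -- nothing but their number, which `pad` is told.
  zeros-below : ∀ {R P} → ones R ≡ 0 → Linked _⊵_ (R ∷ P) →
    shapes (R ∷ P) ≡ replicate (suc (length P)) 0
  zeros-below eq [-]     = cong (_∷ []) eq
  zeros-below eq (p ∷ l) = cong₂ _∷_ eq (zeros-below (n≤0⇒n≡0 (subst (_ ≤_) eq (⊵-ones p))) l)

  trim-zeros : ∀ m → trim (replicate m (zeroRow n)) ≡ []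
  trim-zeros zero    = refl
  trim-zeros (suc m) rewrite zero-letters n z = trim-zeros m

  all-zero : ∀ {R P} → All (IsRow n) (R ∷ P) → Linked _⊵_ (R ∷ P) → ones R ≡ 0 →
    R ∷ P ≡ replicate (suc (length P)) (zeroRow n)
  all-zero {R} {P} rs l eq = zero-tableau z n (suc (length P)) (R ∷ P) rs (zeros-below eq l)

  pad-trim : ∀ {P} → All (IsRow n) P → Linked _⊵_ P → pad (length P) (trim P) ≡ P
  pad-trim {[]}    rs l = refl
  pad-trim {R ∷ P} (r ∷ rs) l with letters z R in eqR | length-letters r
  ... | []    | eq = trans (cong (pad (suc (length P)))
      (trans (sym trim≡) (trans (cong trim zs) (trim-zeros (suc (length P))))))
                           (trans (pad-[] (suc (length P))) (sym zs))
    where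
    zs = all-zero (r ∷ rs) l (sym eq)
    trim≡ : trim (R ∷ P) ≡ trim P
    trim≡ rewrite eqR = refl
  ... | x ∷ w | eq = cong₂ _∷_ (trans (cong (bits n z) (sym eqR))
      (trans (cong (λ m → bits m z (letters z R)) (sym (proj₁ r))) (bits-letters z R)))
                           (pad-trim rs (Linked.tail l))

  trim-∷ : ∀ {R P x w} → letters z R ≡ x ∷ w → All (IsRow n) (R ∷ P) → Linked _⊵_ (R ∷ P) →
           Linked _≥_ (shape (trim P)) → Zip≼ (trim P) →
           Linked _≥_ (shape ((x ∷ w) ∷ trim P)) × Zip≼ ((x ∷ w) ∷ trim P)
  trim-∷ {R} {[]} eq rs l d c = [-] , [-]
  trim-∷ {R} {R′ ∷ P} {x} {w} eq (r ∷ rs@(r′ ∷ _)) ((e , t) ∷ l) d c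
    with letters z R′ in eq′ | length-letters r′ | tab-aligned [] z t []
  ... | [] | o | _ = subst (λ T → Linked _≥_ (shape ((x ∷ w) ∷ T)) × Zip≼ ((x ∷ w) ∷ T)) (sym empty)
      ([-] , [-])
    where
    empty : trim P ≡ []
    empty =
      trans (sym trim≡) (trans (cong trim (all-zero rs l (sym o))) (trim-zeros (suc (length P))))
      where
      trim≡ : trim (R′ ∷ P) ≡ trim P
      trim≡ rewrite eq′ = refl
  ... | x′ ∷ w′ | o | a =
    subst₂ _≤_ (sym o) (trans (sym (length-letters r)) (cong length eq)) (⊵-ones (e , t)) ∷ d ,
    subst (λ u → Aligned u (x′ ∷ w′)) eq a ∷ c

  trim-tableau : ∀ {P} → All (IsRow n) P → Linked _⊵_ P → IsDyckTableau (trim P)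
  trim-tableau {[]} rs l = record { nonempty = [] ; decreasing = [] ; rows = [] ; columns = [] }
  trim-tableau {R ∷ P} (r ∷ rs) l with letters z R in eqR | chain-letters z (proj₂ r)
  ... | []    | _ = trim-tableau rs (Linked.tail l)
  ... | x ∷ w | d , _ = record
    { nonempty   = s≤s z≤n ∷ nonempty
    ; decreasing = proj₁ linked
    ; rows       = d ∷ rows
    ; columns    = proj₂ linked
    }
    where
    open IsDyckTableau (trim-tableau rs (Linked.tail l))
    linked = trim-∷ eqR (r ∷ rs) l decreasing columns

  length-pad : ∀ m T → length (pad m T) ≡ m
  length-pad zero    T       = refl
  length-pad (suc m) []      = cong suc (length-pad m [])
  length-pad (suc m) (R ∷ T) = cong suc (length-pad m T)

  rows-pad-[] : ∀ m → All (IsRow n) (pad m [])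
  rows-pad-[] m = subst (All (IsRow n)) (sym (pad-[] m))
    (All.replicate⁺ m (zero-isRow n))

  pad-rows : ∀ m {T} → All DualDyck T → All (All In) T → All (IsRow n) (pad m T)
  pad-rows zero            ds       as       = []
  pad-rows (suc m) {[]}    ds       as       = rows-pad-[] (suc m)
  pad-rows (suc m) {R ∷ T} (d ∷ ds) (a ∷ as) = proj₂ (letters-bits n z R a d) ∷ pad-rows m ds as

  ⊵-zero : ∀ {R} → IsRow n R → R ⊵ zeroRow n
  ⊵-zero {R} (l , _) = _ , tab-gaps 0 n R l

  pad-linked : ∀ m {T} → IsDyckTableau T → All (All In) T → Linked _⊵_ (pad m T)
  pad-linked m {[]} t as = subst (Linked _⊵_) (sym (pad-[] m)) (zero-linked z n m)
  pad-linked zero {R ∷ T} t as = []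
  pad-linked (suc zero) {R ∷ T} t as = [-]
  pad-linked (suc (suc m)) {R ∷ []} t (a ∷ []) =
    ⊵-zero (proj₂ (letters-bits n z R a (All.head (IsDyckTableau.rows t)))) ∷ subst (Linked _⊵_)
        (sym (pad-[] (suc m))) (zero-linked z n (suc m))
  pad-linked (suc (suc m)) {R ∷ R′ ∷ T}
    record { nonempty = _ ∷ ne ; decreasing = o ∷ de ; rows = d ∷ ds@(d′ ∷ _) ; columns = c ∷ cs }
        (a ∷ as@(a′ ∷ _)) =
    let e , r = letters-bits n z R a d
        e′ , r′ = letters-bits n z R′ a′ d′
    in aligned-tab [] z (proj₂ r′) (trans (proj₁ r′) (sym (proj₁ r)))
         (subst₂ _≤_ (trans (cong length (sym e′)) (length-letters r′))
             (trans (cong length (sym e)) (length-letters r)) o)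
         (subst₂ Aligned (sym e) (sym e′) c)
       ∷ pad-linked (suc m) record { nonempty = ne ; decreasing = de ; rows = ds ; columns = cs } as

  trim-pad : ∀ m {T} → IsDyckTableau T → All (All In) T → length T ≤ m → trim (pad m T) ≡ T
  trim-pad m {[]} t as l = trans (cong trim (pad-[] m)) (trim-zeros m)
  trim-pad (suc m) {R ∷ T} record { nonempty = p ∷ ne ; decreasing = de ; rows = d
      ∷ ds ; columns = cs } (a ∷ as) (s≤s l)
    rewrite proj₁ (letters-bits n z R a d) = trans (nonempty-∷ p) (cong (R ∷_)
      (trim-pad m record { nonempty = ne ; decreasing = Linked.tail de ; rows = ds ; columns = Linked.tail cs } as l))
    where
    nonempty-∷ : ∀ {R T} → 0 < length R → consNonempty R T ≡ R ∷ T
    nonempty-∷ {x ∷ w} p = refl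

  IsFactorization : Monomial → List Word → Set
  IsFactorization α F = map length F ≡ α × All (All In) F × All AffineDyck F

  facs : ∀ α → Enumeration (IsFactorization α)
  facs []      = record
    { list     = [] ∷ []
    ; unique   = [] ∷ []
    ; sound    = λ { (here refl) → refl , [] , [] }
    ; complete = λ { {[]} _ → here refl }
    }
  facs (a ∷ α) = transport (λ (v , F) → v ∷ F) split
    (λ (((l , w) , d) , m , ws , ds) → cong₂ _∷_ l m , w ∷ ws , d ∷ ds)
    (λ { {v ∷ F} (l , w ∷ ws , d ∷ ds) → let p , q = ∷-injective l in ((p , w) , d) , q , ws , ds })
    (λ _ → refl) (λ { {v ∷ F} _ → refl })
    (sigma (λ _ → facs α) (affines a))
    where
    split : List Word → Word × List Word
    split []      = [] , []
    split (v ∷ F) = v , F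

  ∑-facs : ∀ α f → ∑∈ (facs α) (λ F → f (concat F)) ≡ iterate z n α f
  ∑-facs []      f = +-identityʳ _
  ∑-facs (a ∷ α) f = begin
    ∑∈ (facs (a ∷ α)) (λ F → f (concat F))
      ≡⟨ cong sum (map-∘ (list E)) ⟨
    ∑∈ E (λ (v , F) → f (v ++ concat F))
      ≡⟨ ∑-sigma (λ _ → facs α) (affines a) (λ v F → f (v ++ concat F)) ⟩
    ∑∈ (affines a) (λ v → ∑∈ (facs α) (λ F → f (v ++ concat F)))
      ≡⟨ ∑-cong (affines a) (λ {v} _ → ∑-facs α (λ w → f (v ++ w))) ⟩
    iterate z n (a ∷ α) f ∎
    where
    open ≡-Reasoning
    E = sigma (λ _ → facs α) (affines a)

-- Unpadded conjugates, degrees and the choice of the window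

largest : List ℕ → ℕ
largest = foldr _⊔_ 0

≤-largest : ∀ μ → All (_≤ largest μ) μ
≤-largest []      = []
≤-largest (x ∷ μ) =
  m≤m⊔n x (largest μ) ∷ All.map (λ p → ≤-trans p (m≤n⊔m x (largest μ))) (≤-largest μ)

largest-≤-sum : ∀ μ → largest μ ≤ sum μ
largest-≤-sum []      = z≤n
largest-≤-sum (x ∷ μ) = ⊔-lub (m≤m+n x (sum μ)) (≤-trans (largest-≤-sum μ) (m≤n+m (sum μ) x))

conjugate-conj : ∀ μ → conjugate μ ≡ conj (largest μ) μ
conjugate-conj μ = map-upTo (λ j → exceeding j μ) (largest μ)

applyUpTo-+ : ∀ c k (g : ℕ → ℕ) → (∀ j → c ≤ j → g j ≡ 0) →
  applyUpTo g (c + k) ≡ applyUpTo g c ++ replicate k 0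
applyUpTo-+ zero    zero    g h = refl
applyUpTo-+ zero    (suc k) g h =
  cong₂ _∷_ (h 0 z≤n) (applyUpTo-+ zero k (g ∘ suc) (λ j _ → h (suc j) z≤n))
applyUpTo-+ (suc c) k       g h =
  cong (g 0 ∷_) (applyUpTo-+ c k (g ∘ suc) (λ j p → h (suc j) (s≤s p)))

exceeding-largest : ∀ μ {j} → largest μ ≤ j → exceeding j μ ≡ 0
exceeding-largest μ {j} p with exceeding j μ in eq
... | zero  = refl
... | suc _ = contradiction (exceeding-pos (≤-largest μ) (subst (0 <_) (sym eq) (s≤s z≤n))) (≤⇒≯ p)

schur-conjugate : ∀ {m} μ → sum μ ≡ m → ∀ α → schur (conj m μ) α ≡ schur (conjugate μ) α
schur-conjugate {m} μ refl α = trans (cong (λ ν → schur ν α) (begin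
  conj m μ                                                  ≡⟨ cong (λ c → conj c μ)
      (m+[n∸m]≡n (largest-≤-sum μ)) ⟨
  conj (largest μ + (m ∸ largest μ)) μ                      ≡⟨ applyUpTo-+ (largest μ) _ _
      (λ j → exceeding-largest μ) ⟩
  conj (largest μ) μ ++ replicate (m ∸ largest μ) 0         ≡⟨ cong
      (_++ replicate (m ∸ largest μ) 0) (conjugate-conj μ) ⟨
  conjugate μ ++ replicate (m ∸ largest μ) 0                ∎))
      (schur-zeros (m ∸ largest μ) (conjugate μ) α)
  where open ≡-Reasoning

-- The theorem sums over all Dyck tableaux with entries `S`, but chains of strips reach only shapes
-- with as many cells as the degree of the monomial. The other shapes have to be seen to contribute
-- 0.
schur-size : ∀ αs {μ} → Decr μ → sum μ ≢ sum αs → schur μ (reverse αs) ≡ 0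
schur-size [] {μ} d ≢ =
  trans (#-∑ (semistandard μ [])) (∑-zero (semistandard μ []) λ { {T} (t , h) →
  contradiction (trans (cong sum (sym (IsSSYT.hasShape t)))
      (trans (sum-shape T) (empty (content-< {[]} {T} h)))) ≢ })
  where
  empty : ∀ {xs : List ℕ} → All (_< 0) xs → length xs ≡ 0
  empty [] = refl
schur-size (a ∷ αs) {μ} d ≢ =
  trans (cong (schur μ) (unfold-reverse a αs)) (trans (schur-∷ʳ d (reverse αs) a)
  (∑-zero (costrips μ a) λ { {κ} (h , s) →
    schur-size αs (hstrip-decrˡ h) (λ eq → ≢
        (trans s (trans (+-comm (sum κ) a) (cong (λ k → a + k) eq)))) }))

conjugate-decr : ∀ μ → Decr (conjugate μ)
conjugate-decr μ = subst Decr (sym (conjugate-conj μ)) (conj-decr (largest μ) μ)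

sum-conjugate : ∀ μ → sum (conjugate μ) ≡ sum μ
sum-conjugate μ = trans (cong sum (conjugate-conj μ)) (sum-conj (largest μ) (≤-largest μ))

abs-bound : ∀ S → ∃ λ b → All (λ x → ℤ.∣ x ∣ ≤ b) S
abs-bound []      = 0 , []
abs-bound (x ∷ S) = let b , a = abs-bound S in
  ℤ.∣ x ∣ + b , m≤m+n ℤ.∣ x ∣ b ∷ All.map (λ p → ≤-trans p (m≤n+m b ℤ.∣ x ∣)) a

-- The integers from `-b` to `b` take `2b + 1` positions; one more is reserved for the final empty
-- bit.
abs-within : ∀ b x → ℤ.∣ x ∣ ≤ b → Within (ℤ.- pos b) (suc (suc (b + b))) x
abs-within b (pos m) p = b + m , s≤s (s≤s (+-monoʳ-≤ b p)) , sym (begin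
  ℤ.- pos b ℤ.+ (pos b ℤ.+ pos m)     ≡⟨ ℤ.+-assoc (ℤ.- pos b) (pos b) (pos m) ⟨
  ℤ.- pos b ℤ.+ pos b ℤ.+ pos m       ≡⟨ cong (ℤ._+ pos m) (ℤ.+-inverseˡ (pos b)) ⟩
  pos 0 ℤ.+ pos m                   ≡⟨ ℤ.+-identityˡ (pos m) ⟩
  pos m                           ∎)
  where open ≡-Reasoning
abs-within b -[1+ m ] p =
  b ∸ suc m , s≤s (s≤s (≤-trans (m∸n≤m b (suc m)) (m≤m+n b b))) , sym (begin
  ℤ.- pos b ℤ.+ pos (b ∸ suc m)                ≡⟨ cong (λ y → ℤ.- pos b ℤ.+ y)
      (trans (ℤ.⊖-≥ p) refl) ⟨
  ℤ.- pos b ℤ.+ (b ℤ.⊖ suc m)                ≡⟨ cong (λ y → ℤ.- pos b ℤ.+ y) (ℤ.m-n≡m⊖n b (suc m)) ⟨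
  ℤ.- pos b ℤ.+ (pos b ℤ.+ -[1+ m ])           ≡⟨ ℤ.+-assoc (ℤ.- pos b) (pos b) -[1+ m ] ⟨
  ℤ.- pos b ℤ.+ pos b ℤ.+ -[1+ m ]             ≡⟨ cong (ℤ._+ -[1+ m ]) (ℤ.+-inverseˡ (pos b)) ⟩
  pos 0 ℤ.+ -[1+ m ]                         ≡⟨ ℤ.+-identityˡ -[1+ m ] ⟩
  -[1+ m ]                                 ∎)
  where open ≡-Reasoning

window : ∀ S → ∃ λ z → ∃ λ n → All (Within z n) S
window S =
  let b , a = abs-bound S in ℤ.- pos b , suc (suc (b + b)) , All.map (λ {x} → abs-within b x) a

-- Comparison of coefficients

corollary3p20 : (S : List ℤ) (d : ℕ) →
    DS S d ≈ ∑ (dyckTableaux S d) (λ P → schur (conjugate (shape P)))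
corollary3p20 S d α = begin
  DS S d α
    ≡⟨ #-∑ (factorizations S d α) ⟩
  ∑∈ (factorizations S d α) (λ _ → 1)
    -- The conditions on content and `di` are traded for the invariant factor `f`, their indicator.
    -- The sum can then run over all words in the window, where the iterated Pieri rule applies.
    ≡⟨ ∑-cong (factorizations S d α)
        (λ {F} (p , e , _) → indicator-yes (Q? (concat F))
        (IsAffineDyckFactorization.rearranges p , e)) ⟨
  ∑∈ (factorizations S d α) (λ F → f (concat F))
    ≡⟨ ∑-⇔ (refine (Q? ∘ concat) (facs z len α)) (factorizations S d α)
         (λ ((l , ws , ds) , p , e) → record { rearranges = p ; affineDyck = ds } , e , l)
         (λ (p , e , l) → let open IsAffineDyckFactorization p in
           (l , All.concat⁻ (↭.All-resp-↭ (↭-sym rearranges) inS) , affineDyck) , rearranges , e)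
         (λ F → f (concat F)) ⟨
  ∑∈ (refine (Q? ∘ concat) (facs z len α)) (λ F → f (concat F))
    ≡⟨ ∑-refine (facs z len α) (Q? ∘ concat) (λ {F} _ → indicator-no (Q? (concat F))) ⟨
  ∑∈ (facs z len α) (λ F → f (concat F))
    ≡⟨ ∑-facs z len α f ⟩
  iterate z len α f
    ≡⟨ cong (λ β → iterate z len β f) (reverse-involutive α) ⟨
  iterate z len (reverse αs) f
    ≡⟨ ∑-iterate z len m αs ≤-refl inv ⟩
  ∑∈ (parts m m) (λ ν → schur (conj m ν) (reverse αs) * N ν f)
    ≡⟨ ∑-cong (parts m m) (λ {ν} _ → ∑-*ˡ (tableaux ν) (schur (conj m ν) (reverse αs))
        (λ P → f (word z P))) ⟩
  ∑∈ (parts m m) (λ ν → ∑∈ (tableaux ν) (λ P → schur (conj m ν) (reverse αs) * f (word z P)))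
    ≡⟨ ∑-sigma (tableaux) (parts m m) (λ ν P → schur (conj m ν) (reverse αs) * f (word z P)) ⟨
  ∑∈ E (λ (ν , P) → schur (conj m ν) (reverse αs) * f (word z P))
    ≡⟨ ∑-refine E (λ (ν , P) → Q? (word z P)) (λ { {ν , P} _ ¬q →
         trans (cong (schur (conj m ν) (reverse αs) *_) (indicator-no (Q? (word z P)) ¬q))
             (*-zeroʳ (schur (conj m ν) (reverse αs))) }) ⟩
  ∑∈ (refine (λ (ν , P) → Q? (word z P)) E) (λ (ν , P) → schur (conj m ν) (reverse αs) * f (word z P))
    -- Using `m` rows loses nothing, since a Dyck tableau with `m` cells has at most `m` nonempty
    -- rows.
    ≡⟨ ∑-bij (refine (λ (ν , P) → Q? (word z P)) E)
        (refine (λ T → sum (shape T) ≟ m) (dyckTableaux S d))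
         (λ (ν , P) → trim z len P) (λ T → shapes (pad z len m T) , pad z len m T)
         to from to-from from-to (λ { {ν , P} → weights {ν} {P} }) ⟩
  ∑∈ (refine (λ T → sum (shape T) ≟ m) (dyckTableaux S d))
      (λ T → schur (conjugate (shape T)) (reverse αs))
    ≡⟨ ∑-refine (dyckTableaux S d) (λ T → sum (shape T) ≟ m)
         (λ {T} _ ≢ → schur-size αs (conjugate-decr (shape T))
             (λ eq → ≢ (trans (sym (sum-conjugate (shape T))) eq))) ⟨
  ∑∈ (dyckTableaux S d) (λ T → schur (conjugate (shape T)) (reverse αs))
    ≡⟨ cong (λ β → ∑∈ (dyckTableaux S d) (λ T → schur (conjugate (shape T)) β))
        (reverse-involutive α) ⟩
  ∑ (dyckTableaux S d) (λ P → schur (conjugate (shape P))) α ∎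
  where
  open ≡-Reasoning
  z   = proj₁ (window S)
  len = proj₁ (proj₂ (window S))
  αs  = reverse α
  -- The degree of the monomial, which fixes the number of rows. If it differs from the length of
  -- `S`, both sides are 0.
  m   = sum αs

  open Window z len

  inS : All (Within z len) S
  inS = proj₂ (proj₂ (window S))

  Q : Word → Set
  Q w = w ↭ S × di w ≡ d

  Q? : ∀ w → Dec (Q w)
  Q? w = w ↭? S ×-dec di w ≟ d

  f : Word → ℕ
  f w = indicator (Q? w)

  inv : Invariant f
  inv {u} {v} (p , e) = indicator-⇔ (Q? u) (Q? v)
    (λ (q , e′) → ↭-trans (↭-sym p) q , trans (sym e) e′) (λ (q , e′) → ↭-trans p q , trans e e′)

  E = sigma (tableaux) (parts m m)

  Left : List ℕ × List Row → Set
  Left (ν , P) = (IsPart m m ν × IsTableau ν P) × Q (word z P)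

  Right : List Word → Set
  Right T = (IsDyckTableau T × concat T ↭ S × di (RR T) ≡ d) × sum (shape T) ≡ m

  within : ∀ {T} → concat T ↭ S → All (All (Within z len)) T
  within p = All.concat⁻ (↭.All-resp-↭ (↭-sym p) inS)

  fits : ∀ {T} → Right T → length T ≤ m
  fits {T} ((t , _) , s) = ≤-trans (go T (IsDyckTableau.nonempty t)) (≤-reflexive s)
    where
    go : ∀ (T : List Word) → All (λ R → 0 < length R) T → length T ≤ sum (shape T)
    go []      []       = z≤n
    go (R ∷ T) (p ∷ ps) = +-mono-≤ p (go T ps)

  length-concat : (T : List Word) → sum (shape T) ≡ length (concat T)
  length-concat []      = refl
  length-concat (R ∷ T) = trans (cong (λ k → length R + k) (length-concat T)) (sym (length-++ R))

  to : ∀ {x} → Left x → Right (trim z len (proj₂ x))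
  to {ν , P} ((((l , s) , _) , r , ls , refl) , p , e) =
    (trim-tableau z len r ls , ↭-trans (RR-↭ T) (subst (_↭ S) (sym (trim-RR z len P)) p) , trans
        (cong di (trim-RR z len P)) e) ,
    trans (length-concat T) (trans (↭.↭-length (RR-↭ T)) (trans (cong length (trim-RR z len P))
      (trans (length-word z P (All.map proj₂ r)) s)))
    where T = trim z len P

  from : ∀ {T} → Right T → Left (shapes (pad z len m T) , pad z len m T)
  from {T} t@((dt , p , e) , s) =
    (((trans (length-map ones padded)
        (length-pad z len m T) , sizes) , shapes-decr ls) , r , ls , refl) ,
    subst (_↭ S) RR≡ (↭-trans (↭-sym (RR-↭ T)) p) , trans (cong di (sym RR≡)) e
    where
    padded = pad z len m T
    r = pad-rows z len m (IsDyckTableau.rows dt) (within p)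
    ls = pad-linked z len m dt (within p)
    tp : trim z len padded ≡ T
    tp = trim-pad z len m dt (within p) (fits t)
    RR≡ : RR T ≡ word z padded
    RR≡ = trans (cong RR (sym tp)) (trim-RR z len padded)
    sizes : sum (shapes padded) ≡ m
    sizes = trans (sym (length-word z padded (All.map proj₂ r))) (trans (cong length (sym RR≡))
      (trans (sym (↭.↭-length (RR-↭ T))) (trans (sym (length-concat T)) s)))

  to-from : ∀ {x} → Left x →
    (shapes (pad z len m (trim z len (proj₂ x))) , pad z len m (trim z len (proj₂ x))) ≡ x
  to-from {ν , P} ((((l , _) , _) , r , ls , refl) , _) = cong (λ P → shapes P , P)
    (trans (cong (λ k → pad z len k (trim z len P)) (trans (sym l) (length-map ones P)))
        (pad-trim z len r ls))

  from-to : ∀ {T} → Right T → trim z len (pad z len m T) ≡ T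
  from-to t@((dt , p , _) , _) = trim-pad z len m dt (within p) (fits t)

  weights : ∀ {ν P} → Left (ν , P) →
    schur (conj m ν) (reverse αs) * f (word z P) ≡ schur (conjugate (shape (trim z len P)))
    (reverse αs)
  weights {ν} {P} x@(((_ , _) , r , ls , refl) , q) = begin
    schur (conj m ν) (reverse αs) * f (word z P)                ≡⟨ cong
        (schur (conj m ν) (reverse αs) *_) (indicator-yes (Q? (word z P)) q) ⟩
    schur (conj m ν) (reverse αs) * 1                           ≡⟨ *-identityʳ _ ⟩
    schur (conj m ν) (reverse αs)                               ≡⟨ cong (λ μ → schur μ (reverse αs))
        (conj-cong m (exceeding-trim z len r)) ⟩
    schur (conj m (shape (trim z len P))) (reverse αs)            ≡⟨ schur-conjugate
        (shape (trim z len P)) (proj₂ (to x)) (reverse αs) ⟩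
    schur (conjugate (shape (trim z len P))) (reverse αs)         ∎
    where
    conj-cong : ∀ c {g h : ℕ → ℕ} → (∀ j → g j ≡ h j) → applyUpTo g c ≡ applyUpTo h c
    conj-cong zero    e = refl
    conj-cong (suc c) e = cong₂ _∷_ (e 0) (conj-cong c (e ∘ suc))
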